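{- For every positive integer $n$, there exists a 2-dimensional $n$-bit adder tile assembly computer with average-case run time $O(\log n)$ and worst-case run time $O(\sqrt{n})$.
   Context: Abstract tile assembly model (aTAM) in $\mathbb{Z}^2$: tiles are unit squares with a glue type (with nonnegative integer strength) on each side and a label; assemblies are finite sets of translated tiles at distinct integer points; an assembly is $\tau$-stable if the min-cut of its bond graph (adjacent tiles joined with weight equal to the strength of a matching glue, $0$ if glues differ) is at least $\tau$; a tile attaches if the result stays $\tau$-stable. A tile system $(T,S,\tau)$ is deterministic (uniquely assembles $A$) if $A$ is its only terminal producible assembly. Parallel run time: with $\mathrm{PARALLEL}(A)$ the union of all assemblies obtained from $A$ by one attachment and $A\rightrightarrows A'$ meaning $A'=\mathrm{PARALLEL}(A)$, the run time is the $k$ with $S=A_1\rightrightarrows\cdots\rightrightarrows A_k$ terminal. Tile assembly computer (TAC) $(T,U,V,\tau)$: $T$ has exactly one tile $t_0$ labeled "0" and one $t_1$ labeled "1"; input template $U=(R,B)$ with $R$ an assembly over $T\setminus\{t_0,t_1\}$ and $B$ a sequence of unoccupied positions; $U_b$ places $t_{b_i}$ at $B(i)$; output template $V$ is a sequence of positions $C(i)$, and an assembly represents $c$ if the tile at $C(i)$ has label $c_i$. The TAC computes $f$ if for every input $b$, $(T,U_b,\tau)$ uniquely assembles an assembly representing $f(b)$. An $n$-bit adder TAC computes the $(n+1)$-bit binary sum of two $n$-bit numbers given as its $2n$ input bits. Run time on input $b$ is the parallel run time of $(T,U_b,\tau)$; worst case is the maximum over inputs, average case is the expectation over a uniformly random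 input in $\{0,1\}^{2n}$. A 2-dimensional TAC has all tiles and positions in $\mathbb{Z}^2$. -}

module Defs where

open import Data.Nat using (ℕ; zero; suc; _+_; _*_; _≤_; _<_; _≡ᵇ_)
open import Data.Nat.DivMod using (_/_; _%_)
open import Data.Integer as ℤ using (ℤ)
open import Data.Bool using (Bool; true; false; if_then_else_; _∧_; not)
open import Data.Product using (Σ; _×_; _,_; proj₁; proj₂; ∃)
open import Data.Product.Properties using (≡-dec)
open import Data.Sum using (_⊎_)
open import Data.List using (List; []; _∷_; _++_; map; concatMap)
open import Data.Nat.ListAction using (sum)
open import Data.List.Membership.Propositional using (_∈_)
open import Data.List.Relation.Unary.Unique.Propositional using (Unique)
open import Data.Vec as Vec using (Vec; lookup; zipWith; toList)
open import Data.Fin using (Fin)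
open import Relation.Binary.PropositionalEquality using (_≡_; _≢_)
open import Relation.Nullary using (¬_; does)

-- A glue type is a pair (name , strength); its strength is the second
-- component.  Two glues match iff they are the same glue type.
Glue : Set
Glue = ℕ × ℕ

strength : Glue → ℕ
strength = proj₂

-- Labels are natural numbers; label 0 encodes "0" and label 1 encodes "1".
record Tile : Set where
  constructor tile
  field
    north east south west : Glue
    label : ℕ
open Tile public

Pos : Set
Pos = ℤ × ℤ

_≟ₚ_ : (p q : Pos) → Bool
p ≟ₚ q = does (≡-dec ℤ._≟_ ℤ._≟_ p q)

_≟g_ : (g h : Glue) → Bool
g ≟g h = does (≡-dec Data.Nat._≟_ Data.Nat._≟_ g h)
  where import Data.Nat

match : Glue → Glue → ℕ
match g h = if g ≟g h then strength g else 0

Assembly : Set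
Assembly = List (Pos × Tile)

positions : Assembly → List Pos
positions = map proj₁

ValidAssembly : Assembly → Set
ValidAssembly A = Unique (positions A)

_≈ₐ_ : Assembly → Assembly → Set
A ≈ₐ B = ∀ x → (x ∈ A → x ∈ B) × (x ∈ B → x ∈ A)

bond : Pos × Tile → Pos × Tile → ℕ
bond ((x , y) , s) ((x' , y') , t) =
  (if (x' , y') ≟ₚ (x ℤ.+ ℤ.1ℤ , y) then match (east s) (west t) else 0)
  + (if (x' , y') ≟ₚ (x ℤ.- ℤ.1ℤ , y) then match (west s) (east t) else 0)
  + (if (x' , y') ≟ₚ (x , y ℤ.+ ℤ.1ℤ) then match (north s) (south t) else 0)
  + (if (x' , y') ≟ₚ (x , y ℤ.- ℤ.1ℤ) then match (south s) (north t) else 0)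

cutWeight : (Pos → Bool) → Assembly → ℕ
cutWeight X A =
  sum (concatMap (λ a → map (λ b → if X (proj₁ a) ∧ not (X (proj₁ b))
                                    then bond a b else 0) A) A)

Stable : ℕ → Assembly → Set
Stable τ A = (X : Pos → Bool) →
  (Σ (Pos × Tile) λ a → a ∈ A × X (proj₁ a) ≡ true) →
  (Σ (Pos × Tile) λ b → b ∈ A × X (proj₁ b) ≡ false) →
  τ ≤ cutWeight X A

module _ (T : List Tile) (τ : ℕ) where

  Attachable : Assembly → Pos → Tile → Set
  Attachable A p t = t ∈ T × ¬ (p ∈ positions A) × Stable τ ((p , t) ∷ A)

  data Producible (S : Assembly) : Assembly → Set where
    seed : Producible S S
    grow : ∀ {A p t} → Producible S A → Attachable A p t →
           Producible S ((p , t) ∷ A)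

  Terminal : Assembly → Set
  Terminal A = ∀ p t → ¬ Attachable A p t

  UniquelyAssembles : Assembly → Assembly → Set
  UniquelyAssembles S A =
    Producible S A × Terminal A ×
    (∀ B → Producible S B → Terminal B → B ≈ₐ A)

  _⇉_ : Assembly → Assembly → Set
  A ⇉ A' = ValidAssembly A' ×
    (∀ x → (x ∈ A' → x ∈ A ⊎ Attachable A (proj₁ x) (proj₂ x))
         × (x ∈ A ⊎ Attachable A (proj₁ x) (proj₂ x) → x ∈ A'))

  data ParRun : Assembly → ℕ → Assembly → Set where
    done : ∀ {A} → ParRun A 0 A
    step : ∀ {A B C m} → A ⇉ B → ParRun B m C → ParRun A (suc m) C

  -- S = A₁ ⇉ ⋯ ⇉ A_k with A_k terminal
  TerminatesIn : Assembly → ℕ → Set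
  TerminatesIn S k = Σ ℕ λ m → k ≡ suc m ×
    Σ Assembly λ C → ParRun S m C × Terminal C

  RunTime : Assembly → ℕ → Set
  RunTime S k = TerminatesIn S k × (∀ j → j < k → ¬ TerminatesIn S j)

record TAC (ni no : ℕ) : Set where
  field
    tiles : List Tile
    τ : ℕ
    t₀ t₁ : Tile
    t₀∈T : t₀ ∈ tiles
    t₁∈T : t₁ ∈ tiles
    label-t₀ : label t₀ ≡ 0
    label-t₁ : label t₁ ≡ 1
    only-t₀ : ∀ t → t ∈ tiles → label t ≡ 0 → t ≡ t₀
    only-t₁ : ∀ t → t ∈ tiles → label t ≡ 1 → t ≡ t₁
    R : Assembly
    R-valid : ValidAssembly R
    R-tiles : ∀ x → x ∈ R → proj₂ x ∈ tiles × proj₂ x ≢ t₀ × proj₂ x ≢ t₁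
    B : Vec Pos ni
    B-distinct : ∀ i j → lookup B i ≡ lookup B j → i ≡ j
    B-free : ∀ i → ¬ (lookup B i ∈ positions R)
    C : Vec Pos no

  bitTile : Bool → Tile
  bitTile b = if b then t₁ else t₀

  U : Vec Bool ni → Assembly
  U b = R ++ toList (zipWith (λ p bit → p , bitTile bit) B b)

open TAC public

bitLabel : Bool → ℕ
bitLabel b = if b then 1 else 0

Represents : ∀ {ni no} → TAC ni no → Assembly → Vec Bool no → Set
Represents M A c =
  ∀ i → Σ Tile λ t → (lookup (C M) i , t) ∈ A × label t ≡ bitLabel (lookup c i)

Computes : ∀ {ni no} → TAC ni no → (Vec Bool ni → Vec Bool no) → Set
Computes M f = ∀ b → Σ Assembly λ A →
  UniquelyAssembles (tiles M) (τ M) (U M b) A × Represents M A (f b)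

RunTimeOn : ∀ {ni no} → TAC ni no → Vec Bool ni → ℕ → Set
RunTimeOn M b k = RunTime (tiles M) (τ M) (U M b) k

-- Binary numbers (least significant bit first)

val : ∀ {k} → Vec Bool k → ℕ
val Vec.[] = 0
val (x Vec.∷ xs) = bitLabel x + 2 * val xs

toBits : (k : ℕ) → ℕ → Vec Bool k
toBits zero _ = Vec.[]
toBits (suc k) x = (x % 2 ≡ᵇ 1) Vec.∷ toBits k (x / 2)

adderFun : (n : ℕ) → Vec Bool (n + n) → Vec Bool (suc n)
adderFun n v = toBits (suc n) (val (Vec.take n v) + val (Vec.drop n v))

allBits : (k : ℕ) → List (Vec Bool k)
allBits zero = Vec.[] ∷ []
allBits (suc k) = map (false Vec.∷_) (allBits k) ++ map (true Vec.∷_) (allBits k)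

{-# OPTIONS --safe #-}
module Submission where

-- The bits are laid out in √n blocks of about √n positions.  A block is folded, so that its
-- lowest and highest positions lie next to each other in one column.  A position kills,
-- generates or propagates the incoming carry.  In each block one lane runs from the fold
-- to the column and collects the operation of the span between the two legs of the fold; a second
-- lane carries the carries from the column towards the fold, and the column itself takes the
-- carry from block to block.  A tile that kills or generates is attached by one bond of strength
-- 2 and waits for nothing; a propagating one is attached by two bonds of strength 1 and so waits
-- for the incoming signal.  Hence all waiting is along runs of propagating positions, each signal
-- travels O(√n) in any case, and a random input has only runs of length O(log n).
--
-- All glues except those of the two bit tiles name the position and the direction in which they
-- are shown, and the tile set is the union of the final assemblies over all inputs.  So a tile can
-- only attach where and as the final assembly has it, which makes growth locally deterministic.

open import Defs
open import Data.Bool using (Bool; true; false; if_then_else_; not; _∧_; _∨_; _xor_; T; T?)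
import Data.Bool as Bool
open import Data.Bool.Properties using (∧-conicalˡ; ∧-conicalʳ)
open import Data.Empty using (⊥; ⊥-elim)
open import Data.Fin as Fin using (Fin; toℕ; fromℕ<; splitAt)
import Data.Fin.Properties as Fin
open import Data.Integer as ℤ using (ℤ) renaming (+_ to nat)
import Data.Integer.Properties as ℤ
open import Algebra.Properties.AbelianGroup ℤ.+-0-abelianGroup using (∙-cancelˡ)
open import Data.List using (List; []; _∷_; _++_; map; concatMap; filter; upTo; allFin; cartesianProduct)
import Data.List.Properties as List
open import Data.List.Properties using (∷-injective)
open import Data.List.Membership.Propositional using (_∈_; find; lose)
open import Data.List.Membership.Propositional.Properties
  using ( ∈-map⁺; ∈-map⁻; ∈-filter⁺; ∈-filter⁻; ∈-++⁺ˡ; ∈-++⁺ʳ; ∈-++⁻; ∈-concatMap⁺; ∈-concatMap⁻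
        ; ∈-cartesianProduct⁺; ∈-upTo⁺; ∈-allFin)
import Data.List.Membership.DecPropositional as DecMembership
open import Data.List.Relation.Unary.All as All using (All; []; _∷_)
open import Data.List.Relation.Unary.AllPairs using ([]; _∷_)
open import Data.List.Relation.Unary.Any using (here; there)
open import Data.List.Relation.Unary.Unique.Propositional using (Unique)
import Data.List.Relation.Unary.Unique.Propositional.Properties as Unique
open import Data.Maybe using (Maybe; just; nothing; maybe′)
open import Data.Nat
  using ( ℕ; NonZero; zero; suc; _+_; _*_; _∸_; _^_; _≤_; _<_; z≤n; s≤s; _≡ᵇ_; _<ᵇ_; _≤?_; _<?_
        ; >-nonZero)
open import Data.Nat.Divisibility using (divides)
open import Data.Nat.DivMod
  using ( _/_; _%_; [m+kn]%n≡m%n; m<n⇒m%n≡m; m<n⇒m/n≡0; m*n/n≡m; +-distrib-/-∣ʳ; m≡m%n+[m/n]*n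
        ; m%n<n; m<n*o⇒m/o<n)
open import Data.Nat.ListAction using (sum)
open import Data.Nat.ListAction.Properties using (sum-++)
open import Data.Nat.Logarithm using (⌊log₂_⌋; ⌊log₂⌋-mono-≤; ⌊log₂[2^n]⌋≡n)
open import Data.Nat.Properties
open import Data.Nat.Solver using (module +-*-Solver)
open import Data.Product using (Σ; _×_; _,_; proj₁; proj₂; ∃; ∃-syntax)
open import Data.Product.Properties using (≡-dec)
open import Data.Sum using (_⊎_; inj₁; inj₂; [_,_]′)
import Data.Sum as Sum
open import Data.Vec as Vec using (Vec; []; _∷_; lookup; tabulate; zipWith; toList)
import Data.Vec.Properties as Vec
open import Relation.Binary.PropositionalEquality
open import Relation.Nullary using (¬_; Dec; yes; no; does; _×-dec_; _⊎-dec_)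
open import Relation.Nullary.Decidable using (dec-true; dec-false)

-- The model grants one tile per bit value, and that tile must serve at every input and every output
-- position, so its glues cannot name a position; this shapes the construction. Below it shows `rd`
-- of strength 1: a tile reading it needs a second bond, and that one does name the place. Above it
-- shows `ou` of strength 2, which the rest of the assembly offers only from the row of sums,
-- downwards, at a place where just that bit belongs. To the west it shows `base`, which holds an
-- input tile in the seed and at an output faces a seed tile.
--
-- The fold does more than bring both ends of a block to the column: no signal has to return along
-- the upper leg. The carry into an upper position is the carry behind its lower partner, sent
-- through the span strictly between the two. When the carry passes towards the fold, that span is
-- already there, so the upper sum bit can be delivered on the way.

private variable
  X Y Z : Set

-- Bonds and cuts

pattern first = here refl
pattern second = there first

Dir : Set
Dir = Fin 4

pattern N = Fin.zero
pattern E = Fin.suc N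
pattern S = Fin.suc E
pattern W = Fin.suc S

opp : Dir → Dir
opp N = S
opp E = W
opp S = N
opp W = E

opp-opp : ∀ d → opp (opp d) ≡ d
opp-opp N = refl
opp-opp E = refl
opp-opp S = refl
opp-opp W = refl

opp-injective : ∀ {d e} → opp d ≡ opp e → d ≡ e
opp-injective {d} {e} q = trans (sym (opp-opp d)) (trans (cong opp q) (opp-opp e))

shift : Dir → Pos → Pos
shift E (x , y) = x ℤ.+ ℤ.1ℤ , y
shift W (x , y) = x ℤ.- ℤ.1ℤ , y
shift N (x , y) = x , y ℤ.+ ℤ.1ℤ
shift S (x , y) = x , y ℤ.- ℤ.1ℤ

glue : Dir → Tile → Glue
glue N = north
glue E = east
glue S = south
glue W = west

private
  +1-1 : ∀ x → (x ℤ.+ ℤ.1ℤ) ℤ.- ℤ.1ℤ ≡ x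
  +1-1 x = trans (ℤ.+-assoc x ℤ.1ℤ (ℤ.- ℤ.1ℤ)) (ℤ.+-identityʳ x)

  -1+1 : ∀ x → (x ℤ.- ℤ.1ℤ) ℤ.+ ℤ.1ℤ ≡ x
  -1+1 x = trans (ℤ.+-assoc x (ℤ.- ℤ.1ℤ) ℤ.1ℤ) (ℤ.+-identityʳ x)

  cancel : ∀ x a b → x ℤ.+ a ≡ x ℤ.+ b → a ≡ b
  cancel x a b = ∙-cancelˡ x a b

  move≢ : ∀ x a → a ≢ ℤ.0ℤ → x ℤ.+ a ≢ x
  move≢ x a a≢0 e = a≢0 (cancel x a ℤ.0ℤ (trans e (sym (ℤ.+-identityʳ x))))

shift-opp : ∀ d p → shift (opp d) (shift d p) ≡ p
shift-opp N (x , y) = cong (x ,_) (+1-1 y)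
shift-opp E (x , y) = cong (_, y) (+1-1 x)
shift-opp S (x , y) = cong (x ,_) (-1+1 y)
shift-opp W (x , y) = cong (_, y) (-1+1 x)

shift-injective : ∀ d {p q} → shift d p ≡ shift d q → p ≡ q
shift-injective d {p} {q} e =
  trans (sym (shift-opp d p)) (trans (cong (shift (opp d)) e) (shift-opp d q))

shift-dir : ∀ d e p → shift d p ≡ shift e p → d ≡ e
shift-dir N N p q = refl
shift-dir E E p q = refl
shift-dir S S p q = refl
shift-dir W W p q = refl
shift-dir N S (x , y) q with () ← cancel y _ _ (cong proj₂ q)
shift-dir S N (x , y) q with () ← cancel y _ _ (cong proj₂ q)
shift-dir E W (x , y) q with () ← cancel x _ _ (cong proj₁ q)
shift-dir W E (x , y) q with () ← cancel x _ _ (cong proj₁ q)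
shift-dir N E (x , y) q = ⊥-elim (move≢ x _ (λ ()) (sym (cong proj₁ q)))
shift-dir N W (x , y) q = ⊥-elim (move≢ x _ (λ ()) (sym (cong proj₁ q)))
shift-dir S E (x , y) q = ⊥-elim (move≢ x _ (λ ()) (sym (cong proj₁ q)))
shift-dir S W (x , y) q = ⊥-elim (move≢ x _ (λ ()) (sym (cong proj₁ q)))
shift-dir E N (x , y) q = ⊥-elim (move≢ x _ (λ ()) (cong proj₁ q))
shift-dir E S (x , y) q = ⊥-elim (move≢ x _ (λ ()) (cong proj₁ q))
shift-dir W N (x , y) q = ⊥-elim (move≢ x _ (λ ()) (cong proj₁ q))
shift-dir W S (x , y) q = ⊥-elim (move≢ x _ (λ ()) (cong proj₁ q))

≟ₚ-sound : ∀ p q → (p ≟ₚ q) ≡ true → p ≡ q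
≟ₚ-sound p q e with ≡-dec ℤ._≟_ ℤ._≟_ p q
... | yes r = r

≟ₚ-refl : ∀ p → (p ≟ₚ p) ≡ true
≟ₚ-refl p = dec-true (≡-dec ℤ._≟_ ℤ._≟_ p p) refl

≟ₚ-false : ∀ p q → p ≢ q → (p ≟ₚ q) ≡ false
≟ₚ-false p q = dec-false (≡-dec ℤ._≟_ ℤ._≟_ p q)

match-refl : ∀ g → match g g ≡ strength g
match-refl g rewrite dec-true (≡-dec _≟_ _≟_ g g) refl = refl

match-comm : ∀ g h → match g h ≡ match h g
match-comm g h with ≡-dec _≟_ _≟_ g h
... | yes refl rewrite dec-true (≡-dec _≟_ _≟_ g g) refl = refl
... | no g≢h rewrite dec-false (≡-dec _≟_ _≟_ h g) (λ q → g≢h (sym q)) = refl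

match-positive : ∀ g h → 1 ≤ match g h → g ≡ h × match g h ≡ strength g
match-positive g h m with ≡-dec _≟_ _≟_ g h
... | yes q = q , refl

private
  term : Dir → Pos × Tile → Pos × Tile → ℕ
  term d (p , s) (q , t) =
    if q ≟ₚ shift d p then match (glue d s) (glue (opp d) t) else 0

  bond-terms : ∀ a b →
    bond a b ≡ term E a b + term W a b + term N a b + term S a b
  bond-terms ((x , y) , s) ((x' , y') , t) = refl

  term-hit : ∀ d p s t → term d (p , s) (shift d p , t) ≡ match (glue d s) (glue (opp d) t)
  term-hit d p s t rewrite ≟ₚ-refl (shift d p) = refl

  term-miss : ∀ d e p s t → d ≢ e → term e (p , s) (shift d p , t) ≡ 0
  term-miss d e p s t d≢e
    rewrite ≟ₚ-false (shift d p) (shift e p) (λ q → d≢e (shift-dir d e p q)) = refl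

  term-positive : ∀ d p s q t → 1 ≤ term d (p , s) (q , t) → q ≡ shift d p
  term-positive d p s q t h with q ≟ₚ shift d p in eq
  ... | true = ≟ₚ-sound q (shift d p) eq

-- The four directions lead to four different places, so only one of the four summands of `bond`
-- survives.
bond-shift : ∀ d p s t →
  bond (p , s) (shift d p , t) ≡ match (glue d s) (glue (opp d) t)
bond-shift N p s t
  rewrite bond-terms (p , s) (shift N p , t)
  | term-miss N E p s t (λ ()) | term-miss N W p s t (λ ()) | term-miss N S p s t (λ ())
  | term-hit N p s t = +-identityʳ _
bond-shift E p s t
  rewrite bond-terms (p , s) (shift E p , t)
  | term-miss E N p s t (λ ()) | term-miss E W p s t (λ ()) | term-miss E S p s t (λ ())
  | term-hit E p s t = trans (+-identityʳ _) (trans (+-identityʳ _) (+-identityʳ _))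
bond-shift S p s t
  rewrite bond-terms (p , s) (shift S p , t)
  | term-miss S N p s t (λ ()) | term-miss S W p s t (λ ()) | term-miss S E p s t (λ ())
  | term-hit S p s t = refl
bond-shift W p s t
  rewrite bond-terms (p , s) (shift W p , t)
  | term-miss W N p s t (λ ()) | term-miss W E p s t (λ ()) | term-miss W S p s t (λ ())
  | term-hit W p s t = trans (+-identityʳ _) (+-identityʳ _)

bond-unshift : ∀ d p s t →
  bond (shift d p , t) (p , s) ≡ match (glue d s) (glue (opp d) t)
bond-unshift d p s t = begin
  bond (shift d p , t) (p , s)
    ≡⟨ cong (λ q → bond (shift d p , t) (q , s)) (shift-opp d p) ⟨
  bond (shift d p , t) (shift (opp d) (shift d p) , s)
    ≡⟨ bond-shift (opp d) (shift d p) t s ⟩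
  match (glue (opp d) t) (glue (opp (opp d)) s)
    ≡⟨ match-comm (glue (opp d) t) (glue (opp (opp d)) s) ⟩
  match (glue (opp (opp d)) s) (glue (opp d) t)
    ≡⟨ cong (λ e → match (glue e s) (glue (opp d) t)) (opp-opp d) ⟩
  match (glue d s) (glue (opp d) t) ∎
  where open ≡-Reasoning

bond-direction : ∀ p s q t → 1 ≤ bond (p , s) (q , t) → ∃ λ d → q ≡ shift d p
bond-direction p s q t h with term E (p , s) (q , t) in e₁ | term W (p , s) (q , t) in e₂
  | term N (p , s) (q , t) in e₃ | term S (p , s) (q , t) in e₄ | bond-terms (p , s) (q , t)
... | suc _ | _ | _ | _ | _ = E , term-positive E p s q t (subst (1 ≤_) (sym e₁) (s≤s z≤n))
... | zero | suc _ | _ | _ | _ = W , term-positive W p s q t (subst (1 ≤_) (sym e₂) (s≤s z≤n))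
... | zero | zero | suc _ | _ | _ = N , term-positive N p s q t (subst (1 ≤_) (sym e₃) (s≤s z≤n))
... | zero | zero | zero | suc _ | _ = S , term-positive S p s q t (subst (1 ≤_) (sym e₄) (s≤s z≤n))
... | zero | zero | zero | zero | eq with () ← subst (1 ≤_) eq h

-- Sums over lists

∈-sum : (g : X → ℕ) {a : X} {A : List X} → a ∈ A → g a ≤ sum (map g A)
∈-sum g first = m≤m+n _ _
∈-sum g {A = b ∷ _} (there i) = ≤-trans (∈-sum g i) (m≤n+m _ (g b))

∈-sum₂ : (g : X → ℕ) {a b : X} {A : List X} → a ≢ b → a ∈ A → b ∈ A →
  g a + g b ≤ sum (map g A)
∈-sum₂ g a≢b first first = ⊥-elim (a≢b refl)
∈-sum₂ g a≢b first (there j) = +-monoʳ-≤ _ (∈-sum g j)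
∈-sum₂ g {a} {b} a≢b (there i) first =
  ≤-trans (≤-reflexive (+-comm (g a) (g b))) (+-monoʳ-≤ _ (∈-sum g i))
∈-sum₂ g {A = c ∷ _} a≢b (there i) (there j) =
  ≤-trans (∈-sum₂ g a≢b i j) (m≤n+m _ (g c))

sum-map-mono : {g h : X → ℕ} (A : List X) → (∀ {a} → a ∈ A → g a ≤ h a) →
  sum (map g A) ≤ sum (map h A)
sum-map-mono [] g≤h = z≤n
sum-map-mono (a ∷ A) g≤h = +-mono-≤ (g≤h first) (sum-map-mono A (λ i → g≤h (there i)))

sum-map-zero : (g : X → ℕ) (A : List X) → (∀ {a} → a ∈ A → g a ≡ 0) → sum (map g A) ≡ 0
sum-map-zero g [] z = refl
sum-map-zero g (a ∷ A) z = cong₂ _+_ (z first) (sum-map-zero g A (λ i → z (there i)))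

sum-concatMap : (g : X → List ℕ) (A : List X) →
  sum (concatMap g A) ≡ sum (map (λ a → sum (g a)) A)
sum-concatMap g [] = refl
sum-concatMap g (a ∷ A) =
  trans (sum-++ (g a) (concatMap g A)) (cong (sum (g a) +_) (sum-concatMap g A))

sum≥1 : (g : X → ℕ) (A : List X) → 1 ≤ sum (map g A) → ∃ λ a → a ∈ A × 1 ≤ g a
sum≥1 g (a ∷ A) le with g a in eq
... | suc _ = a , here refl , subst (1 ≤_) (sym eq) (s≤s z≤n)
... | zero with b , i , k ← sum≥1 g A le = b , there i , k

-- This is what temperature 2 means for an attaching tile: one strong bond, or two weak ones to
-- different neighbours. The map `h` will be the position, as uniqueness is known for positions.
sum≥2 : (g : X → ℕ) (h : X → Y) (A : List X) → Unique (map h A) → 2 ≤ sum (map g A) →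
  (∃ λ a → a ∈ A × 2 ≤ g a) ⊎
  (∃ λ a → ∃ λ b → a ∈ A × b ∈ A × h a ≢ h b × 1 ≤ g a × 1 ≤ g b)
sum≥2 g h (a ∷ A) (fresh ∷ unique) le with g a in eq
... | suc (suc _) = inj₁ (a , here refl , subst (2 ≤_) (sym eq) (s≤s (s≤s z≤n)))
... | suc zero with b , i , k ← sum≥1 g A (≤-pred le) = inj₂
  (a , b , here refl , there i , All.lookup fresh (∈-map⁺ h i) , subst (1 ≤_) (sym eq) (s≤s z≤n) , k)
... | zero with sum≥2 g h A unique le
...   | inj₁ (b , i , k) = inj₁ (b , there i , k)
...   | inj₂ (b , c , i , j , rest) = inj₂ (b , c , there i , there j , rest)

-- Lower and upper bounds for cut weights

private
  crossing : (Pos → Bool) → Pos × Tile → Pos × Tile → ℕ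
  crossing χ a b = if χ (proj₁ a) ∧ not (χ (proj₁ b)) then bond a b else 0

  row : (Pos → Bool) → Assembly → Pos × Tile → ℕ
  row χ A a = sum (map (crossing χ a) A)

  cut-rows : ∀ χ A → cutWeight χ A ≡ sum (map (row χ A) A)
  cut-rows χ A = sum-concatMap _ A

  crossing-hit : ∀ χ a b → χ (proj₁ a) ≡ true → χ (proj₁ b) ≡ false → crossing χ a b ≡ bond a b
  crossing-hit χ a b p q rewrite p | q = refl

  crossing≤row : ∀ χ {A a b} → b ∈ A → χ (proj₁ a) ≡ true → χ (proj₁ b) ≡ false →
    bond a b ≤ row χ A a
  crossing≤row χ {a = a} {b} j p q =
    ≤-trans (≤-reflexive (sym (crossing-hit χ a b p q))) (∈-sum (crossing χ a) j)

cut≥bond : ∀ χ {A a b} → a ∈ A → b ∈ A → χ (proj₁ a) ≡ true → χ (proj₁ b) ≡ false →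
  bond a b ≤ cutWeight χ A
cut≥bond χ {A} {a} {b} i j p q =
  ≤-trans (crossing≤row χ {A} {a} {b} j p q) (≤-trans (∈-sum (row χ A) i) (≤-reflexive (sym (cut-rows χ A))))

-- `cutWeight` counts bonds from the inside to the outside only. So a tile with two severed bonds is
-- treated as the inner end here and as the outer end in `cut≥in`.
cut≥out : ∀ χ {A a b c} → b ≢ c → a ∈ A → b ∈ A → c ∈ A →
  χ (proj₁ a) ≡ true → χ (proj₁ b) ≡ false → χ (proj₁ c) ≡ false →
  bond a b + bond a c ≤ cutWeight χ A
cut≥out χ {A} {a} {b} {c} b≢c i j k p q r = begin
  bond a b + bond a c              ≡⟨ cong₂ _+_ (crossing-hit χ a b p q) (crossing-hit χ a c p r) ⟨
  crossing χ a b + crossing χ a c  ≤⟨ ∈-sum₂ (crossing χ a) b≢c j k ⟩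
  row χ A a                        ≤⟨ ∈-sum (row χ A) i ⟩
  sum (map (row χ A) A)            ≡⟨ cut-rows χ A ⟨
  cutWeight χ A                    ∎
  where open ≤-Reasoning

cut≥in : ∀ χ {A a b c} → b ≢ c → a ∈ A → b ∈ A → c ∈ A →
  χ (proj₁ a) ≡ false → χ (proj₁ b) ≡ true → χ (proj₁ c) ≡ true →
  bond b a + bond c a ≤ cutWeight χ A
cut≥in χ {A} {a} {b} {c} b≢c i j k p q r = begin
  bond b a + bond c a        ≤⟨ +-mono-≤ (crossing≤row χ {A} {b} {a} i q p) (crossing≤row χ {A} {c} {a} i r p) ⟩
  row χ A b + row χ A c      ≤⟨ ∈-sum₂ (row χ A) b≢c j k ⟩
  sum (map (row χ A) A)      ≡⟨ cut-rows χ A ⟨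
  cutWeight χ A              ∎
  where open ≤-Reasoning

-- Used to turn stability around: cutting off the new tile alone must cost at least 2, so its own
-- bonds add up to at least 2. Old tiles contribute nothing, since none of them lies inside this
-- cut.
singleton-cut : ∀ p t A → ¬ (p ∈ positions A) →
  cutWeight (_≟ₚ p) ((p , t) ∷ A) ≤ sum (map (bond (p , t)) A)
singleton-cut p t A p∉A = begin
  cutWeight χ A⁺                                ≡⟨ cut-rows χ A⁺ ⟩
  row χ A⁺ (p , t) + sum (map (row χ A⁺) A)     ≡⟨ cong (row χ A⁺ (p , t) +_) (sum-map-zero (row χ A⁺) A others) ⟩
  row χ A⁺ (p , t) + 0                          ≡⟨ +-identityʳ _ ⟩
  row χ A⁺ (p , t)                              ≡⟨ cong (_+ row χ A (p , t)) own ⟩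
  row χ A (p , t)                               ≤⟨ sum-map-mono A (λ {b} _ → crossing≤ b) ⟩
  sum (map (bond (p , t)) A)                    ∎
  where
    open ≤-Reasoning
    χ = _≟ₚ p
    A⁺ = (p , t) ∷ A
    χp = ≟ₚ-refl p
    own : crossing χ (p , t) (p , t) ≡ 0
    own rewrite χp = refl
    crossing≤ : ∀ b → crossing χ (p , t) b ≤ bond (p , t) b
    crossing≤ b with χ p ∧ not (χ (proj₁ b))
    ... | true = ≤-refl
    ... | false = z≤n
    others : ∀ {a} → a ∈ A → row χ A⁺ a ≡ 0
    others {a} i = sum-map-zero (crossing χ a) A⁺ λ {b} _ → lemma b
      where
        χa : χ (proj₁ a) ≡ false
        χa = ≟ₚ-false (proj₁ a) p (λ q → p∉A (subst (_∈ positions A) q (∈-map⁺ proj₁ i)))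
        lemma : ∀ b → crossing χ a b ≡ 0
        lemma b rewrite χa = refl

-- Locally deterministic growth

map-unique : {g : X → Y} {A : List X} → (∀ {a b} → a ∈ A → b ∈ A → g a ≡ g b → a ≡ b) →
  Unique A → Unique (map g A)
map-unique {A = []} inj [] = []
map-unique {g = g} {a ∷ A} inj (fresh ∷ unique) =
  All.tabulate new ∷ map-unique (λ i j → inj (there i) (there j)) unique
  where
    new : ∀ {y} → y ∈ map g A → g a ≢ y
    new i q with b , b∈A , refl ← ∈-map⁻ g i = All.lookup fresh b∈A (inj first (there b∈A) q)

least : {P : ℕ → Set} → (∀ k → Dec (P k)) → ∀ K → P K →
  ∃ λ m → P m × (∀ j → j < m → ¬ P j)
least P? zero p = zero , p , λ _ ()
least {P} P? (suc K) p with P? zero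
... | yes p₀ = zero , p₀ , λ _ ()
... | no ¬p₀ with m , q , minimal ← least (λ k → P? (suc k)) K p = suc m , q , earlier
  where
    earlier : ∀ j → j < suc m → ¬ P j
    earlier zero _ = ¬p₀
    earlier (suc j) (s≤s j<m) = minimal j j<m

data Supported {Site : Set} (f : Site → Tile) (root j : Site) : List (Dir × Site) → Set where
  isRoot : j ≡ root → Supported f root j []
  one : ∀ {d k} → 2 ≤ match (glue d (f j)) (glue (opp d) (f k)) →
    Supported f root j ((d , k) ∷ [])
  two : ∀ {d k e l} → d ≢ e →
    1 ≤ match (glue d (f j)) (glue (opp d) (f k)) →
    1 ≤ match (glue e (f j)) (glue (opp e) (f l)) →
    Supported f root j ((d , k) ∷ (e , l) ∷ [])

-- `free` says that `j` was not attached through the side facing `p`. It will hold because the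
-- inputs of a placed tile are present, while `p` is still empty.
record Touches {Site : Set} (sites : List Site) (pos : Site → Pos) (f : Site → Tile)
  (inputs : Site → List (Dir × Site)) (p : Pos) (t : Tile) (d : Dir) (j : Site) : Set where
  constructor touches
  field
    site : j ∈ sites
    at : pos j ≡ shift d p
    free : ∀ k → ¬ ((opp d , k) ∈ inputs j)
    bonded : 1 ≤ match (glue d t) (glue (opp d) (f j))

-- Local determinism is in `strong-bond` and `weak-bonds`: for every tile of `T` and every place
-- outside the seed, bonds of total strength 2 force the intended tile, and with it the presence of
-- its inputs. `lev` makes the inputs well-founded and need not be a time.
record Dataflow (T : List Tile) : Set₁ where
  field
    {Site} : Set
    pos : Site → Pos
    f : Site → Tile
    inputs : Site → List (Dir × Site)
    sites : List Site
    sites-unique : Unique sites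
    pos-injective : ∀ {j k} → j ∈ sites → k ∈ sites → pos j ≡ pos k → j ≡ k
    f∈T : ∀ {j} → j ∈ sites → f j ∈ T
    isSeed : Site → Bool
    lev : Site → ℕ
    input-site : ∀ {j d k} → j ∈ sites → (d , k) ∈ inputs j → k ∈ sites
    input-pos : ∀ {j d k} → j ∈ sites → (d , k) ∈ inputs j → pos k ≡ shift d (pos j)
    input-seed : ∀ {j d k} → j ∈ sites → isSeed j ≡ true → (d , k) ∈ inputs j → isSeed k ≡ true
    input-lev : ∀ {j d k} → j ∈ sites → (d , k) ∈ inputs j → lev k < lev j
    root : Site
    root∈sites : root ∈ sites
    root-seed : isSeed root ≡ true
    supported : ∀ {j} → j ∈ sites → Supported f root j (inputs j)
    strong-bond : ∀ {p t d j} → t ∈ T → (∀ {k} → k ∈ sites → isSeed k ≡ true → pos k ≢ p) →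
      Touches sites pos f inputs p t d j → 2 ≤ match (glue d t) (glue (opp d) (f j)) →
      ∃ λ i → i ∈ sites × pos i ≡ p × f i ≡ t × (∀ {e k} → (e , k) ∈ inputs i → k ≡ j)
    weak-bonds : ∀ {p t d j e l} → t ∈ T → (∀ {k} → k ∈ sites → isSeed k ≡ true → pos k ≢ p) →
      d ≢ e → Touches sites pos f inputs p t d j → Touches sites pos f inputs p t e l →
      ∃ λ i → i ∈ sites × pos i ≡ p × f i ≡ t × (∀ {e k} → (e , k) ∈ inputs i → k ≡ j ⊎ k ≡ l)

module Growth {T : List Tile} (D : Dataflow T) where
  open Dataflow D

  cell : Site → Pos × Tile
  cell j = pos j , f j

  -- The invariant of growth. `closed` makes stability a matter of single tiles and their inputs,
  -- and it supplies `free` in `Touches`.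
  record Good (A : Assembly) : Set where
    field
      unique : ValidAssembly A
      sound : ∀ {x} → x ∈ A → ∃ λ j → j ∈ sites × x ≡ cell j
      seeded : ∀ {j} → j ∈ sites → isSeed j ≡ true → cell j ∈ A
      closed : ∀ {j d k} → j ∈ sites → cell j ∈ A → (d , k) ∈ inputs j → cell k ∈ A
  open Good

  cell-injective : ∀ {j k} → j ∈ sites → k ∈ sites → cell j ≡ cell k → j ≡ k
  cell-injective j k q = pos-injective j k (cong proj₁ q)

  occupied : ∀ {A j} → Good A → j ∈ sites → pos j ∈ positions A → cell j ∈ A
  occupied G j∈ i with x , x∈A , q ← ∈-map⁻ proj₁ i with k , k∈ , refl ← sound G x∈A
    with refl ← pos-injective j∈ k∈ q = x∈A

  bond-out : ∀ {i d k} → pos k ≡ shift d (pos i) →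
    bond (cell i) (cell k) ≡ match (glue d (f i)) (glue (opp d) (f k))
  bond-out {i} {d} {k} q rewrite q = bond-shift d (pos i) (f i) (f k)

  bond-in : ∀ {i d k} → pos k ≡ shift d (pos i) →
    bond (cell k) (cell i) ≡ match (glue d (f i)) (glue (opp d) (f k))
  bond-in {i} {d} {k} q rewrite q = bond-unshift d (pos i) (f i) (f k)

  -- A cut separating some site from the root separates a site from all of its inputs.
  stable : ∀ {A} → Good A → Stable 2 A
  stable {A} G χ (a , a∈ , χa) (b , b∈ , χb) = split (χ (pos root)) refl
    where
      spread : ∀ m i → lev i < m → i ∈ sites → cell i ∈ A → χ (pos i) ≢ χ (pos root) →
        2 ≤ cutWeight χ A
      spread (suc m) i (s≤s lev≤m) i∈ i∈A i≢root =
        separate (inputs i) (supported i∈) λ u →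
          input-site i∈ u , input-pos i∈ u , <-≤-trans (input-lev i∈ u) lev≤m , closed G i∈ i∈A u
        where
          separate : ∀ L → Supported f root i L →
            (∀ {d k} → (d , k) ∈ L →
              k ∈ sites × pos k ≡ shift d (pos i) × lev k < m × cell k ∈ A) →
            2 ≤ cutWeight χ A
          separate _ (isRoot refl) _ = ⊥-elim (i≢root refl)
          separate _ (one {d} {k} strong) facts with facts first
          ... | k∈ , at , lev< , k∈A with χ (pos k) Bool.≟ χ (pos root)
          ...   | no k≢root = spread m k lev< k∈ k∈A k≢root
          ...   | yes k≡root with χ (pos i) in χi | χ (pos k) in χk
          ...     | true | true = ⊥-elim (i≢root k≡root)
          ...     | false | false = ⊥-elim (i≢root k≡root)
          ...     | true | false = ≤-trans strong (≤-trans (≤-reflexive (sym (bond-out {i} {d} {k} at)))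
                                     (cut≥bond χ i∈A k∈A χi χk))
          ...     | false | true = ≤-trans strong (≤-trans (≤-reflexive (sym (bond-in {i} {d} {k} at)))
                                     (cut≥bond χ k∈A i∈A χk χi))
          separate _ (two {d} {k} {e} {l} d≢e weak weak′) facts
            with facts first | facts second
          ... | k∈ , at , lev< , k∈A | l∈ , at′ , lev<′ , l∈A
            with χ (pos k) Bool.≟ χ (pos root) | χ (pos l) Bool.≟ χ (pos root)
          ...   | no k≢root | _ = spread m k lev< k∈ k∈A k≢root
          ...   | yes _ | no l≢root = spread m l lev<′ l∈ l∈A l≢root
          ...   | yes k≡root | yes l≡root = cut (χ (pos i)) refl
            where
              k≢l : cell k ≢ cell l
              k≢l q = d≢e (shift-dir d e (pos i) (trans (sym at) (trans (cong proj₁ q) at′)))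
              flip : ∀ {j c} → χ (pos i) ≡ c → χ (pos j) ≡ χ (pos root) → χ (pos j) ≡ not c
              flip {j} {c} p q with χ (pos i) | χ (pos root) | c | p
              ... | true | true | _ | _ = ⊥-elim (i≢root refl)
              ... | false | false | _ | _ = ⊥-elim (i≢root refl)
              ... | true | false | .true | refl = q
              ... | false | true | .false | refl = q
              cut : ∀ c → χ (pos i) ≡ c → 2 ≤ cutWeight χ A
              cut true χi = ≤-trans (+-mono-≤ weak weak′)
                (≤-trans (≤-reflexive (sym (cong₂ _+_ (bond-out {i} {d} {k} at) (bond-out {i} {e} {l} at′))))
                (cut≥out χ k≢l i∈A k∈A l∈A χi (flip {k} χi k≡root) (flip {l} χi l≡root)))
              cut false χi = ≤-trans (+-mono-≤ weak weak′)
                (≤-trans (≤-reflexive (sym (cong₂ _+_ (bond-in {i} {d} {k} at) (bond-in {i} {e} {l} at′))))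
                (cut≥in χ k≢l i∈A k∈A l∈A χi (flip {k} χi k≡root) (flip {l} χi l≡root)))
      -- The descent starts from the given tile on the other side of the cut than the root: `b` if
      -- the root is inside, `a` if it is outside.
      split : ∀ c → χ (pos root) ≡ c → 2 ≤ cutWeight χ A
      split true χroot with j , j∈ , refl ← sound G b∈ =
        spread (suc (lev j)) j ≤-refl j∈ b∈ λ q → false≢true (trans (sym χb) (trans q χroot))
        where
          false≢true : false ≢ true
          false≢true ()
      split false χroot with j , j∈ , refl ← sound G a∈ =
        spread (suc (lev j)) j ≤-refl j∈ a∈ λ q → true≢false (trans (sym χa) (trans q χroot))
        where
          true≢false : true ≢ false
          true≢false ()

  extend : ∀ {A j} → Good A → j ∈ sites → ¬ (cell j ∈ A) →
    (∀ {d k} → (d , k) ∈ inputs j → cell k ∈ A) → Good (cell j ∷ A)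
  extend {A} {j} G j∈ fresh ready = record
    { unique = All.tabulate (λ {q} i e → fresh (occupied G j∈ (subst (_∈ positions A) (sym e) i))) ∷ unique G
    ; sound = λ { first → j , j∈ , refl ; (there i) → sound G i }
    ; seeded = λ k∈ s → there (seeded G k∈ s)
    ; closed = λ { {i} i∈ (here q) u → there (ready (subst (λ z → _ ∈ inputs z) (cell-injective i∈ j∈ q) u))
                 ; i∈ (there i∈A) u → there (closed G i∈ i∈A u) }
    }

  attach : ∀ {A j} → Good A → j ∈ sites → ¬ (cell j ∈ A) →
    (∀ {d k} → (d , k) ∈ inputs j → cell k ∈ A) → Attachable T 2 A (pos j) (f j)
  attach G j∈ fresh ready =
    f∈T j∈ , (λ i → fresh (occupied G j∈ i)) , stable (extend G j∈ fresh ready)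

  -- The converse of `attach`. The cut around the new tile alone yields its bonds; the root
  -- witnesses that the other side of this cut is inhabited, as `Stable` demands.
  attached : ∀ {A p t} → Good A → Attachable T 2 A p t →
    ∃ λ i → i ∈ sites × pos i ≡ p × f i ≡ t × (∀ {d k} → (d , k) ∈ inputs i → cell k ∈ A)
  attached {A} {p} {t} G (t∈T , p∉A , st) = result
    where
      p≢ : ∀ {j} → cell j ∈ A → pos j ≢ p
      p≢ j∈A q = p∉A (subst (_∈ positions A) q (∈-map⁺ proj₁ j∈A))
      unseeded : ∀ {k} → k ∈ sites → isSeed k ≡ true → pos k ≢ p
      unseeded k∈ s = p≢ (seeded G k∈ s)
      total : 2 ≤ sum (map (bond (p , t)) A)
      total = ≤-trans
        (st (_≟ₚ p) ((p , t) , here refl , ≟ₚ-refl p)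
          (cell root , there (seeded G root∈sites root-seed) ,
           ≟ₚ-false (pos root) p (unseeded root∈sites root-seed)))
        (singleton-cut p t A p∉A)
      touch : ∀ {j} → j ∈ sites → cell j ∈ A → 1 ≤ bond (p , t) (cell j) →
        ∃ λ d → Touches sites pos f inputs p t d j ×
          bond (p , t) (cell j) ≡ match (glue d t) (glue (opp d) (f j))
      touch {j} j∈ j∈A b with d , at ← bond-direction p t (pos j) (f j) b =
        d , touches j∈ at free (subst (1 ≤_) eq b) , eq
        where
          eq : bond (p , t) (cell j) ≡ match (glue d t) (glue (opp d) (f j))
          eq = trans (cong (λ q → bond (p , t) (q , f j)) at) (bond-shift d p t (f j))
          free : ∀ k → ¬ ((opp d , k) ∈ inputs j)
          free k u = p≢ (closed G j∈ j∈A u)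
            (trans (input-pos j∈ u) (trans (cong (shift (opp d)) at) (shift-opp d p)))
      result : ∃ λ i → i ∈ sites × pos i ≡ p × f i ≡ t × (∀ {d k} → (d , k) ∈ inputs i → cell k ∈ A)
      result with sum≥2 (bond (p , t)) proj₁ A (unique G) total
      ... | inj₁ (x , x∈A , b) with j , j∈ , refl ← sound G x∈A
        with d , τ , eq ← touch j∈ x∈A (≤-trans (s≤s z≤n) b)
        with i , i∈ , at , fi , from ← strong-bond t∈T unseeded τ (subst (2 ≤_) eq b) =
        i , i∈ , at , fi , λ u → subst (λ z → cell z ∈ A) (sym (from u)) x∈A
      result | inj₂ (x , y , x∈A , y∈A , x≢y , b , c)
        with j , j∈ , refl ← sound G x∈A | l , l∈ , refl ← sound G y∈A
        with d , τ , _ ← touch j∈ x∈A b | e , υ , _ ← touch l∈ y∈A c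
        with i , i∈ , at , fi , from ← weak-bonds t∈T unseeded
               (λ { refl → x≢y (trans (Touches.at τ) (sym (Touches.at υ))) }) τ υ =
        i , i∈ , at , fi , λ u → present (from u)
        where
          present : ∀ {k} → k ≡ j ⊎ k ≡ l → cell k ∈ A
          present (inj₁ refl) = x∈A
          present (inj₂ refl) = y∈A

  attached-good : ∀ {A p t} → Good A → Attachable T 2 A p t → Good ((p , t) ∷ A)
  attached-good G a@(_ , p∉A , _) with i , i∈ , refl , refl , ready ← attached G a =
    extend G i∈ (λ c → p∉A (∈-map⁺ proj₁ c)) ready

  producible-good : ∀ {A B} → Good A → Producible T 2 A B → Good B
  producible-good G seed = G
  producible-good G (grow P a) = attached-good (producible-good G P) a

  open DecMembership (≡-dec ℤ._≟_ ℤ._≟_) using (_∈?_)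

  cell∈? : ∀ {A j} → Good A → j ∈ sites → Dec (cell j ∈ A)
  cell∈? {A} {j} G j∈ with pos j ∈? positions A
  ... | yes i = yes (occupied G j∈ i)
  ... | no ¬i = no λ i → ¬i (∈-map⁺ proj₁ i)

  Below : ℕ → Assembly → Set
  Below m A = ∀ {j} → j ∈ sites → lev j < m → cell j ∈ A

  -- Sites of level at most `m` have all inputs below `m`, so one pass over the list places them in
  -- whatever order they come.
  fill : ∀ {A₀ A m} → Good A₀ → Producible T 2 A₀ A → Below m A →
    ∀ L → (∀ {j} → j ∈ L → j ∈ sites) →
    ∃ λ B → Producible T 2 A₀ B × (∀ {x} → x ∈ A → x ∈ B) × (∀ {j} → j ∈ L → lev j ≤ m → cell j ∈ B)
  fill G P below [] L⊆ = _ , P , (λ i → i) , λ ()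
  fill {A₀} {A} {m} G P below (j ∷ L) L⊆
    with B , Q , A⊆B , filled ← fill G P below L (λ i → L⊆ (there i))
    with cell∈? (producible-good G Q) (L⊆ first) | lev j ≤? m
  ... | yes j∈B | _ = B , Q , A⊆B , λ { first _ → j∈B ; (there i) l → filled i l }
  ... | no _ | no l≰m = B , Q , A⊆B , λ { first l → ⊥-elim (l≰m l) ; (there i) l → filled i l }
  ... | no j∉B | yes l≤m = cell j ∷ B ,
    grow Q (attach (producible-good G Q) (L⊆ first) j∉B ready) ,
    (λ i → there (A⊆B i)) , λ { first _ → here refl ; (there i) l → there (filled i l) }
    where
      ready : ∀ {d k} → (d , k) ∈ inputs j → cell k ∈ B
      ready u = A⊆B (below (input-site (L⊆ first) u) (<-≤-trans (input-lev (L⊆ first) u) l≤m))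

  build : ∀ {A₀} → Good A₀ → ∀ m → ∃ λ A → Producible T 2 A₀ A × Below m A
  build G zero = _ , seed , λ _ ()
  build G (suc m) with A , P , below ← build G m
    with B , Q , _ , filled ← fill G P below sites (λ i → i) =
    B , Q , λ { j∈ (s≤s l) → filled j∈ l }

  full-terminal : ∀ {A} → Good A → (∀ {j} → j ∈ sites → cell j ∈ A) → Terminal T 2 A
  full-terminal G full p t a@(_ , p∉A , _) with i , i∈ , refl , _ ← attached G a =
    p∉A (∈-map⁺ proj₁ (full i∈))

  -- By induction on the level: a missing site whose inputs are all present could still attach.
  terminal-full : ∀ {A} → Good A → Terminal T 2 A → ∀ {j} → j ∈ sites → cell j ∈ A
  terminal-full {A} G terminal {j} j∈ = go (suc (lev j)) j∈ ≤-refl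
    where
      go : ∀ m {j} → j ∈ sites → lev j < m → cell j ∈ A
      go (suc m) {j} j∈ (s≤s l) with cell∈? G j∈
      ... | yes i = i
      ... | no ¬i = ⊥-elim (terminal (pos j) (f j)
        (attach G j∈ ¬i λ u → go m (input-site j∈ u) (<-≤-trans (input-lev j∈ u) l)))

  unique-assembly : ∀ {A₀} → Good A₀ → ∃ λ A → UniquelyAssembles T 2 A₀ A ×
    (∀ {j} → j ∈ sites → cell j ∈ A)
  -- The sum of all levels is a crude bound for each of them.
  unique-assembly {A₀} G with A , P , below ← build G (suc (sum (map lev sites))) =
    A , (P , full-terminal GA full , λ B Q tB x → same (producible-good G Q) GA full x ,
          same GA (producible-good G Q) (terminal-full (producible-good G Q) tB) x) , full
    where
      GA = producible-good G P
      full : ∀ {j} → j ∈ sites → cell j ∈ A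
      full j∈ = below j∈ (s≤s (∈-sum lev j∈))
      same : ∀ {B C} → Good B → Good C → (∀ {j} → j ∈ sites → cell j ∈ C) → ∀ x → x ∈ B → x ∈ C
      same GB GC full x i with j , j∈ , refl ← sound GB i = full j∈

  -- Parallel stages and the run time

  placed : ℕ → Site → Bool
  allPlaced : ℕ → List (Dir × Site) → Bool
  placed zero j = isSeed j
  placed (suc k) j = placed k j ∨ allPlaced k (inputs j)
  allPlaced k [] = true
  allPlaced k ((_ , j) ∷ L) = placed k j ∧ allPlaced k L

  allPlaced⁻ : ∀ k L {d j} → allPlaced k L ≡ true → (d , j) ∈ L → placed k j ≡ true
  allPlaced⁻ k ((_ , j) ∷ L) h first with placed k j
  ... | true = refl
  allPlaced⁻ k ((_ , j) ∷ L) h (there i) with placed k j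
  ... | true = allPlaced⁻ k L h i

  allPlaced⁺ : ∀ k L → (∀ {d j} → (d , j) ∈ L → placed k j ≡ true) → allPlaced k L ≡ true
  allPlaced⁺ k [] h = refl
  allPlaced⁺ k ((_ , j) ∷ L) h rewrite h first = allPlaced⁺ k L (λ i → h (there i))

  placed-suc : ∀ k j → placed k j ≡ true → placed (suc k) j ≡ true
  placed-suc k j h rewrite h = refl

  placed-ready : ∀ k j → (∀ {d l} → (d , l) ∈ inputs j → placed k l ≡ true) → placed (suc k) j ≡ true
  placed-ready k j h with placed k j
  ... | true = refl
  ... | false = allPlaced⁺ k (inputs j) h

  placed-cases : ∀ k j → placed (suc k) j ≡ true → placed k j ≡ true ⊎ allPlaced k (inputs j) ≡ true
  placed-cases k j h with placed k j
  ... | true = inj₁ refl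
  ... | false = inj₂ h

  placed-mono : ∀ {k m} j → k ≤ m → placed k j ≡ true → placed m j ≡ true
  placed-mono {k} {m} j k≤m h with m≤n⇒∃[o]m+o≡n k≤m
  ... | o , refl = go o
    where
      go : ∀ o → placed (k + o) j ≡ true
      go zero rewrite +-identityʳ k = h
      go (suc o) rewrite +-suc k o = placed-suc (k + o) j (go o)

  placed-inputs : ∀ k {j d l} → j ∈ sites → placed k j ≡ true → (d , l) ∈ inputs j → placed k l ≡ true
  placed-inputs zero j∈ h u = input-seed j∈ h u
  placed-inputs (suc k) {j} {l = l} j∈ h u with placed-cases k j h
  ... | inj₁ p = placed-suc k l (placed-inputs k j∈ p u)
  ... | inj₂ a = placed-suc k l (allPlaced⁻ k (inputs j) a u)

  -- Parallel growth is deterministic up to the order of the list: after `k` steps exactly the sites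
  -- with `placed k` are filled. As `placed` is Boolean, completeness is decidable and the first
  -- complete stage can be searched for.
  record Stage (k : ℕ) (A : Assembly) : Set where
    field
      valid : ValidAssembly A
      only : ∀ {x} → x ∈ A → ∃ λ j → j ∈ sites × x ≡ cell j × placed k j ≡ true
      all : ∀ {j} → j ∈ sites → placed k j ≡ true → cell j ∈ A
  open Stage

  stage-placed : ∀ {k A j} → Stage k A → j ∈ sites → cell j ∈ A → placed k j ≡ true
  stage-placed st j∈ i with j′ , j′∈ , q , h ← only st i
    with refl ← cell-injective j∈ j′∈ q = h

  stage-good : ∀ {k A} → Stage k A → Good A
  stage-good {k} st = record
    { unique = valid st
    ; sound = λ i → let j , j∈ , q , _ = only st i in j , j∈ , q
    ; seeded = λ {j} j∈ s → all st j∈ (placed-mono j (z≤n {k}) s)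
    ; closed = λ j∈ i u → all st (input-site j∈ u) (placed-inputs k j∈ (stage-placed st j∈ i) u)
    }

  grown⁻ : ∀ {k A x} → Stage k A → x ∈ A ⊎ Attachable T 2 A (proj₁ x) (proj₂ x) →
    ∃ λ j → j ∈ sites × x ≡ cell j × placed (suc k) j ≡ true
  grown⁻ {k} st (inj₁ i) with j , j∈ , q , h ← only st i = j , j∈ , q , placed-suc k j h
  grown⁻ {k} st (inj₂ a) with j , j∈ , refl , refl , ready ← attached (stage-good st) a =
    j , j∈ , refl , placed-ready k j (λ u → stage-placed st (input-site j∈ u) (ready u))

  grown⁺ : ∀ {k A j} → Stage k A → j ∈ sites → placed (suc k) j ≡ true →
    cell j ∈ A ⊎ Attachable T 2 A (pos j) (f j)
  grown⁺ {k} {A} {j} st j∈ h with cell∈? (stage-good st) j∈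
  ... | yes i = inj₁ i
  ... | no ¬i with placed-cases k j h
  ...   | inj₁ p = inj₁ (all st j∈ p)
  ...   | inj₂ a = inj₂ (attach (stage-good st) j∈ ¬i
                     λ u → all st (input-site j∈ u) (allPlaced⁻ k (inputs j) a u))

  stage-step : ∀ {k A B} → Stage k A → _⇉_ T 2 A B → Stage (suc k) B
  stage-step st (valid-B , iff) = record
    { valid = valid-B
    ; only = λ {x} i → grown⁻ st (proj₁ (iff x) i)
    ; all = λ {j} j∈ h → proj₂ (iff (cell j)) (grown⁺ st j∈ h)
    }

  snapshot : ℕ → Assembly
  snapshot k = map cell (filter (λ j → placed k j Bool.≟ true) sites)

  snapshot-stage : ∀ k → Stage k (snapshot k)
  snapshot-stage k = record
    { valid = map-unique {g = proj₁}
        (λ i j q → let a , a∈ , p = ∈-map⁻ cell i ; b , b∈ , r = ∈-map⁻ cell j in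
          trans p (trans (cong cell (pos-injective (in-sites a∈) (in-sites b∈)
            (trans (cong proj₁ (sym p)) (trans q (cong proj₁ r))))) (sym r)))
        (map-unique (λ i j → cell-injective (in-sites i) (in-sites j))
          (Unique.filter⁺ P? sites-unique))
    ; only = λ i → let j , j∈ , q = ∈-map⁻ cell i ; j∈sites , h = ∈-filter⁻ P? {xs = sites} j∈ in
        j , j∈sites , q , h
    ; all = λ j∈ h → ∈-map⁺ cell (∈-filter⁺ P? j∈ h)
    }
    where
      P? = λ j → placed k j Bool.≟ true
      in-sites : ∀ {j} → j ∈ filter P? sites → j ∈ sites
      in-sites i = proj₁ (∈-filter⁻ P? {xs = sites} i)

  stage-run : ∀ {k A} m → Stage k A → ∃ λ C → ParRun T 2 A m C × Stage (k + m) C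
  stage-run {k} {A} zero st = A , done , subst (λ z → Stage z A) (sym (+-identityʳ k)) st
  stage-run {k} {A} (suc m) st with C , run , stC ← stage-run m (snapshot-stage (suc k)) =
    C , step (valid next , λ x → (λ i → back x (only next i)) , λ i → forth (grown⁻ st i)) run ,
    subst (λ z → Stage z C) (sym (+-suc k m)) stC
    where
      next = snapshot-stage (suc k)
      back : ∀ x → (∃ λ j → j ∈ sites × x ≡ cell j × placed (suc k) j ≡ true) →
        x ∈ A ⊎ Attachable T 2 A (proj₁ x) (proj₂ x)
      back _ (j , j∈ , refl , h) = grown⁺ st j∈ h
      forth : ∀ {x} → (∃ λ j → j ∈ sites × x ≡ cell j × placed (suc k) j ≡ true) → x ∈ snapshot (suc k)
      forth (j , j∈ , refl , h) = all next j∈ h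

  -- `stage-run` provides one run; this speaks of all of them, which the minimality in `RunTime`
  -- requires.
  run-stage : ∀ {k A m C} → Stage k A → ParRun T 2 A m C → Stage (k + m) C
  run-stage {k} {A} st done = subst (λ z → Stage z A) (sym (+-identityʳ k)) st
  run-stage {k} {C = C} st (step {m = m} g run) =
    subst (λ z → Stage z C) (sym (+-suc k m)) (run-stage (stage-step st g) run)

  Complete : ℕ → Set
  Complete k = All (λ j → placed k j ≡ true) sites

  stage-terminal : ∀ {k A} → Stage k A → Complete k → Terminal T 2 A
  stage-terminal st c = full-terminal (stage-good st) (λ j∈ → all st j∈ (All.lookup c j∈))

  terminal-stage : ∀ {k A} → Stage k A → Terminal T 2 A → Complete k
  terminal-stage st t = All.tabulate λ j∈ → stage-placed st j∈ (terminal-full (stage-good st) t j∈)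

  -- A schedule bounds arrivals from above and need not be exact: it only has to increase along
  -- inputs that lead from one tile outside the seed to another.
  Schedule : (Site → ℕ) → Set
  Schedule time = ∀ {j d k} → j ∈ sites → isSeed j ≡ false → (d , k) ∈ inputs j →
    isSeed k ≡ true ⊎ time k < time j

  scheduled : ∀ {time} → Schedule time → ∀ {j} → j ∈ sites → placed (suc (time j)) j ≡ true
  scheduled {time} ok {j} j∈ = go (suc (time j)) j∈ ≤-refl
    where
      go : ∀ m {j} → j ∈ sites → time j < m → placed m j ≡ true
      go (suc m) {j} j∈ (s≤s l) = by (isSeed j) refl
        where
          by : ∀ c → isSeed j ≡ c → placed (suc m) j ≡ true
          by true s = placed-mono j (z≤n {suc m}) s
          by false s = placed-ready m j λ {_} {k} u → ready k u (ok j∈ s u)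
            where
              ready : ∀ k {d} → (d , k) ∈ inputs j → isSeed k ≡ true ⊎ time k < time j → placed m k ≡ true
              ready k u (inj₁ s) = placed-mono k (z≤n {m}) s
              ready k u (inj₂ t<) = go m (input-site j∈ u) (<-≤-trans t< l)

  complete-by : ∀ {time K} → Schedule time → (∀ {j} → j ∈ sites → time j ≤ K) → Complete (suc K)
  complete-by ok bound = All.tabulate λ {j} j∈ → placed-mono j (s≤s (bound j∈)) (scheduled ok j∈)

  run-time : ∀ {A₀} → Stage 0 A₀ → ∃ λ k → RunTime T 2 A₀ k ×
    (∀ {time K} → Schedule time → (∀ {j} → j ∈ sites → time j ≤ K) → k ≤ 2 + K)
  run-time {A₀} st
    with m , complete , minimal ← least {Complete} (λ k → All.all? (λ j → placed k j Bool.≟ true) sites)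
      (suc (sum (map lev sites)))
      (complete-by {lev} {sum (map lev sites)} (λ j∈ _ u → inj₂ (input-lev j∈ u)) (∈-sum lev))
    with C , run , stC ← stage-run m st =
    -- `RunTime` counts assemblies rather than steps, hence `suc m`. A schedule bounded by `K` is
    -- complete after `suc K` steps, hence `2 + K`.
    suc m , ((m , refl , C , run , stage-terminal stC complete) , not-earlier) ,
    λ {time} {K} ok bound → s≤s (≮⇒≥ λ l → minimal (suc K) l (complete-by {time} {K} ok bound))
    where
      not-earlier : ∀ j → j < suc m → ¬ TerminatesIn T 2 A₀ j
      not-earlier _ (s≤s l) (j , refl , C , run , t) = minimal j l (terminal-stage (run-stage st run) t)

-- Wires and circuits

-- Upwards, a block consists of a horizontal tooth of the seed, the output tiles, the row that
-- distributes the sums, the lane of carries (running east), the lane of spans (running west),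
-- the row that reads the bits, and the input tiles, which hang from the next tooth.  The column
-- at the western end carries from block to block; the spine at the eastern end joins the teeth.
Row Col : Set
Row = Fin 9
Col = Fin 8

pattern tooth = Fin.zero
pattern store = Fin.suc tooth
pattern sums = Fin.suc store
pattern carries = Fin.suc sums
pattern spans = Fin.suc carries
pattern scan = Fin.suc spans
pattern load = Fin.suc scan
pattern column = Fin.suc load
pattern spine = Fin.suc column

pattern u0 = Fin.zero
pattern u1 = Fin.suc u0
pattern u2 = Fin.suc u1
pattern u3 = Fin.suc u2
pattern u4 = Fin.suc u3
pattern u5 = Fin.suc u4
pattern u6 = Fin.suc u5
pattern u7 = Fin.suc u6

-- row, supercell, column of the supercell, block; the vertical lines column and spine use the
-- third component for the height within the block and have 0 in the second
Site : Set
Site = Row × ℕ × Col × ℕ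

Op : Set
Op = Fin 3

pattern kill = Fin.zero
pattern gen = Fin.suc kill
pattern prop = Fin.suc gen

-- ops l h s: the operations of the lower and upper position of a supercell, and that of the span
-- from the one to the other; car c h l: the carry out of the lower position, with the operations
-- of its supercell; fin c s s′: the carry entering a supercell, its lower sum bit, and the upper
-- sum bit of the supercell west of it.
data Val : Set where
  nil : Val
  bits : List Bool → Val
  ops : Op → Op → Op → Val
  car : Bool → Op → Op → Val
  fin : Bool → Bool → Bool → Val

-- Only `sig` names its place, side and value. The others are anonymous: `rd`, `ou` and `base` are
-- the glues of the bit tiles and must look alike everywhere.
data Wire : Set where
  null base : Wire
  rd ou : Bool → Wire
  sig : Site → Dir → Val → ℕ → Wire

power : Wire → ℕ
power null = 0
power base = 2
power (rd _) = 1
power (ou _) = 2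
power (sig _ _ _ s) = s

-- Coding wires as glues

private
  bitLabel-injective : ∀ {a b} → bitLabel a ≡ bitLabel b → a ≡ b
  bitLabel-injective {false} {false} _ = refl
  bitLabel-injective {true} {true} _ = refl

  valCode : Val → List ℕ
  valCode nil = 0 ∷ []
  valCode (bits l) = 1 ∷ map bitLabel l
  valCode (ops a b c) = 2 ∷ toℕ a ∷ toℕ b ∷ toℕ c ∷ []
  valCode (car a b c) = 3 ∷ bitLabel a ∷ toℕ b ∷ toℕ c ∷ []
  valCode (fin a b c) = 4 ∷ bitLabel a ∷ bitLabel b ∷ bitLabel c ∷ []

  map-bitLabel-injective : ∀ {l m} → map bitLabel l ≡ map bitLabel m → l ≡ m
  map-bitLabel-injective {[]} {[]} _ = refl
  map-bitLabel-injective {_ ∷ _} {_ ∷ _} e with p , q ← ∷-injective e =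
    cong₂ _∷_ (bitLabel-injective p) (map-bitLabel-injective q)

  heads : ∀ {a b : ℕ} {l m : List ℕ} → a ∷ l ≡ b ∷ m → a ≡ b × l ≡ m
  heads refl = refl , refl

  valCode-injective : ∀ {v w} → valCode v ≡ valCode w → v ≡ w
  valCode-injective {nil} {nil} _ = refl
  valCode-injective {bits l} {bits m} e = cong bits (map-bitLabel-injective (proj₂ (heads e)))
  valCode-injective {ops a b c} {ops a′ b′ c′} e
    with p , e ← heads (proj₂ (heads e)) with q , e ← heads e with r , _ ← heads e
    with refl ← Fin.toℕ-injective {i = a} {a′} p | refl ← Fin.toℕ-injective {i = b} {b′} q
    | refl ← Fin.toℕ-injective {i = c} {c′} r = refl
  valCode-injective {car a b c} {car a′ b′ c′} e
    with p , e ← heads (proj₂ (heads e)) with q , e ← heads e with r , _ ← heads e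
    with refl ← bitLabel-injective {a} {a′} p | refl ← Fin.toℕ-injective {i = b} {b′} q
    | refl ← Fin.toℕ-injective {i = c} {c′} r = refl
  valCode-injective {fin a b c} {fin a′ b′ c′} e
    with p , e ← heads (proj₂ (heads e)) with q , e ← heads e with r , _ ← heads e
    with refl ← bitLabel-injective {a} {a′} p | refl ← bitLabel-injective {b} {b′} q
    | refl ← bitLabel-injective {c} {c′} r = refl

  -- The power of two holds the head and the odd factor the tail, so unique factorisation reads the
  -- list back; 0 remains for the empty list.
  pack : List ℕ → ℕ
  pack [] = 0
  pack (a ∷ l) = 2 ^ a * suc (2 * pack l)

  odd≢even : ∀ m n → suc (2 * m) ≢ 2 * n
  odd≢even m zero ()
  odd≢even zero (suc n) e with () ← trans e (cong suc (+-suc n (n + 0)))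
  odd≢even (suc m) (suc n) e = odd≢even m n
    (suc-injective (suc-injective
      (trans (cong (λ z → suc (suc z)) (sym (+-suc m (m + 0)))) (trans e (cong suc (+-suc n (n + 0)))))))

  odd-part : ∀ a b m n → 2 ^ a * suc (2 * m) ≡ 2 ^ b * suc (2 * n) → a ≡ b × m ≡ n
  odd-part zero zero m n e =
    refl , *-cancelˡ-≡ m n 2 (suc-injective (trans (sym (*-identityˡ _)) (trans e (*-identityˡ _))))
  odd-part zero (suc b) m n e = ⊥-elim (odd≢even m (2 ^ b * suc (2 * n))
    (trans (sym (*-identityˡ _)) (trans e (*-assoc 2 (2 ^ b) _))))
  odd-part (suc a) zero m n e = ⊥-elim (odd≢even n (2 ^ a * suc (2 * m))
    (trans (sym (*-identityˡ _)) (trans (sym e) (*-assoc 2 (2 ^ a) _))))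
  odd-part (suc a) (suc b) m n e with p , q ← odd-part a b m n
    (*-cancelˡ-≡ _ _ 2 (trans (sym (*-assoc 2 (2 ^ a) _)) (trans e (*-assoc 2 (2 ^ b) _)))) =
    cong suc p , q

  pack-pos : ∀ a l → pack (a ∷ l) ≢ 0
  pack-pos zero l ()
  pack-pos (suc a) l e = pack-pos a l (*-cancelˡ-≡ _ 0 2 (trans (sym (*-assoc 2 (2 ^ a) _)) e))

  pack-injective : ∀ l m → pack l ≡ pack m → l ≡ m
  pack-injective [] [] _ = refl
  pack-injective [] (a ∷ m) e = ⊥-elim (pack-pos a m (sym e))
  pack-injective (a ∷ l) [] e = ⊥-elim (pack-pos a l e)
  pack-injective (a ∷ l) (b ∷ m) e with p , q ← odd-part a b (pack l) (pack m) e =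
    cong₂ _∷_ p (pack-injective l m q)

  sigCode : Site → Dir → Val → List ℕ
  sigCode (r , x , u , i) d v = toℕ r ∷ x ∷ toℕ u ∷ i ∷ toℕ d ∷ valCode v

  -- The offset 6 keeps the signals clear of the six names before them, so that a name reveals the
  -- kind of its wire. The strength of a signal is left out, being the other component of the glue.
  glueName : Wire → ℕ
  glueName null = 0
  glueName base = 1
  glueName (rd b) = 2 + bitLabel b
  glueName (ou b) = 4 + bitLabel b
  glueName (sig j d v s) = 6 + pack (sigCode j d v)

  kind : Wire → ℕ
  kind null = 0
  kind base = 1
  kind (rd _) = 2
  kind (ou _) = 3
  kind (sig _ _ _ _) = 4

  nameKind : ℕ → ℕ
  nameKind 0 = 0
  nameKind 1 = 1
  nameKind 2 = 2
  nameKind 3 = 2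
  nameKind 4 = 3
  nameKind 5 = 3
  nameKind _ = 4

  nameKind-glueName : ∀ w → nameKind (glueName w) ≡ kind w
  nameKind-glueName null = refl
  nameKind-glueName base = refl
  nameKind-glueName (rd false) = refl
  nameKind-glueName (rd true) = refl
  nameKind-glueName (ou false) = refl
  nameKind-glueName (ou true) = refl
  nameKind-glueName (sig _ _ _ _) = refl

  glue-injective : ∀ w w′ → kind w ≡ kind w′ → glueName w ≡ glueName w′ → power w ≡ power w′ → w ≡ w′
  glue-injective null null _ _ _ = refl
  glue-injective base base _ _ _ = refl
  glue-injective (rd b) (rd c) _ e _ = cong rd (bitLabel-injective (suc-injective (suc-injective e)))
  glue-injective (ou b) (ou c) _ e _ = cong ou (bitLabel-injective (+-cancelˡ-≡ 4 _ _ e))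
  glue-injective (sig (r , x , u , i) d v s) (sig (r′ , x′ , u′ , i′) d′ v′ s′) _ e refl
    with e₁ , e ← heads (pack-injective
           (sigCode (r , x , u , i) d v) (sigCode (r′ , x′ , u′ , i′) d′ v′)
           (+-cancelˡ-≡ 6 _ _ e))
    with e₂ , e ← heads e with e₃ , e ← heads e with e₄ , e ← heads e with e₅ , e₆ ← heads e
    with refl ← Fin.toℕ-injective {i = r} {r′} e₁ | refl ← e₂ | refl ← Fin.toℕ-injective {i = u} {u′} e₃ | refl ← e₄
    | refl ← Fin.toℕ-injective {i = d} {d′} e₅ | refl ← valCode-injective {v} {v′} e₆ = refl

abstract
  -- Abstract, since all that follows needs only the strength and injectivity.
  toGlue : Wire → Glue
  toGlue w = glueName w , power w

  strength-toGlue : ∀ w → strength (toGlue w) ≡ power w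
  strength-toGlue w = refl

  toGlue-injective : ∀ {w w′} → toGlue w ≡ toGlue w′ → w ≡ w′
  toGlue-injective {w} {w′} e = glue-injective w w′
    (trans (sym (nameKind-glueName w)) (trans (cong nameKind (cong proj₁ e)) (nameKind-glueName w′)))
    (cong proj₁ e) (cong proj₂ e)

match-wires : ∀ w → match (toGlue w) (toGlue w) ≡ power w
match-wires w = trans (match-refl (toGlue w)) (strength-toGlue w)

wires-match : ∀ {w w′} → 1 ≤ match (toGlue w) (toGlue w′) → w ≡ w′ × match (toGlue w) (toGlue w′) ≡ power w
wires-match {w} {w′} h with e , q ← match-positive _ _ h = toGlue-injective e , trans q (strength-toGlue w)

bitTileOf : Bool → Tile
bitTileOf c = tile (toGlue (ou c)) (toGlue null) (toGlue (rd c)) (toGlue base) (bitLabel c)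

-- Messages, wires and the tiles they determine

source : Dir → List (Dir × Site) → Maybe Site
source d [] = nothing
source d ((e , k) ∷ L) = if does (d Fin.≟ e) then just k else source d L

source-just : ∀ d L {k} → source d L ≡ just k → (d , k) ∈ L
source-just d ((e , k) ∷ L) q with d Fin.≟ e
source-just d ((d , k) ∷ L) refl | yes refl = here refl
... | no _ = there (source-just d L q)

source-here : ∀ d k L → source d ((d , k) ∷ L) ≡ just k
source-here d k L rewrite dec-true (d Fin.≟ d) refl = refl

source-there : ∀ {d e} k L → d ≢ e → source d ((e , k) ∷ L) ≡ source d L
source-there {d} {e} k L d≢e rewrite dec-false (d Fin.≟ e) d≢e = refl

-- `ins`, `out` and `lab` see the input only through the message of the site. So a site with the
-- right message and the right incoming wires carries the right tile.
record Plan (B : Set) : Set where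
  field
    pos : Site → Pos
    sites : List Site
    sites-unique : Unique sites
    pos-injective : ∀ {j k} → j ∈ sites → k ∈ sites → pos j ≡ pos k → j ≡ k
    msg : B → Site → Val
    ins : Site → Val → List (Dir × Site)
    out : Site → Dir → Val → Wire
    lab : Site → Val → ℕ
    isSeed : Site → Bool
    root : Site

module Wiring {B : Set} (plan : Plan B) where
  open Plan plan

  inputs : B → Site → List (Dir × Site)
  inputs b j = ins j (msg b j)

  emitted : B → Site → Dir → Wire
  emitted b j d = out j d (msg b j)

  -- On an input side a tile repeats what the neighbour sends, so that this bond matches by
  -- construction.
  feed : B → Site → Dir → Maybe Site → Wire
  feed b j d (just k) = emitted b k (opp d)
  feed b j d nothing = emitted b j d

  side : B → Site → Dir → Wire
  side b j d = feed b j d (source d (inputs b j))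

  tileAt : B → Site → Tile
  tileAt b j = tile (toGlue (side b j N)) (toGlue (side b j E)) (toGlue (side b j S))
    (toGlue (side b j W)) (lab j (msg b j))

  -- In `weak` both strengths are exactly 1. Hence a bond of strength 2 on an input side shows that
  -- the tile has no other input.
  data Shape (b : B) (j : Site) : List (Dir × Site) → Set where
    rooted : j ≡ root → Shape b j []
    strong : ∀ {d k} → 2 ≤ power (emitted b k (opp d)) → Shape b j ((d , k) ∷ [])
    weak : ∀ {d k e l} → d ≢ e → power (emitted b k (opp d)) ≡ 1 → power (emitted b l (opp e)) ≡ 1 →
      Shape b j ((d , k) ∷ (e , l) ∷ [])

  -- What a site shows on a side that is not an input.  The last two cases are the only
  -- wires that do not name their position and may face a growth site.
  data Emits (b : B) (j : Site) (d : Dir) : Wire → Set where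
    signal : ∀ {v s} → Emits b j d (sig j d v s)
    silent : Emits b j d null
    guarded : ∀ {w} k → k ∈ sites → isSeed k ≡ true → pos k ≡ shift d (pos j) → Emits b j d w
    reads : ∀ {c} → d ≡ S → Emits b j d (rd c)
    writes : ∀ {c} k → d ≡ S → k ∈ sites → pos k ≡ shift d (pos j) → tileAt b k ≡ bitTileOf c →
      inputs b k ≡ (N , j) ∷ [] → Emits b j d (ou c)

record Circuit (B : Set) : Set where
  field
    plan : Plan B
  open Plan plan
  open Wiring plan
  field
    lev : B → Site → ℕ
    root∈sites : root ∈ sites
    root-seed : isSeed root ≡ true
    input-site : ∀ b {j d k} → j ∈ sites → (d , k) ∈ inputs b j → k ∈ sites
    input-pos : ∀ b {j d k} → j ∈ sites → (d , k) ∈ inputs b j → pos k ≡ shift d (pos j)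
    input-seed : ∀ b {j d k} → j ∈ sites → isSeed j ≡ true → (d , k) ∈ inputs b j → isSeed k ≡ true
    input-lev : ∀ b {j d k} → j ∈ sites → (d , k) ∈ inputs b j → lev b k < lev b j
    shape : ∀ b {j} → j ∈ sites → Shape b j (inputs b j)
    emits : ∀ b {j} d → j ∈ sites → source d (inputs b j) ≡ nothing → Emits b j d (emitted b j d)
    out-sig : ∀ i d v {j e w s} → out i d v ≡ sig j e w s → i ≡ j × d ≡ e
    out-north : ∀ i v {c} → out i N v ≢ rd c
    ou-tile : ∀ b {i c} → i ∈ sites → side b i N ≡ ou c → tileAt b i ≡ bitTileOf c
    -- The inputs are those for `b′`: a candidate tile made for `b′` is tested against neighbours
    -- that stand as they do for `b`.
    determined : ∀ b b′ {j} → j ∈ sites → isSeed j ≡ false →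
      (∀ {d k} → (d , k) ∈ inputs b′ j → emitted b′ k (opp d) ≡ emitted b k (opp d)) →
      msg b′ j ≡ msg b j

-- From circuits to locally deterministic growth

module CircuitAssembly {B : Set} (C : Circuit B) (all : List B) (complete : ∀ b → b ∈ all) where
  open Circuit C
  open Plan plan
  open Wiring plan

  tileSet : List Tile
  tileSet = bitTileOf false ∷ bitTileOf true ∷ concatMap (λ b → map (tileAt b) sites) all

  tileAt∈ : ∀ b {j} → j ∈ sites → tileAt b j ∈ tileSet
  tileAt∈ b j∈ = there (there
    (∈-concatMap⁺ (λ b → map (tileAt b) sites) (lose (complete b) (∈-map⁺ (tileAt b) j∈))))

  data Member (t : Tile) : Set where
    isBit : ∀ c → t ≡ bitTileOf c → Member t
    isAt : ∀ b i → i ∈ sites → t ≡ tileAt b i → Member t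

  member : ∀ {t} → t ∈ tileSet → Member t
  member (here e) = isBit false e
  member (there (here e)) = isBit true e
  member (there (there i))
    with b , _ , m ← find (∈-concatMap⁻ (λ b → map (tileAt b) sites) {xs = all} i)
    with j , j∈ , e ← ∈-map⁻ (tileAt b) m = isAt b j j∈ e

  glue-side : ∀ b j d → glue d (tileAt b j) ≡ toGlue (side b j d)
  glue-side b j N = refl
  glue-side b j E = refl
  glue-side b j S = refl
  glue-side b j W = refl

  bitSide : Bool → Dir → Wire
  bitSide c N = ou c
  bitSide c E = null
  bitSide c S = rd c
  bitSide c W = base

  glue-bit : ∀ c d → glue d (bitTileOf c) ≡ toGlue (bitSide c d)
  glue-bit c N = refl
  glue-bit c E = refl
  glue-bit c S = refl
  glue-bit c W = refl

  source-none : ∀ b {j} d → j ∈ sites → (∀ k → ¬ ((d , k) ∈ inputs b j)) → source d (inputs b j) ≡ nothing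
  source-none b {j} d j∈ none with source d (inputs b j) in e
  ... | nothing = refl
  ... | just k = ⊥-elim (none k (source-just d (inputs b j) e))

  source-some : ∀ b {j d k} → j ∈ sites → (d , k) ∈ inputs b j → source d (inputs b j) ≡ just k
  source-some b {j} j∈ u with inputs b j | shape b j∈
  source-some b j∈ first | (d , k) ∷ L | _ = source-here d k L
  source-some b j∈ second | _ ∷ (e , l) ∷ [] | weak {d} {k} d≢e _ _ =
    trans (source-there k ((e , l) ∷ []) (λ q → d≢e (sym q))) (source-here e l [])

  side-input : ∀ b {j d k} → j ∈ sites → (d , k) ∈ inputs b j → side b j d ≡ emitted b k (opp d)
  side-input b {j} {d} j∈ u = cong (feed b j d) (source-some b j∈ u)

  side-free : ∀ b {j} d → j ∈ sites → (∀ k → ¬ ((d , k) ∈ inputs b j)) → side b j d ≡ emitted b j d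
  side-free b {j} d j∈ none = cong (feed b j d) (source-none b d j∈ none)

  -- Otherwise the two sites would be inputs of each other and the level would fall both ways. So
  -- the side of `k` facing `j` shows what `k` itself emits.
  no-return : ∀ b {j d k} → j ∈ sites → (d , k) ∈ inputs b j → ∀ l → ¬ ((opp d , l) ∈ inputs b k)
  no-return b {j} {d} {k} j∈ u l v
    with refl ← pos-injective (input-site b (input-site b j∈ u) v) j∈
           (trans (input-pos b (input-site b j∈ u) v)
             (trans (cong (shift (opp d)) (input-pos b j∈ u)) (shift-opp d (pos j)))) =
    <-asym (input-lev b j∈ u) (input-lev b (input-site b j∈ u) v)

  input-match : ∀ b {j d k} → j ∈ sites → (d , k) ∈ inputs b j →
    match (glue d (tileAt b j)) (glue (opp d) (tileAt b k)) ≡ power (emitted b k (opp d))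
  input-match b {j} {d} {k} j∈ u
    rewrite glue-side b j d | glue-side b k (opp d) | side-input b j∈ u
    | side-free b (opp d) (input-site b j∈ u) (no-return b j∈ u) = match-wires (emitted b k (opp d))

  supported : ∀ b {j} → j ∈ sites → Supported (tileAt b) root j (inputs b j)
  supported b {j} j∈ = go (inputs b j) (shape b j∈) (λ u → input-match b j∈ u)
    where
      go : ∀ L → Shape b j L → (∀ {d k} → (d , k) ∈ L →
        match (glue d (tileAt b j)) (glue (opp d) (tileAt b k)) ≡ power (emitted b k (opp d))) →
        Supported (tileAt b) root j L
      go _ (rooted e) h = isRoot e
      go _ (strong p) h = one (subst (2 ≤_) (sym (h first)) p)
      go _ (weak d≢e p q) h = two d≢e
        (≤-reflexive (sym (trans (h first) p)))
        (≤-reflexive (sym (trans (h second) q)))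

  module _ (b : B) where
    Touch : Pos → Tile → Dir → Site → Set
    Touch = Touches sites pos (tileAt b) (inputs b)

    Unseeded : Pos → Set
    Unseeded p = ∀ {k} → k ∈ sites → isSeed k ≡ true → pos k ≢ p

    touched : ∀ {p t d j w} → Touch p t d j → glue d t ≡ toGlue w →
      w ≡ emitted b j (opp d) × match (glue d t) (glue (opp d) (tileAt b j)) ≡ power w
    touched {d = d} {j} (touches j∈ at free bonded) g
      rewrite g | glue-side b j (opp d) | side-free b (opp d) j∈ free = wires-match bonded

    shown : ∀ {p t d j} → Touch p t d j → Emits b j (opp d) (emitted b j (opp d))
    shown {d = d} (touches j∈ at free bonded) = emits b (opp d) j∈ (source-none b (opp d) j∈ free)

    back : ∀ {p d j} → pos j ≡ shift d p → shift (opp d) (pos j) ≡ p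
    back {p} {d} at = trans (cong (shift (opp d)) at) (shift-opp d p)

    opp-S : ∀ {d} → opp d ≡ S → d ≡ N
    opp-S e = opp-injective e

    -- What the bond with `j` reveals about a tile made for site `i` and input `b′`. A signal proves
    -- that `p` is its own place (`own`). An `rd` glue is weak and says something only once the
    -- place is known (`faint`). An `ou` glue makes it the bit tile that belongs at `p`
    -- (`finished`).
    data Outcome (p : Pos) (d : Dir) (j : Site) (b′ : B) (i : Site) : Set where
      own : pos i ≡ p → (d , j) ∈ inputs b′ i → emitted b′ j (opp d) ≡ emitted b j (opp d) →
        Outcome p d j b′ i
      faint : d ≡ N → power (emitted b j (opp d)) ≡ 1 →
        (pos i ≡ p → (d , j) ∈ inputs b′ i × emitted b′ j (opp d) ≡ emitted b j (opp d)) →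
        Outcome p d j b′ i
      finished : ∀ k → k ∈ sites → pos k ≡ p → tileAt b k ≡ tileAt b′ i → inputs b k ≡ (d , j) ∷ [] →
        Outcome p d j b′ i

    sourced : ∀ b′ i d {w} → side b′ i d ≡ w →
      (∃ λ k → (d , k) ∈ inputs b′ i × emitted b′ k (opp d) ≡ w) ⊎ emitted b′ i d ≡ w
    sourced b′ i d e with source d (inputs b′ i) in q
    ... | just k = inj₁ (k , source-just d (inputs b′ i) q , e)
    ... | nothing = inj₂ e

    opp≢ : ∀ d → d ≢ opp d
    opp≢ N ()
    opp≢ E ()
    opp≢ S ()
    opp≢ W ()

    outcome : ∀ {p d j b′ i} → Unseeded p → i ∈ sites → Touch p (tileAt b′ i) d j →
      Outcome p d j b′ i
    outcome {p} {d} {j} {b′} {i} unseeded i∈ τ@(touches j∈ at free bonded)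
      with w≡ , m≡ ← touched τ (glue-side b′ i d) = go (shown τ) refl
      where
        go : ∀ {w} → Emits b j (opp d) w → w ≡ emitted b j (opp d) → Outcome p d j b′ i
        go (guarded k k∈ s k-at) _ = ⊥-elim (unseeded k∈ s (trans k-at (back at)))
        go silent e = ⊥-elim (1+n≰n (≤-trans bonded (≤-reflexive (trans m≡ (cong power (trans w≡ (sym e)))))))
        go signal e with sourced b′ i d (trans w≡ (sym e))
        -- A signal emitted by `i` itself would name side `d`, but the one from `j` names `opp d`.
        ... | inj₂ q with _ , d≡ ← out-sig i d (msg b′ i) q = ⊥-elim (opp≢ d d≡)
        ... | inj₁ (k , u , q) with refl , _ ← out-sig k (opp d) (msg b′ k) q =
          own (shift-injective d (trans (sym (input-pos b′ i∈ u)) at)) u (trans q e)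
        go (reads d≡) e with sourced b′ i d (trans w≡ (sym e)) | opp-S {d} d≡
        ... | inj₂ q | refl = ⊥-elim (out-north i (msg b′ i) q)
        ... | inj₁ (k , u , q) | refl = faint refl (cong power (sym e)) λ i-at →
          same (pos-injective (input-site b′ i∈ u) j∈
            (trans (input-pos b′ i∈ u) (trans (cong (shift N) i-at) (sym at))))
          where
            same : k ≡ j → (N , j) ∈ inputs b′ i × emitted b′ j S ≡ emitted b j S
            same refl = u , trans q e
        go (writes k d≡ k∈ k-at tile≡ in≡) e with opp-S {d} d≡
        ... | refl = finished k k∈ (trans k-at (back {d = N} at))
          (trans tile≡ (sym (ou-tile b′ i∈ (trans w≡ (sym e))))) in≡

    -- Of the glues that may face a place outside the seed, a bit tile answers only `ou`. `rd` is
    -- shown downwards, and the tile below it would have to match with its north side, where a bit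
    -- tile has `ou`.
    bit-outcome : ∀ {p d j c} → Unseeded p → Touch p (bitTileOf c) d j →
      ∃ λ k → k ∈ sites × pos k ≡ p × tileAt b k ≡ bitTileOf c × inputs b k ≡ (d , j) ∷ []
    bit-outcome {p} {d} {j} {c} unseeded τ@(touches j∈ at free bonded)
      with w≡ , m≡ ← touched τ (glue-bit c d) = go (shown τ) (trans w≡ refl)
      where
        Result = ∃ λ k → k ∈ sites × pos k ≡ p × tileAt b k ≡ bitTileOf c × inputs b k ≡ (d , j) ∷ []
        not-signal : ∀ d {v s} → bitSide c d ≢ sig j (opp d) v s
        not-signal N ()
        not-signal E ()
        not-signal S ()
        not-signal W ()
        ou≢rd : ∀ {c′} → d ≡ N → bitSide c d ≢ rd c′
        ou≢rd refl ()
        ou-inj : ∀ {c′} → d ≡ N → bitSide c d ≡ ou c′ → c ≡ c′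
        ou-inj refl refl = refl
        go : ∀ {w} → Emits b j (opp d) w → bitSide c d ≡ w → Result
        go (guarded k k∈ s k-at) _ = ⊥-elim (unseeded k∈ s (trans k-at (back at)))
        go silent e = ⊥-elim (1+n≰n (≤-trans bonded (≤-reflexive (trans m≡ (cong power e)))))
        go signal e = ⊥-elim (not-signal d e)
        go (reads d≡) e = ⊥-elim (ou≢rd (opp-S {d} d≡) e)
        go (writes k d≡ k∈ k-at tile≡ in≡) e =
          k , k∈ , trans k-at (back at) , trans tile≡ (cong bitTileOf (sym (ou-inj (opp-S {d} d≡) e))) ,
          subst (λ z → inputs b k ≡ (z , j) ∷ []) (sym (opp-S {d} d≡)) in≡

    identify : ∀ b′ {i} → i ∈ sites → Unseeded (pos i) →
      (∀ {d k} → (d , k) ∈ inputs b′ i → emitted b′ k (opp d) ≡ emitted b k (opp d)) →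
      tileAt b i ≡ tileAt b′ i × inputs b i ≡ inputs b′ i
    identify b′ {i} i∈ unseeded agree = tiles≡ , cong (ins i) (sym msg≡)
      where
        unseed : ∀ c → isSeed i ≡ c → isSeed i ≡ false
        unseed false e = e
        unseed true e = ⊥-elim (unseeded i∈ e refl)
        msg≡ : msg b′ i ≡ msg b i
        msg≡ = determined b b′ i∈ (unseed (isSeed i) refl) agree
        feed≡ : ∀ d → (∀ {k} → source d (inputs b′ i) ≡ just k → emitted b′ k (opp d) ≡ emitted b k (opp d)) →
          side b i d ≡ side b′ i d
        feed≡ d h rewrite sym msg≡ with source d (ins i (msg b′ i))
        ... | just k = sym (h refl)
        ... | nothing = cong (out i d) (sym msg≡)
        side≡ : ∀ d → side b i d ≡ side b′ i d
        side≡ d = feed≡ d λ q → agree (source-just d (inputs b′ i) q)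
        tiles≡ : tileAt b i ≡ tileAt b′ i
        tiles≡ rewrite side≡ N | side≡ E | side≡ S | side≡ W | msg≡ = refl

    Attaches : Pos → Tile → (Site → Set) → Set
    Attaches p t Q = ∃ λ i → i ∈ sites × pos i ≡ p × tileAt b i ≡ t ×
      (∀ {e k} → (e , k) ∈ inputs b i → Q k)

    lone : ∀ {i d j} (Q : Site → Set) → inputs b i ≡ (d , j) ∷ [] → Q j →
      ∀ {e k} → (e , k) ∈ inputs b i → Q k
    lone Q eq q u with subst (_ ∈_) eq u
    ... | here refl = q

    strong-bond : ∀ {p t d j} → t ∈ tileSet → Unseeded p → Touch p t d j →
      2 ≤ match (glue d t) (glue (opp d) (tileAt b j)) → Attaches p t (_≡ j)
    strong-bond t∈ unseeded τ two≤ with member t∈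
    ... | isBit c refl with k , k∈ , at , eq , in≡ ← bit-outcome unseeded τ =
      k , k∈ , at , eq , lone (_≡ _) in≡ refl
    ... | isAt b′ i i∈ refl with outcome unseeded i∈ τ
    ...   | finished k k∈ at eq in≡ = k , k∈ , at , eq , lone (_≡ _) in≡ refl
    strong-bond {d = d} t∈ unseeded τ two≤ | isAt b′ i i∈ refl | faint _ p≡1 _
      with w≡ , m≡ ← touched τ (glue-side b′ i d) =
      ⊥-elim (1+n≰n (≤-trans two≤ (≤-reflexive (trans m≡ (trans (cong power w≡) p≡1)))))
    strong-bond {d = d} {j} t∈ unseeded τ two≤ | isAt b′ i i∈ refl | own refl u wire
      with w≡ , m≡ ← touched τ (glue-side b′ i d) = result
      where
        powerful : 2 ≤ power (emitted b′ j (opp d))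
        powerful = ≤-trans two≤ (≤-reflexive (trans m≡ (cong power (trans w≡ (sym wire)))))
        only : ∀ L → Shape b′ i L → (d , j) ∈ L → L ≡ (d , j) ∷ []
        only _ (strong _) first = refl
        only _ (weak _ p _) first = ⊥-elim (1+n≰n (≤-trans powerful (≤-reflexive p)))
        only _ (weak _ _ q) second = ⊥-elim (1+n≰n (≤-trans powerful (≤-reflexive q)))
        in≡ : inputs b′ i ≡ (d , j) ∷ []
        in≡ = only (inputs b′ i) (shape b′ i∈) u
        agree : ∀ {e k} → (e , k) ∈ inputs b′ i → emitted b′ k (opp e) ≡ emitted b k (opp e)
        agree v with subst (_ ∈_) in≡ v
        ... | here refl = wire
        result : Attaches (pos i) (tileAt b′ i) (_≡ j)
        result with eq , in′ ← identify b′ i∈ unseeded agree =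
          i , i∈ , refl , eq , lone (_≡ _) (trans in′ in≡) refl

    covers : ∀ b′ {i d j e l} L → Shape b′ i L → d ≢ e → (d , j) ∈ L → (e , l) ∈ L →
      ∀ {x} → x ∈ L → x ≡ (d , j) ⊎ x ≡ (e , l)
    covers b′ _ (strong _) d≢e first first = ⊥-elim (d≢e refl)
    covers b′ _ (weak _ _ _) d≢e first first = ⊥-elim (d≢e refl)
    covers b′ _ (weak _ _ _) d≢e second second = ⊥-elim (d≢e refl)
    covers b′ _ (weak _ _ _) d≢e first second first = inj₁ refl
    covers b′ _ (weak _ _ _) d≢e first second second = inj₂ refl
    covers b′ _ (weak _ _ _) d≢e second first first = inj₂ refl
    covers b′ _ (weak _ _ _) d≢e second first second = inj₁ refl

    both : ∀ {p d j e l b′ i} → i ∈ sites → Unseeded p → pos i ≡ p → d ≢ e →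
      (d , j) ∈ inputs b′ i → emitted b′ j (opp d) ≡ emitted b j (opp d) →
      (e , l) ∈ inputs b′ i → emitted b′ l (opp e) ≡ emitted b l (opp e) →
      Attaches p (tileAt b′ i) (λ k → k ≡ j ⊎ k ≡ l)
    both {d = d} {j} {e} {l} {b′} {i} i∈ unseeded refl d≢e u wire v wire′
      with eq , in≡ ← identify b′ i∈ unseeded
             (λ x → [ (λ { refl → wire }) , (λ { refl → wire′ }) ]′
               (covers b′ (inputs b′ i) (shape b′ i∈) d≢e u v x)) =
      i , i∈ , refl , eq , λ x → Sum.map (cong proj₂) (cong proj₂)
        (covers b′ (inputs b′ i) (shape b′ i∈) d≢e u v (subst (_ ∈_) in≡ x))

    weak-bonds : ∀ {p t d j e l} → t ∈ tileSet → Unseeded p → d ≢ e →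
      Touch p t d j → Touch p t e l → Attaches p t (λ k → k ≡ j ⊎ k ≡ l)
    weak-bonds t∈ unseeded d≢e τ υ with member t∈
    ... | isBit c refl with k , k∈ , at , eq , in≡ ← bit-outcome unseeded τ =
      k , k∈ , at , eq , lone (λ k → k ≡ _ ⊎ k ≡ _) in≡ (inj₁ refl)
    ... | isAt b′ i i∈ refl with outcome unseeded i∈ τ | outcome unseeded i∈ υ
    ...   | finished k k∈ at eq in≡ | _ = k , k∈ , at , eq , lone (λ k → k ≡ _ ⊎ k ≡ _) in≡ (inj₁ refl)
    ...   | _ | finished k k∈ at eq in≡ = k , k∈ , at , eq , lone (λ k → k ≡ _ ⊎ k ≡ _) in≡ (inj₂ refl)
    -- An `rd` glue reaches a tile from the north only, so of two different sides at most one is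
    -- faint and the other fixes the place.
    ...   | faint refl _ _ | faint refl _ _ = ⊥-elim (d≢e refl)
    ...   | own at u wire | own _ v wire′ = both i∈ unseeded at d≢e u wire v wire′
    ...   | own at u wire | faint _ _ h with v , wire′ ← h at = both i∈ unseeded at d≢e u wire v wire′
    weak-bonds t∈ unseeded d≢e τ υ | isAt b′ i i∈ refl | faint _ _ h | own at v wire′
      with u , wire ← h at = both i∈ unseeded at d≢e u wire v wire′

    dataflow : Dataflow tileSet
    dataflow = record
      { pos = pos
      ; f = tileAt b
      ; inputs = inputs b
      ; sites = sites
      ; sites-unique = sites-unique
      ; pos-injective = pos-injective
      ; f∈T = tileAt∈ b
      ; isSeed = isSeed
      ; lev = lev b
      ; input-site = input-site b
      ; input-pos = input-pos b
      ; input-seed = input-seed b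
      ; input-lev = input-lev b
      ; root = root
      ; root∈sites = root∈sites
      ; root-seed = root-seed
      ; supported = supported b
      ; strong-bond = strong-bond
      ; weak-bonds = weak-bonds
      }

-- Carries

at : ∀ {m} → Vec Bool m → ℕ → Bool
at [] _ = false
at (x ∷ v) zero = x
at (x ∷ v) (suc k) = at v k

at-lookup : ∀ {m} (v : Vec Bool m) i → at v (toℕ i) ≡ lookup v i
at-lookup (x ∷ v) Fin.zero = refl
at-lookup (x ∷ v) (Fin.suc i) = at-lookup v i

at-beyond : ∀ {m} (v : Vec Bool m) k → m ≤ k → at v k ≡ false
at-beyond [] k _ = refl
at-beyond (x ∷ v) (suc k) (s≤s l) = at-beyond v k l

opOf : Bool → Bool → Op
opOf false false = kill
opOf false true = prop
opOf true false = prop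
opOf true true = gen

apply : Op → Bool → Bool
apply kill _ = false
apply gen _ = true
apply prop c = c

_after_ : Op → Op → Op
kill after q = kill
gen after q = gen
prop after q = q

apply-after : ∀ p q c → apply (p after q) c ≡ apply p (apply q c)
apply-after kill q c = refl
apply-after gen q c = refl
apply-after prop q c = refl

isProp : Op → Bool
isProp prop = true
isProp _ = false

carryFrom : Bool → (ℕ → Op) → ℕ → Bool
carryFrom c q zero = c
carryFrom c q (suc k) = apply (q k) (carryFrom c q k)

carry : (ℕ → Op) → ℕ → Bool
carry = carryFrom false

sumBit : (ℕ → Op) → ℕ → Bool
sumBit q k = isProp (q k) xor carry q k

double : ℕ → ℕ
double zero = zero
double (suc m) = suc (suc (double m))

-- Positions k, …, k + 2m − 1, composed from the middle outwards as the folded block does it.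
span : (ℕ → Op) → ℕ → ℕ → Op
span q k zero = prop
span q k (suc m) = q (double m + suc k) after (span q (suc k) m after q k)

span-carry : ∀ q m k → apply (span q k m) (carry q k) ≡ carry q (double m + k)
span-carry q zero k = refl
span-carry q (suc m) k = begin
  apply (hi after (span q (suc k) m after q k)) (carry q k)
    ≡⟨ apply-after hi _ _ ⟩
  apply hi (apply (span q (suc k) m after q k) (carry q k))
    ≡⟨ cong (apply hi) (apply-after (span q (suc k) m) (q k) _) ⟩
  apply hi (apply (span q (suc k) m) (carry q (suc k)))
    ≡⟨ cong (apply hi) (span-carry q m (suc k)) ⟩
  carry q (suc (double m + suc k))
    ≡⟨ cong (λ z → carry q (suc z)) (+-suc (double m) k) ⟩
  carry q (double (suc m) + k) ∎
  where
    open ≡-Reasoning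
    hi = q (double m + suc k)

after-prop : ∀ p q → p after q ≡ prop → p ≡ prop × q ≡ prop
after-prop prop q e = refl , e

-- `kill` and `gen` absorb whatever comes before them, so a composite propagates only if each factor
-- does.
span-prop : ∀ q m k → span q k m ≡ prop → ∀ i → i < double m → q (i + k) ≡ prop
span-prop q (suc m) k e i l
  with e₁ , e₂ ← after-prop (q (double m + suc k)) _ e
  with e₃ , e₄ ← after-prop (span q (suc k) m) (q k) e₂ = go i l
  where
    go : ∀ i → i < double (suc m) → q (i + k) ≡ prop
    go zero _ = e₄
    go (suc i) (s≤s i≤) with m≤n⇒m<n∨m≡n (≤-pred i≤)
    ... | inj₁ i< = subst (λ z → q z ≡ prop) (+-suc i k) (span-prop q m (suc k) e₃ i i<)
    ... | inj₂ refl = subst (λ z → q z ≡ prop) (+-suc (double m) k) e₁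

-- Binary addition by ripple carry

carryFrom-shift : ∀ c q k → carryFrom c q (suc k) ≡ carryFrom (apply (q 0) c) (λ i → q (suc i)) k
carryFrom-shift c q zero = refl
carryFrom-shift c q (suc k) = cong (apply (q (suc k))) (carryFrom-shift c q k)

digit : ∀ d z → d < 2 → (d + z * 2) % 2 ≡ d × (d + z * 2) / 2 ≡ z
digit d z d<2 =
  trans ([m+kn]%n≡m%n d z 2) (m<n⇒m%n≡m d<2) ,
  trans (+-distrib-/-∣ʳ d (divides z refl)) (cong₂ _+_ (m<n⇒m/n≡0 d<2) (m*n/n≡m z 2))

full-adder : ∀ x y c → bitLabel x + bitLabel y + bitLabel c ≡
  bitLabel (isProp (opOf x y) xor c) + bitLabel (apply (opOf x y) c) * 2
full-adder false false false = refl
full-adder false false true = refl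
full-adder false true false = refl
full-adder false true true = refl
full-adder true false false = refl
full-adder true false true = refl
full-adder true true false = refl
full-adder true true true = refl

bitLabel<2 : ∀ b → bitLabel b < 2
bitLabel<2 false = s≤s z≤n
bitLabel<2 true = s≤s (s≤s z≤n)

bitLabel-≡ᵇ : ∀ b → (bitLabel b ≡ᵇ 1) ≡ b
bitLabel-≡ᵇ false = refl
bitLabel-≡ᵇ true = refl

-- Stated for an arbitrary incoming carry, because removing the lowest bits turns them into a carry
-- for the rest.
ripple : ∀ {n} (a b : Vec Bool n) c (i : Fin (suc n)) → let q = λ k → opOf (at a k) (at b k) in
  lookup (toBits (suc n) (val a + val b + bitLabel c)) i ≡ isProp (q (toℕ i)) xor carryFrom c q (toℕ i)
ripple [] [] false Fin.zero = refl
ripple [] [] true Fin.zero = refl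
ripple {suc n} (x ∷ a) (y ∷ b) c i = go i
  where
    q : ℕ → Op
    q k = opOf (at (x ∷ a) k) (at (y ∷ b) k)
    s = isProp (opOf x y) xor c
    c′ = apply (opOf x y) c
    total : val (x ∷ a) + val (y ∷ b) + bitLabel c ≡ bitLabel s + (val a + val b + bitLabel c′) * 2
    total = begin
      bitLabel x + 2 * val a + (bitLabel y + 2 * val b) + bitLabel c
        ≡⟨ solve 5 (λ p A r B c → p :+ con 2 :* A :+ (r :+ con 2 :* B) :+ c := (p :+ r :+ c) :+ (A :+ B) :* con 2)
             refl (bitLabel x) (val a) (bitLabel y) (val b) (bitLabel c) ⟩
      (bitLabel x + bitLabel y + bitLabel c) + (val a + val b) * 2
        ≡⟨ cong (_+ (val a + val b) * 2) (full-adder x y c) ⟩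
      (bitLabel s + bitLabel c′ * 2) + (val a + val b) * 2
        ≡⟨ solve 3 (λ s c A → (s :+ c :* con 2) :+ A :* con 2 := s :+ (A :+ c) :* con 2)
             refl (bitLabel s) (bitLabel c′) (val a + val b) ⟩
      bitLabel s + (val a + val b + bitLabel c′) * 2 ∎
      where
        open ≡-Reasoning
        open +-*-Solver
    parts = digit (bitLabel s) (val a + val b + bitLabel c′) (bitLabel<2 s)
    go : ∀ i → lookup (toBits (suc (suc n)) (val (x ∷ a) + val (y ∷ b) + bitLabel c)) i ≡
      isProp (q (toℕ i)) xor carryFrom c q (toℕ i)
    go Fin.zero = trans (cong (_≡ᵇ 1) (trans (cong (_% 2) total) (proj₁ parts))) (bitLabel-≡ᵇ s)
    go (Fin.suc i) = begin
      lookup (toBits (suc n) ((val (x ∷ a) + val (y ∷ b) + bitLabel c) / 2)) i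
        ≡⟨ cong (λ z → lookup (toBits (suc n) z) i) (trans (cong (_/ 2) total) (proj₂ parts)) ⟩
      lookup (toBits (suc n) (val a + val b + bitLabel c′)) i
        ≡⟨ ripple a b c′ i ⟩
      isProp (q (suc (toℕ i))) xor carryFrom c′ (λ k → q (suc k)) (toℕ i)
        ≡⟨ cong (isProp (q (suc (toℕ i))) xor_) (carryFrom-shift c q (toℕ i)) ⟨
      isProp (q (suc (toℕ i))) xor carryFrom c q (suc (toℕ i)) ∎
      where open ≡-Reasoning

opAt : ∀ n → Vec Bool (n + n) → ℕ → Op
opAt n v k = opOf (at (Vec.take n v) k) (at (Vec.drop n v) k)

adder-sumBit : ∀ n v i → lookup (adderFun n v) i ≡ sumBit (opAt n v) (toℕ i)
adder-sumBit n v i = trans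
  (cong (λ z → lookup (toBits (suc n) z) i) (sym (+-identityʳ (val (Vec.take n v) + val (Vec.drop n v)))))
  (ripple (Vec.take n v) (Vec.drop n v) false i)

-- The layout

odd : Col → Bool
odd u0 = false
odd u1 = true
odd u2 = false
odd u3 = true
odd u4 = false
odd u5 = true
odd u6 = false
odd u7 = true

digits : ∀ m .{{_ : NonZero m}} {a b x y} → a < m → b < m → a + x * m ≡ b + y * m → a ≡ b × x ≡ y
digits m {a} {b} {x} {y} a<m b<m e = a≡b , *-cancelʳ-≡ x y m (+-cancelˡ-≡ b _ _ (trans (cong (_+ x * m) (sym a≡b)) e))
  where
    a≡b : a ≡ b
    a≡b = trans (sym (trans ([m+kn]%n≡m%n a x m) (m<n⇒m%n≡m a<m)))
      (trans (cong (_% m) e) (trans ([m+kn]%n≡m%n b y m) (m<n⇒m%n≡m b<m)))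

n≡ᵇn : ∀ n → (n ≡ᵇ n) ≡ true
n≡ᵇn zero = refl
n≡ᵇn (suc n) = n≡ᵇn n

<⇒≢ᵇ : ∀ {m n} → m < n → (m ≡ᵇ n) ≡ false
<⇒≢ᵇ {zero} {suc n} _ = refl
<⇒≢ᵇ {suc m} {suc n} (s≤s l) = <⇒≢ᵇ l

<⇒<ᵇ-true : ∀ {m n} → m < n → (m <ᵇ n) ≡ true
<⇒<ᵇ-true {zero} {suc n} _ = refl
<⇒<ᵇ-true {suc m} {suc n} (s≤s l) = <⇒<ᵇ-true l

n<ᵇn : ∀ n → (n <ᵇ n) ≡ false
n<ᵇn zero = refl
n<ᵇn (suc n) = n<ᵇn n

∸-step : ∀ {m n} → m < n → n ∸ m ≡ suc (n ∸ suc m)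
∸-step {zero} {suc n} _ = refl
∸-step {suc m} {suc n} (s≤s l) = ∸-step l

weight : Op → ℕ
weight prop = 1
weight _ = 2

-- Strength 1 occurs exactly where the receiving tile needs a second neighbour.
strengthOf : Site → Dir → Val → ℕ
strengthOf (scan , _ , u0 , _) E _ = 1
strengthOf (scan , _ , u2 , _) E _ = 1
strengthOf (scan , _ , u4 , _) E _ = 1
strengthOf (scan , _ , u6 , _) E _ = 1
strengthOf (scan , _ , u7 , _) S (bits (b ∷ a ∷ _)) = weight (opOf a b)
strengthOf (spans , _ , u7 , _) S (ops lo _ _) = weight lo
strengthOf (spans , _ , u1 , _) S _ = 1
strengthOf (spans , zero , u0 , _) W (ops _ _ s) = weight s
strengthOf (spans , suc _ , u0 , _) W _ = 1
strengthOf (carries , _ , u0 , _) E _ = 1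
strengthOf (carries , _ , u6 , _) E _ = 1
strengthOf (column , _ , u3 , _) N _ = 1
strengthOf _ _ _ = 2

bitOf : Val → Bool
bitOf (bits (b ∷ _)) = b
bitOf _ = false

lowSum highSum : Val → Bool
lowSum (fin _ s _) = s
lowSum _ = false
highSum (fin _ _ s) = s
highSum _ = false

tap : Col → Maybe (Val → Bool)
tap u1 = just lowSum
tap u3 = just highSum
tap _ = nothing

-- `c` enters the supercell at its lower position and `s` leads from there through its upper
-- position, so `apply s c` is the carry into the next higher position. That is the upper position
-- of the supercell to the west, whose operation is `h`.
combine : Val → Val → Val
combine (car c h _) (ops l _ s) = fin c (isProp l xor c) (isProp h xor apply s c)
combine _ _ = nil

back : Col → ℕ
back u = 7 ∸ toℕ u

port : ℕ → Col
port 0 = u1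
port 1 = u3
port 2 = u5
port _ = u7

module Layout (n w : ℕ) where

  Input : Set
  Input = Vec Bool (n + n)

  -- The position number `x` of block `r`, counted from its low end and from its high end.
  -- `double (w ∸ suc x)` is the number of positions strictly between the two, which is the form
  -- that the recursion of `span` produces.
  lo hi : ℕ → ℕ → ℕ
  lo x r = x + r * double w
  hi x r = double (w ∸ suc x) + suc (lo x r)

  q : Input → ℕ → Op
  q = opAt n

  index : ℕ → Col → ℕ → ℕ
  index x u5 r = hi x r
  index x u7 r = hi x r
  index x _ r = lo x r

  operand : Input → Col → Vec Bool n
  operand b u3 = Vec.drop n b
  operand b u7 = Vec.drop n b
  operand b _ = Vec.take n b

  inBit : Input → ℕ → Col → ℕ → Bool
  inBit b x u r = at (operand b u) (index x u r)

  real : ℕ → Col → ℕ → Bool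
  real x u r = index x u r <ᵇ n

  -- The bits read so far, latest first. After the fourth, the scanning row knows both operations of
  -- the supercell and hands them down from its last column.
  prefix : Input → ℕ → ℕ → ℕ → List Bool
  prefix b x r zero = []
  prefix b x r (suc m) = inBit b x (port m) r ∷ prefix b x r m

  read : Input → ℕ → Col → ℕ → List Bool
  read b x u0 r = prefix b x r 0
  read b x u1 r = prefix b x r 1
  read b x u2 r = prefix b x r 1
  read b x u3 r = prefix b x r 2
  read b x u4 r = prefix b x r 2
  read b x u5 r = prefix b x r 3
  read b x u6 r = prefix b x r 3
  read b x u7 r = prefix b x r 4

  -- The third component is the span of the block just passed, by which the tile at the exit knows
  -- whether it waits for the carry from below. The second stands for an upper position west of
  -- supercell 0; there is none, hence `prop`.
  blockCarry : Input → ℕ → Val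
  blockCarry b zero = car false prop prop
  blockCarry b (suc r) = car (carry (q b) (lo 0 (suc r))) prop (span (q b) (lo 0 r) w)

  localCarry : Input → ℕ → ℕ → Val
  localCarry b zero r = blockCarry b r
  localCarry b (suc x) r = car (carry (q b) (lo (suc x) r)) (q b (hi x r)) (q b (lo x r))

  spanVal : Input → ℕ → ℕ → Val
  spanVal b x r = if x <ᵇ w
    then ops (q b (lo x r)) (q b (hi x r)) (span (q b) (lo x r) (w ∸ x))
    else ops prop prop prop

  sumVal : Input → ℕ → ℕ → Val
  sumVal b x r = combine (localCarry b x r) (spanVal b x r)

  msg : Input → Site → Val
  msg b (tooth , x , u , r) = nil
  msg b (store , x , u1 , r) = bits (lowSum (sumVal b x r) ∷ [])
  msg b (store , x , u3 , r) = bits (highSum (sumVal b x r) ∷ [])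
  msg b (store , x , _ , r) = nil
  msg b (sums , x , u , r) = sumVal b x r
  msg b (carries , x , u0 , r) = localCarry b x r
  msg b (carries , x , u7 , r) = localCarry b (suc x) r
  msg b (carries , x , _ , r) = sumVal b x r
  msg b (spans , x , u , r) = spanVal b x r
  msg b (scan , x , u , r) = bits (read b x u r)
  msg b (load , x , u , r) = if odd u then bits (inBit b x u r ∷ []) else nil
  msg b (column , x , u0 , r) = blockCarry b r
  msg b (column , x , u1 , r) = blockCarry b r
  msg b (column , x , u2 , r) = blockCarry b r
  msg b (column , x , u3 , r) = blockCarry b r
  msg b (column , x , _ , r) = blockCarry b (suc r)
  msg b (spine , x , u , r) = ops prop prop prop

  -- Supercell `w` ends after its fourth column, where the spine takes over; `v` is the height at
  -- which the row meets it.
  eastOf : Row → Col → ℕ → Col → ℕ → Site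
  eastOf row v x u0 r = row , x , u1 , r
  eastOf row v x u1 r = row , x , u2 , r
  eastOf row v x u2 r = row , x , u3 , r
  eastOf row v x u3 r = if x ≡ᵇ w then (spine , 0 , v , r) else (row , x , u4 , r)
  eastOf row v x u4 r = row , x , u5 , r
  eastOf row v x u5 r = row , x , u6 , r
  eastOf row v x u6 r = row , x , u7 , r
  eastOf row v x u7 r = row , suc x , u0 , r

  westOf : Row → ℕ → Col → ℕ → Site
  westOf row x u0 r = row , x , u0 , r
  westOf row x u1 r = row , x , u0 , r
  westOf row x u2 r = row , x , u1 , r
  westOf row x u3 r = row , x , u2 , r
  westOf row x u4 r = row , x , u3 , r
  westOf row x u5 r = row , x , u4 , r
  westOf row x u6 r = row , x , u5 , r
  westOf row x u7 r = row , x , u6 , r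

  previous : ℕ → ℕ → Site
  previous zero r = column , 0 , u3 , r
  previous (suc x) r = carries , x , u7 , r

  ifProp : Op → Dir × Site → List (Dir × Site)
  ifProp prop y = y ∷ []
  ifProp _ y = []

  upward : Row → ℕ → Col → ℕ → List (Dir × Site)
  upward row x u0 zero = []
  upward row x u0 (suc r) = (S , row , 0 , u6 , r) ∷ []
  upward row x u r = (S , westOf row 0 u r) ∷ []

  -- Since inputs may depend on the message alone, every gate carries the operation that decides
  -- whether it waits: the lower one on the lane of carries, the upper one on the lane of spans, the
  -- span of the block on the column.
  ins : Site → Val → List (Dir × Site)
  ins (tooth , x , u , r) _ = (E , eastOf tooth u0 x u r) ∷ []
  ins (store , x , u , r) _ = if odd u then (N , sums , x , u , r) ∷ [] else (S , tooth , x , u , r) ∷ []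
  ins (sums , x , u1 , r) _ = (N , carries , x , u1 , r) ∷ []
  ins (sums , x , u , r) _ = (W , westOf sums x u r) ∷ []
  ins (carries , x , u0 , r) _ = (W , previous x r) ∷ []
  ins (carries , x , u1 , r) _ = (W , carries , x , u0 , r) ∷ (N , spans , x , u1 , r) ∷ []
  ins (carries , x , u7 , r) (car _ _ l) = (N , spans , x , u7 , r) ∷ ifProp l (W , carries , x , u6 , r)
  ins (carries , x , u7 , r) _ = []
  ins (carries , x , u , r) _ = (W , westOf carries x u r) ∷ []
  ins (spans , x , u7 , r) (ops _ h _) = (N , scan , x , u7 , r) ∷ ifProp h (E , spans , suc x , u0 , r)
  ins (spans , x , u7 , r) _ = []
  ins (spans , x , u , r) _ = (E , eastOf spans u4 x u r) ∷ []
  ins (scan , x , u0 , r) _ = (N , load , x , u0 , r) ∷ []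
  ins (scan , x , u , r) _ = (W , westOf scan x u r) ∷ (if odd u then (N , load , x , u , r) ∷ [] else [])
  ins (load , x , u , r) _ = if odd u then (W , westOf load x u r) ∷ [] else (N , tooth , x , u , suc r) ∷ []
  ins (column , x , u0 , zero) _ = (E , tooth , 0 , u0 , 0) ∷ []
  ins (column , x , u4 , r) (car _ _ s) = (E , spans , 0 , u0 , r) ∷ ifProp s (S , column , 0 , u3 , r)
  ins (column , x , u4 , r) _ = []
  ins (column , x , u , r) _ = upward column x u r
  ins (spine , x , u , r) _ = upward spine x u r

  -- Without `exists` the tile stands past the last bit and reads as 0, but it must not pass for a
  -- bit tile. Hence `null` in the north, where `ou` would mark one.
  bitOut : Bool → Bool → Dir → Wire
  bitOut exists c N = if exists then ou c else null
  bitOut exists c E = null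
  bitOut exists c S = rd c
  bitOut exists c W = base

  sends : Site → Dir → Val → Wire
  sends j d v = sig j d v (strengthOf j d v)

  loadOut : Bool → ℕ → Col → ℕ → Dir → Val → Wire
  loadOut true x u r d v = bitOut (real x u r) (bitOf v) d
  loadOut false x u r E v = base
  loadOut false x u r d v = sends (load , x , u , r) d v

  out : Site → Dir → Val → Wire
  out (store , x , u , r) d v = if odd u then bitOut true (bitOf v) d else sends (store , x , u , r) d v
  out (load , x , u , r) d v = loadOut (odd u) x u r d v
  out (sums , x , u , r) S v = maybe′ (λ sum → ou (sum v)) (sends (sums , x , u , r) S v) (tap u)
  out j d v = sends j d v

  lab : Site → Val → ℕ
  lab (store , x , u , r) v = if odd u then bitLabel (bitOf v) else 2
  lab (load , x , u , r) v = if odd u ∧ real x u r then bitLabel (bitOf v) else 2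
  lab _ _ = 2

  isSeed : Site → Bool
  isSeed (tooth , _) = true
  isSeed (load , _) = true
  isSeed (spine , _) = true
  isSeed (store , x , u , r) = if odd u then false else true
  isSeed (column , x , u0 , zero) = true
  isSeed _ = false

  -- Upper sum bits appear one supercell further east than their position, so the lanes need half a
  -- supercell `w` at the fold, up to the column of that output.
  data Inside : ℕ → Col → Set where
    inside : ∀ {x u} → x < w → Inside x u
    edge : ∀ {u} → T (toℕ u <ᵇ 4) → Inside w u

  -- There is one tooth more than there are blocks, as the inputs of the last block hang from a
  -- tooth above it. The spine reaches that tooth with its single tile at `r ≡ w`.
  Ok : Site → Set
  Ok (tooth , x , u , r) = Inside x u × r ≤ w
  Ok (store , x , u , r) = Inside x u × r < w × T (toℕ u <ᵇ 4)
  Ok (sums , x , u , r) = Inside x u × r < w × T ((0 <ᵇ toℕ u) ∧ (toℕ u <ᵇ 4))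
  Ok (carries , x , u , r) = Inside x u × r < w
  Ok (spans , x , u , r) = Inside x u × r < w
  Ok (scan , x , u , r) = x < w × r < w
  Ok (load , x , u , r) = x < w × r < w
  Ok (column , x , u , r) = x ≡ 0 × r < w × T (toℕ u <ᵇ 7)
  Ok (spine , x , u , r) = x ≡ 0 × (r < w ⊎ r ≡ w × u ≡ u0) × T (toℕ u <ᵇ 7)

  inside? : ∀ x u → Dec (Inside x u)
  inside? x u with x <? w | x ≟ w | T? (toℕ u <ᵇ 4)
  ... | yes p | _ | _ = yes (inside p)
  ... | no _ | yes refl | yes p = yes (edge p)
  ... | no ¬p | no ¬q | _ = no λ { (inside p) → ¬p p ; (edge _) → ¬q refl }
  ... | no ¬p | yes refl | no ¬q = no λ { (inside p) → ¬p p ; (edge q) → ¬q q }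

  ok? : ∀ j → Dec (Ok j)
  ok? (tooth , x , u , r) = inside? x u ×-dec (r ≤? w)
  ok? (store , x , u , r) = inside? x u ×-dec ((r <? w) ×-dec T? (toℕ u <ᵇ 4))
  ok? (sums , x , u , r) = inside? x u ×-dec ((r <? w) ×-dec T? ((0 <ᵇ toℕ u) ∧ (toℕ u <ᵇ 4)))
  ok? (carries , x , u , r) = inside? x u ×-dec (r <? w)
  ok? (spans , x , u , r) = inside? x u ×-dec (r <? w)
  ok? (scan , x , u , r) = (x <? w) ×-dec (r <? w)
  ok? (load , x , u , r) = (x <? w) ×-dec (r <? w)
  ok? (column , x , u , r) = (x ≟ 0) ×-dec ((r <? w) ×-dec T? (toℕ u <ᵇ 7))
  ok? (spine , x , u , r) = (x ≟ 0) ×-dec (((r <? w) ⊎-dec ((r ≟ w) ×-dec (u Fin.≟ u0))) ×-dec T? (toℕ u <ᵇ 7))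

  universe : List Site
  universe = cartesianProduct (allFin 9) (cartesianProduct (upTo (suc w)) (cartesianProduct (allFin 8) (upTo (suc w))))

  sites : List Site
  sites = filter ok? universe

  sites-unique : Unique sites
  sites-unique = Unique.filter⁺ ok? (Unique.cartesianProduct⁺ (Unique.allFin⁺ 9)
    (Unique.cartesianProduct⁺ (Unique.upTo⁺ (suc w)) (Unique.cartesianProduct⁺ (Unique.allFin⁺ 8) (Unique.upTo⁺ (suc w)))))

  ∈-ok : ∀ {j} → j ∈ sites → Ok j
  ∈-ok i = proj₂ (∈-filter⁻ ok? {xs = universe} i)

  Inside-≤ : ∀ {x u} → Inside x u → x ≤ w
  Inside-≤ (inside p) = <⇒≤ p
  Inside-≤ (edge _) = ≤-refl

  ok-∈ : ∀ {j} → Ok j → j ∈ sites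
  ok-∈ {row , x , u , r} o = ∈-filter⁺ ok?
    (∈-cartesianProduct⁺ (∈-allFin row) (∈-cartesianProduct⁺ (∈-upTo⁺ (s≤s (proj₁ (bounds row o))))
      (∈-cartesianProduct⁺ (∈-allFin u) (∈-upTo⁺ (s≤s (proj₂ (bounds row o))))))) o
    where
      bounds : ∀ row → Ok (row , x , u , r) → x ≤ w × r ≤ w
      bounds tooth (i , p) = Inside-≤ i , p
      bounds store (i , p , _) = Inside-≤ i , <⇒≤ p
      bounds sums (i , p , _) = Inside-≤ i , <⇒≤ p
      bounds carries (i , p) = Inside-≤ i , <⇒≤ p
      bounds spans (i , p) = Inside-≤ i , <⇒≤ p
      bounds scan (i , p) = <⇒≤ i , <⇒≤ p
      bounds load (i , p) = <⇒≤ i , <⇒≤ p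
      bounds column (refl , p , _) = z≤n , <⇒≤ p
      bounds spine (refl , inj₁ p , _) = z≤n , <⇒≤ p
      bounds spine (refl , inj₂ (refl , _) , _) = z≤n , ≤-refl

  height : Row → Col
  height tooth = u0
  height store = u1
  height sums = u2
  height carries = u3
  height spans = u4
  height scan = u5
  height load = u6
  height column = u7
  height spine = u7

  -- A supercell has eight columns and a block seven rows. The rows begin one supercell further
  -- east, and the vertical column occupies the last place before them; the spine follows directly
  -- on the four columns of supercell `w`.
  coords : Site → ℕ × Col × ℕ × Col
  coords (column , x , u , r) = 0 , u7 , r , u
  coords (spine , x , u , r) = suc w , u4 , r , u
  coords (row , x , u , r) = suc x , u , r , height row

  abscissa ordinate : Site → ℕ
  abscissa j = let x , u , r , v = coords j in toℕ u + x * 8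
  ordinate j = let x , u , r , v = coords j in toℕ v + r * 7

  pos : Site → Pos
  pos j = nat (abscissa j) , nat (ordinate j)

  private
    atHeight : Col → Row
    atHeight u0 = tooth
    atHeight u1 = store
    atHeight u2 = sums
    atHeight u3 = carries
    atHeight u4 = spans
    atHeight u5 = scan
    atHeight u6 = load
    atHeight u7 = load

    is4 : Col → Bool
    is4 u4 = true
    is4 _ = false

    site : ℕ × Col × ℕ × Col → Site
    site (zero , u , r , v) = column , 0 , v , r
    site (suc x , u , r , v) = if is4 u ∧ (x ≡ᵇ w) then (spine , 0 , v , r) else (atHeight v , x , u , r)

    not-spine : ∀ {x u} → Inside x u → (is4 u ∧ (x ≡ᵇ w)) ≡ false
    not-spine {x} {u} (inside p) rewrite <⇒≢ᵇ p = ∧-false (is4 u)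
      where
        ∧-false : ∀ c → c ∧ false ≡ false
        ∧-false false = refl
        ∧-false true = refl
    not-spine {u = u0} (edge _) = refl
    not-spine {u = u1} (edge _) = refl
    not-spine {u = u2} (edge _) = refl
    not-spine {u = u3} (edge _) = refl

    site-coords : ∀ j → Ok j → site (coords j) ≡ j
    site-coords (tooth , x , u , r) (i , _) rewrite not-spine i = refl
    site-coords (store , x , u , r) (i , _) rewrite not-spine i = refl
    site-coords (sums , x , u , r) (i , _) rewrite not-spine i = refl
    site-coords (carries , x , u , r) (i , _) rewrite not-spine i = refl
    site-coords (spans , x , u , r) (i , _) rewrite not-spine i = refl
    site-coords (scan , x , u , r) (i , _) rewrite not-spine {u = u} (inside i) = refl
    site-coords (load , x , u , r) (i , _) rewrite not-spine {u = u} (inside i) = refl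
    site-coords (column , x , u , r) (refl , _) = refl
    site-coords (spine , x , u , r) (refl , _) rewrite n≡ᵇn w = refl

    height<7 : ∀ j → Ok j → toℕ (proj₂ (proj₂ (proj₂ (coords j)))) < 7
    height<7 (tooth , _) _ = <ᵇ⇒< 0 7 _
    height<7 (store , _) _ = <ᵇ⇒< 1 7 _
    height<7 (sums , _) _ = <ᵇ⇒< 2 7 _
    height<7 (carries , _) _ = <ᵇ⇒< 3 7 _
    height<7 (spans , _) _ = <ᵇ⇒< 4 7 _
    height<7 (scan , _) _ = <ᵇ⇒< 5 7 _
    height<7 (load , _) _ = <ᵇ⇒< 6 7 _
    height<7 (column , _ , u , _) (_ , _ , p) = <ᵇ⇒< (toℕ u) 7 p
    height<7 (spine , _ , u , _) (_ , _ , p) = <ᵇ⇒< (toℕ u) 7 p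

  pos-injective : ∀ {j k} → j ∈ sites → k ∈ sites → pos j ≡ pos k → j ≡ k
  pos-injective {j} {k} j∈ k∈ e = begin
    j                ≡⟨ site-coords j (∈-ok j∈) ⟨
    site (coords j)  ≡⟨ cong site same ⟩
    site (coords k)  ≡⟨ site-coords k (∈-ok k∈) ⟩
    k                ∎
    where
      open ≡-Reasoning
      natural : ℤ → ℕ
      natural (nat z) = z
      natural _ = 0
      merge : ∀ {x u r v x′ u′ r′ v′} → toℕ u ≡ toℕ u′ × x ≡ x′ → toℕ v ≡ toℕ v′ × r ≡ r′ →
        (x , u , r , v) ≡ (x′ , u′ , r′ , v′)
      merge {u = u} {v = v} {u′ = u′} {v′ = v′} (p , refl) (q , refl)
        with refl ← Fin.toℕ-injective {i = u} {u′} p | refl ← Fin.toℕ-injective {i = v} {v′} q = refl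
      same : coords j ≡ coords k
      same = merge
        (digits 8 (Fin.toℕ<n (proj₁ (proj₂ (coords j)))) (Fin.toℕ<n (proj₁ (proj₂ (coords k))))
          (cong (λ p → natural (proj₁ p)) e))
        (digits 7 (height<7 j (∈-ok j∈)) (height<7 k (∈-ok k∈)) (cong (λ p → natural (proj₂ p)) e))

  plan : Plan Input
  plan = record
    { pos = pos ; sites = sites ; sites-unique = sites-unique ; pos-injective = pos-injective
    ; msg = msg ; ins = ins ; out = out ; lab = lab ; isSeed = isSeed ; root = spine , 0 , u0 , 0 }

-- Arrival times

module Links (n w : ℕ) (0<w : 0 < w) where
  open Layout n w
  open Wiring plan

  -- The runs of propagating positions (for β, of propagating blocks) that a span, a carry and a
  -- block carry have to wait for.
  inwards : Input → ℕ → ℕ → ℕ → ℕ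
  inwards b r x zero = 0
  inwards b r x (suc m) = if isProp (q b (hi x r)) then suc (inwards b r (suc x) m) else 0

  ρ : Input → ℕ → ℕ → ℕ
  ρ b x r = inwards b r x (w ∸ x)

  μ : Input → ℕ → ℕ → ℕ
  μ b r zero = 0
  μ b r (suc x) = if isProp (q b (lo x r)) then suc (μ b r x) else 0

  β : Input → ℕ → ℕ
  β b zero = 0
  β b (suc r) = if isProp (span (q b) (lo 0 r) w) then suc (β b r) else 0

  ρ-prop : ∀ b {x r} → x < w → q b (hi x r) ≡ prop → ρ b x r ≡ suc (ρ b (suc x) r)
  ρ-prop b x<w e rewrite ∸-step x<w | e = refl

  μ-prop : ∀ b {x r} → q b (lo x r) ≡ prop → μ b r (suc x) ≡ suc (μ b r x)
  μ-prop b e rewrite e = refl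

  β-prop : ∀ b {r} → span (q b) (lo 0 r) w ≡ prop → β b (suc r) ≡ suc (β b r)
  β-prop b e rewrite e = refl

  within : ∀ {x u} v → Inside x u → T (toℕ v <ᵇ 4) → Inside x v
  within v (inside p) _ = inside p
  within v (edge _) q = edge q

  strictly : ∀ {x u} → Inside x u → T (3 <ᵇ toℕ u) → x < w
  strictly (inside p) _ = p
  strictly {u = u} (edge q) p = ⊥-elim (<⇒≱ (<ᵇ⇒< (toℕ u) 4 q) (<ᵇ⇒< 3 (toℕ u) p))

  next : ∀ {x} u → x < w → T (toℕ u <ᵇ 4) → Inside (suc x) u
  next u p q with m≤n⇒m<n∨m≡n p
  ... | inj₁ l = inside l
  ... | inj₂ refl = edge q

  atE : ∀ j k → abscissa k ≡ suc (abscissa j) → ordinate k ≡ ordinate j → pos k ≡ shift E (pos j)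
  atE j k e f = cong₂ _,_ (cong nat (trans e (sym (+-comm (abscissa j) 1)))) (cong nat f)

  atN : ∀ j k → abscissa k ≡ abscissa j → ordinate k ≡ suc (ordinate j) → pos k ≡ shift N (pos j)
  atN j k e f = cong₂ _,_ (cong nat e) (cong nat (trans f (sym (+-comm (ordinate j) 1))))

  atW : ∀ j k → suc (abscissa k) ≡ abscissa j → ordinate k ≡ ordinate j → pos k ≡ shift W (pos j)
  atW j k e f rewrite sym e | f = refl

  atS : ∀ j k → abscissa k ≡ abscissa j → suc (ordinate k) ≡ ordinate j → pos k ≡ shift S (pos j)
  atS j k e f rewrite e | sym f = refl

  Adjacent : Dir → Site → Site → Set
  Adjacent N j k = abscissa k ≡ abscissa j × ordinate k ≡ suc (ordinate j)
  Adjacent E j k = abscissa k ≡ suc (abscissa j) × ordinate k ≡ ordinate j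
  Adjacent S j k = abscissa k ≡ abscissa j × suc (ordinate k) ≡ ordinate j
  Adjacent W j k = suc (abscissa k) ≡ abscissa j × ordinate k ≡ ordinate j

  adjacent : ∀ d j k → Adjacent d j k → pos k ≡ shift d (pos j)
  adjacent N j k (e , f) = atN j k e f
  adjacent E j k (e , f) = atE j k e f
  adjacent S j k (e , f) = atS j k e f
  adjacent W j k (e , f) = atW j k e f

  -- It grows up the spine, westwards along a tooth and then off the tooth. An input tile gets 4
  -- against the 2 of the tile that holds it, because it lies one column further east, where `back`
  -- is smaller by 1.
  seedLev : Site → ℕ
  seedLev (tooth , x , u , r) = 1 + (back u + ((w ∸ x) * 8 + r * 7))
  seedLev (store , x , u , r) = 2 + (back u + ((w ∸ x) * 8 + r * 7))
  seedLev (load , x , u , r) = (if odd u then 4 else 2) + (back u + ((w ∸ x) * 8 + suc r * 7))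
  seedLev (column , x , u , r) = 2 + (7 + (w * 8 + 0))
  seedLev (spine , x , u , r) = toℕ u + r * 7
  seedLev _ = 0

  module Timing (b : Input) (ℓ Λ : ℕ) (ρ≤ : ∀ {x r} → x ≤ w → r < w → ρ b x r ≤ ℓ)
    (β≤ : ∀ {r} → r ≤ w → β b r ≤ Λ) where

    -- All spans have reached the column before α, all block carries have left it before δ.
    α δ : ℕ
    α = 18 + ℓ * 8
    δ = 7 + (Λ * 7 + α)

    -- Eight units per supercell and seven per block, the number of tiles from gate to gate on a
    -- lane and on the column. A gate that does not propagate sets the count back, so only runs
    -- enter. In the assembly the phases overlap; scheduling them one after the other costs a
    -- constant factor.
    time : Site → ℕ
    time (scan , x , u , r) = toℕ u
    time (spans , x , u , r) = back u + (9 + ρ b x r * 8)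
    time (column , x , u0 , r) = 3 + (β b r * 7 + α)
    time (column , x , u1 , r) = 4 + (β b r * 7 + α)
    time (column , x , u2 , r) = 5 + (β b r * 7 + α)
    time (column , x , u3 , r) = 6 + (β b r * 7 + α)
    time (column , x , u4 , r) = β b (suc r) * 7 + α
    time (column , x , u5 , r) = 1 + (β b (suc r) * 7 + α)
    time (column , x , u6 , r) = 2 + (β b (suc r) * 7 + α)
    time (carries , x , u7 , r) = μ b r (suc x) * 8 + δ
    time (carries , x , u , r) = toℕ u + (1 + (μ b r x * 8 + δ))
    time (sums , x , u , r) = toℕ u + (2 + (μ b r x * 8 + δ))
    time (store , x , u , r) = toℕ u + (3 + (μ b r x * 8 + δ))
    time _ = 0

    -- The circuit and the schedule need different facts about an input; gathered here, they all
    -- come from the one case analysis `links`.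
    record Link (j : Site) (d : Dir) (k : Site) : Set where
      constructor link
      field
        ok : Ok k
        located : pos k ≡ shift d (pos j)
        seedy : isSeed j ≡ true → isSeed k ≡ true × seedLev k < seedLev j
        timely : isSeed j ≡ false → isSeed k ≡ true ⊎ time k < time j

    private
      early : ∀ {x r} k m → k ≤ 17 → x ≤ w → r < w → k + ρ b x r * 8 < m + α
      early k m k≤ x≤ r< = ≤-trans (s≤s (+-mono-≤ k≤ (*-monoˡ-≤ 8 (ρ≤ x≤ r<)))) (m≤n+m α m)

      α≤δ : ∀ m → α ≤ m + δ
      α≤δ m = ≤-trans (m≤n+m α (Λ * 7)) (≤-trans (m≤n+m _ 7) (m≤n+m δ m))

      earlier : ∀ {x r} k m → k ≤ 17 → x ≤ w → r < w → k + ρ b x r * 8 < m + δ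
      earlier k m k≤ x≤ r< = ≤-trans (early k 0 k≤ x≤ r<) (α≤δ m)

      middle : ∀ {r} k m → k ≤ 6 → r ≤ w → k + (β b r * 7 + α) < m + δ
      middle k m k≤ r≤ = ≤-trans (s≤s (+-mono-≤ k≤ (+-monoˡ-≤ α (*-monoˡ-≤ 7 (β≤ r≤))))) (m≤n+m δ m)

      planted : ∀ {j d k} → isSeed j ≡ true → isSeed k ≡ true → Ok k → Adjacent d j k →
        seedLev k < seedLev j → Link j d k
      planted {j} {d} {k} s t o a l =
        link o (adjacent d j k a) (λ _ → t , l) (λ f → ⊥-elim (true≢false (trans (sym s) f)))
        where
          true≢false : true ≢ false
          true≢false ()

      grown : ∀ {j d k} → isSeed j ≡ false → Ok k → Adjacent d j k →
        isSeed k ≡ true ⊎ time k < time j → Link j d k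
      grown {j} {d} {k} s o a t = link o (adjacent d j k a) (λ f → ⊥-elim (false≢true (trans (sym s) f))) (λ _ → t)
        where
          false≢true : false ≢ true
          false≢true ()

    tooth-link : ∀ {x r} u → Inside x u → r ≤ w → Link (tooth , x , u , r) E (eastOf tooth u0 x u r)
    tooth-link {x} {r} u0 i p = planted refl refl (within u1 i _ , p) (refl , refl) ≤-refl
    tooth-link {x} {r} u1 i p = planted refl refl (within u2 i _ , p) (refl , refl) ≤-refl
    tooth-link {x} {r} u2 i p = planted refl refl (within u3 i _ , p) (refl , refl) ≤-refl
    tooth-link {x} {r} u3 (inside l) p rewrite <⇒≢ᵇ l =
      planted refl refl (inside l , p) (refl , refl) ≤-refl
    tooth-link {x} {r} u3 (edge l) p rewrite n≡ᵇn w =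
      planted refl refl (refl , end p , _) (refl , refl)
        (s≤s (≤-trans (m≤n+m (r * 7) ((w ∸ w) * 8)) (m≤n+m _ 4)))
      where
        end : r ≤ w → r < w ⊎ r ≡ w × u0 ≡ u0
        end p with m≤n⇒m<n∨m≡n p
        ... | inj₁ l = inj₁ l
        ... | inj₂ e = inj₂ (e , refl)
    tooth-link {x} {r} u4 i p = planted refl refl (inside (strictly i _) , p) (refl , refl) ≤-refl
    tooth-link {x} {r} u5 i p = planted refl refl (inside (strictly i _) , p) (refl , refl) ≤-refl
    tooth-link {x} {r} u6 i p = planted refl refl (inside (strictly i _) , p) (refl , refl) ≤-refl
    tooth-link {x} {r} u7 i p with l ← strictly i _ =
      planted refl refl (next u0 l _ , p) (refl , refl)
        (s≤s (≤-reflexive (sym (cong (λ z → z * 8 + r * 7) (∸-step l)))))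

    spans-link : ∀ {x r} u → T (toℕ u <ᵇ 7) → Inside x u → r < w → Link (spans , x , u , r) E (eastOf spans u4 x u r)
    spans-link {x} {r} u0 _ i p = grown refl (within u1 i _ , p) (refl , refl) (inj₂ ≤-refl)
    spans-link {x} {r} u1 _ i p = grown refl (within u2 i _ , p) (refl , refl) (inj₂ ≤-refl)
    spans-link {x} {r} u2 _ i p = grown refl (within u3 i _ , p) (refl , refl) (inj₂ ≤-refl)
    spans-link {x} {r} u3 _ (inside l) p rewrite <⇒≢ᵇ l =
      grown refl (inside l , p) (refl , refl) (inj₂ ≤-refl)
    spans-link {x} {r} u3 _ (edge l) p rewrite n≡ᵇn w =
      grown refl (refl , inj₁ p , _) (refl , refl) (inj₁ refl)
    spans-link {x} {r} u4 _ i p = grown refl (inside (strictly i _) , p) (refl , refl) (inj₂ ≤-refl)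
    spans-link {x} {r} u5 _ i p = grown refl (inside (strictly i _) , p) (refl , refl) (inj₂ ≤-refl)
    spans-link {x} {r} u6 _ i p = grown refl (inside (strictly i _) , p) (refl , refl) (inj₂ ≤-refl)

    links : ∀ {d k} j → Ok j → (d , k) ∈ inputs b j → Link j d k
    links (tooth , x , u , r) (i , p) first = tooth-link u i p
    links (store , x , u0 , r) (i , p , _) first =
      planted refl refl (i , <⇒≤ p) (refl , refl) ≤-refl
    links (store , x , u2 , r) (i , p , _) first =
      planted refl refl (i , <⇒≤ p) (refl , refl) ≤-refl
    links (store , x , u1 , r) (i , p , _) first =
      grown refl (i , p , _) (refl , refl) (inj₂ ≤-refl)
    links (store , x , u3 , r) (i , p , _) first =
      grown refl (i , p , _) (refl , refl) (inj₂ ≤-refl)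
    links (sums , x , u1 , r) (i , p , _) first =
      grown refl (i , p) (refl , refl) (inj₂ ≤-refl)
    links (sums , x , u2 , r) (i , p , _) first =
      grown refl (within u1 i _ , p , _) (refl , refl) (inj₂ ≤-refl)
    links (sums , x , u3 , r) (i , p , _) first =
      grown refl (within u2 i _ , p , _) (refl , refl) (inj₂ ≤-refl)
    links (carries , zero , u0 , r) (i , p) first =
      grown refl (refl , p , _) (refl , refl) (inj₂ (middle 6 1 ≤-refl (<⇒≤ p)))
    links (carries , suc x , u0 , r) (i , p) first =
      grown refl (inside (before i) , p) (refl , refl) (inj₂ ≤-refl)
      where
        before : ∀ {x u} → Inside (suc x) u → x < w
        before (inside l) = <-trans (n<1+n _) l
        before (edge _) = ≤-refl
    links (carries , x , u1 , r) (i , p) first =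
      grown refl (within u0 i _ , p) (refl , refl) (inj₂ ≤-refl)
    links (carries , x , u1 , r) (i , p) second =
      grown refl (i , p) (refl , refl)
        (inj₂ (≤-trans (earlier 15 0 (m≤m+n 15 2) (Inside-≤ i) p) (≤-trans (m≤n+m δ (μ b r x * 8)) (m≤n+m _ 2))))
    links (carries , x , u2 , r) (i , p) first =
      grown refl (within u1 i _ , p) (refl , refl) (inj₂ ≤-refl)
    links (carries , x , u3 , r) (i , p) first =
      grown refl (within u2 i _ , p) (refl , refl) (inj₂ ≤-refl)
    links (carries , x , u4 , r) (i , p) first =
      grown refl (within u3 i _ , p) (refl , refl) (inj₂ ≤-refl)
    links (carries , x , u5 , r) (i , p) first =
      grown refl (inside (strictly i _) , p) (refl , refl) (inj₂ ≤-refl)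
    links (carries , x , u6 , r) (i , p) first =
      grown refl (inside (strictly i _) , p) (refl , refl) (inj₂ ≤-refl)
    links (carries , x , u7 , r) (i , p) first =
      grown refl (i , p) (refl , refl)
        (inj₂ (≤-trans (earlier 9 0 (m≤m+n 9 8) (Inside-≤ i) p) (m≤n+m δ (μ b r (suc x) * 8))))
    links (carries , x , u7 , r) (i , p) (there m) with q b (lo x r) in e
    -- A propagating position adds 1 to `μ`, and the 8 units this gives are just what the carry
    -- needs from gate to gate.
    links (carries , x , u7 , r) (i , p) second | prop =
      grown refl (inside (strictly i _) , p) (refl , refl)
        (inj₂ (≤-reflexive (cong (λ z → z * 8 + δ) (sym (μ-prop b {x} {r} e)))))
    links (spans , x , u0 , r) (i , p) first = spans-link u0 _ i p
    links (spans , x , u1 , r) (i , p) first = spans-link u1 _ i p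
    links (spans , x , u2 , r) (i , p) first = spans-link u2 _ i p
    links (spans , x , u3 , r) (i , p) first = spans-link u3 _ i p
    links (spans , x , u4 , r) (i , p) first = spans-link u4 _ i p
    links (spans , x , u5 , r) (i , p) first = spans-link u5 _ i p
    links (spans , x , u6 , r) (i , p) first = spans-link u6 _ i p
    links j@(spans , x , u7 , r) (i , p) m = gate (strictly i _) m
      where
        gate : ∀ {d k} → x < w → (d , k) ∈ inputs b (spans , x , u7 , r) → Link j d k
        gate l m rewrite <⇒<ᵇ-true l = go m
          where
            go : ∀ {d k} → (d , k) ∈ (N , scan , x , u7 , r) ∷ ifProp (q b (hi x r)) (E , spans , suc x , u0 , r) →
              Link j d k
            go first = grown refl (l , p) (refl , refl) (inj₂ (≤-trans (m≤m+n 8 1) (m≤m+n 9 _)))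
            go (there m) with q b (hi x r) in e
            go second | prop =
              grown refl (next u0 l _ , p) (refl , refl)
                (inj₂ (≤-reflexive (cong (λ z → 9 + z * 8) (sym (ρ-prop b {x} {r} l e)))))
    links (scan , x , u0 , r) o first = grown refl o (refl , refl) (inj₁ refl)
    links (scan , x , u1 , r) o first = grown refl o (refl , refl) (inj₂ ≤-refl)
    links (scan , x , u2 , r) o first = grown refl o (refl , refl) (inj₂ ≤-refl)
    links (scan , x , u3 , r) o first = grown refl o (refl , refl) (inj₂ ≤-refl)
    links (scan , x , u4 , r) o first = grown refl o (refl , refl) (inj₂ ≤-refl)
    links (scan , x , u5 , r) o first = grown refl o (refl , refl) (inj₂ ≤-refl)
    links (scan , x , u6 , r) o first = grown refl o (refl , refl) (inj₂ ≤-refl)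
    links (scan , x , u7 , r) o first = grown refl o (refl , refl) (inj₂ ≤-refl)
    links (scan , x , u1 , r) o second = grown refl o (refl , refl) (inj₁ refl)
    links (scan , x , u3 , r) o second = grown refl o (refl , refl) (inj₁ refl)
    links (scan , x , u5 , r) o second = grown refl o (refl , refl) (inj₁ refl)
    links (scan , x , u7 , r) o second = grown refl o (refl , refl) (inj₁ refl)
    links (load , x , u0 , r) (l , p) first = planted refl refl (inside l , p) (refl , refl) ≤-refl
    links (load , x , u2 , r) (l , p) first = planted refl refl (inside l , p) (refl , refl) ≤-refl
    links (load , x , u4 , r) (l , p) first = planted refl refl (inside l , p) (refl , refl) ≤-refl
    links (load , x , u6 , r) (l , p) first = planted refl refl (inside l , p) (refl , refl) ≤-refl
    links (load , x , u1 , r) o first = planted refl refl o (refl , refl) ≤-refl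
    links (load , x , u3 , r) o first = planted refl refl o (refl , refl) ≤-refl
    links (load , x , u5 , r) o first = planted refl refl o (refl , refl) ≤-refl
    links (load , x , u7 , r) o first = planted refl refl o (refl , refl) ≤-refl
    links (column , x , u0 , zero) (_ , p , _) first =
      planted refl refl (inside 0<w , z≤n) (refl , refl) ≤-refl
    links (column , x , u0 , suc r) (_ , p , _) first =
      grown refl (refl , <-trans (n<1+n r) p , _) (refl , refl) (inj₂ ≤-refl)
    links (column , x , u1 , zero) (_ , p , _) first = grown refl (refl , p , _) (refl , refl) (inj₁ refl)
    links (column , x , u1 , suc r) (_ , p , _) first = grown refl (refl , p , _) (refl , refl) (inj₂ ≤-refl)
    links (column , x , u2 , r) (_ , p , _) first = grown refl (refl , p , _) (refl , refl) (inj₂ ≤-refl)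
    links (column , x , u3 , r) (_ , p , _) first = grown refl (refl , p , _) (refl , refl) (inj₂ ≤-refl)
    links (column , x , u4 , r) (_ , p , _) m = gate r p m
      where
        exit : ∀ r → r < w → Link (column , x , u4 , r) E (spans , 0 , u0 , r)
        exit r p = grown refl (inside 0<w , p) (refl , refl)
          (inj₂ (early 16 (β b (suc r) * 7) (m≤m+n 16 1) z≤n p))
        below : ∀ r → r < w → span (q b) (lo 0 r) w ≡ prop → Link (column , x , u4 , r) S (column , 0 , u3 , r)
        below r p e = grown refl (refl , p , _) (refl , refl)
          (inj₂ (≤-reflexive (cong (λ z → z * 7 + α) (sym (β-prop b {r} e)))))
        gate : ∀ {d k} r → r < w → (d , k) ∈ inputs b (column , x , u4 , r) → Link (column , x , u4 , r) d k
        gate r p first = exit r p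
        gate r p (there m) with span (q b) (lo 0 r) w in e
        gate r p second | prop = below r p e
    links (column , x , u5 , r) (_ , p , _) first = grown refl (refl , p , _) (refl , refl) (inj₂ ≤-refl)
    links (column , x , u6 , r) (_ , p , _) first = grown refl (refl , p , _) (refl , refl) (inj₂ ≤-refl)
    links (spine , x , u0 , suc r) (_ , p , _) first =
      planted refl refl (refl , inj₁ (below p) , _) (refl , refl) ≤-refl
      where
        below : ∀ {u} → suc r < w ⊎ suc r ≡ w × u ≡ u0 → r < w
        below (inj₁ l) = <-trans (n<1+n r) l
        below (inj₂ (e , _)) = ≤-reflexive e
    links (spine , x , u1 , r) (_ , inj₁ p , _) first = planted refl refl (refl , inj₁ p , _) (refl , refl) ≤-refl
    links (spine , x , u2 , r) (_ , inj₁ p , _) first = planted refl refl (refl , inj₁ p , _) (refl , refl) ≤-refl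
    links (spine , x , u3 , r) (_ , inj₁ p , _) first = planted refl refl (refl , inj₁ p , _) (refl , refl) ≤-refl
    links (spine , x , u4 , r) (_ , inj₁ p , _) first = planted refl refl (refl , inj₁ p , _) (refl , refl) ≤-refl
    links (spine , x , u5 , r) (_ , inj₁ p , _) first = planted refl refl (refl , inj₁ p , _) (refl , refl) ≤-refl
    links (spine , x , u6 , r) (_ , inj₁ p , _) first = planted refl refl (refl , inj₁ p , _) (refl , refl) ≤-refl

-- The layout is a circuit

module Laws (n w : ℕ) (0<w : 0 < w) where
  open Layout n w
  open Links n w 0<w
  open Wiring plan

  private
    2≤2 : 2 ≤ 2
    2≤2 = ≤-refl

  if-less : ∀ {x} {A : Set} {a b : A} → x < w → (if x <ᵇ w then a else b) ≡ a
  if-less l rewrite <⇒<ᵇ-true l = refl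

  spanVal-less : ∀ b x r → x < w →
    spanVal b x r ≡ ops (q b (lo x r)) (q b (hi x r)) (span (q b) (lo x r) (w ∸ x))
  spanVal-less b x r l = if-less l

  -- At the fold the span is empty, hence the constant that the spine shows.
  spanVal-edge : ∀ b r → spanVal b w r ≡ ops prop prop prop
  spanVal-edge b r rewrite n<ᵇn w = refl

  even-shape : ∀ b {x r} u → T (toℕ u <ᵇ 7) → Inside x u → Shape b (spans , x , u , r) ((E , eastOf spans u4 x u r) ∷ [])
  even-shape b u0 _ i = strong 2≤2
  even-shape b u1 _ i = strong 2≤2
  even-shape b u2 _ i = strong 2≤2
  even-shape b u3 _ (inside l) rewrite <⇒≢ᵇ l = strong 2≤2
  even-shape b u3 _ (edge _) rewrite n≡ᵇn w = strong 2≤2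
  even-shape b u4 _ i = strong 2≤2
  even-shape b u5 _ i = strong 2≤2
  even-shape b {x} {r} u6 _ i = strong (u7-west (spanVal b x r))
    where
      u7-west : ∀ v → 2 ≤ strengthOf (spans , x , u7 , r) W v
      u7-west v = 2≤2

  tooth-shape : ∀ b {x r} u → Inside x u → Shape b (tooth , x , u , r) ((E , eastOf tooth u0 x u r) ∷ [])
  tooth-shape b u0 i = strong 2≤2
  tooth-shape b u1 i = strong 2≤2
  tooth-shape b u2 i = strong 2≤2
  tooth-shape b u3 (inside l) rewrite <⇒≢ᵇ l = strong 2≤2
  tooth-shape b u3 (edge _) rewrite n≡ᵇn w = strong 2≤2
  tooth-shape b u4 i = strong 2≤2
  tooth-shape b u5 i = strong 2≤2
  tooth-shape b u6 i = strong 2≤2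
  tooth-shape b u7 i = strong 2≤2

  -- The strength chosen by the sender and the number of inputs expected by the receiver agree
  -- because both are read off the same operation `o`.
  gate-shape : ∀ b j o {d k e l} → d ≢ e → power (emitted b k (opp d)) ≡ weight o →
    power (emitted b l (opp e)) ≡ 1 → Shape b j ((d , k) ∷ ifProp o (e , l))
  gate-shape b j kill d≢e p _ = strong (≤-reflexive (sym p))
  gate-shape b j gen d≢e p _ = strong (≤-reflexive (sym p))
  gate-shape b j prop d≢e p p′ = weak d≢e p p′

  shapes : ∀ b j → Ok j → Shape b j (inputs b j)
  shapes b (tooth , x , u , r) (i , _) = tooth-shape b u i
  shapes b (store , x , u0 , r) _ = strong 2≤2
  shapes b (store , x , u1 , r) _ = strong 2≤2
  shapes b (store , x , u2 , r) _ = strong 2≤2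
  shapes b (store , x , u3 , r) _ = strong 2≤2
  shapes b (sums , x , u1 , r) _ = strong 2≤2
  shapes b (sums , x , u2 , r) _ = strong 2≤2
  shapes b (sums , x , u3 , r) _ = strong 2≤2
  shapes b (carries , zero , u0 , r) _ = strong 2≤2
  shapes b (carries , suc x , u0 , r) _ = strong 2≤2
  shapes b (carries , x , u1 , r) _ = weak (λ ()) refl refl
  shapes b (carries , x , u2 , r) _ = strong 2≤2
  shapes b (carries , x , u3 , r) _ = strong 2≤2
  shapes b (carries , x , u4 , r) _ = strong 2≤2
  shapes b (carries , x , u5 , r) _ = strong 2≤2
  shapes b (carries , x , u6 , r) _ = strong 2≤2
  shapes b j@(carries , x , u7 , r) (i , _) = gate-shape b j (q b (lo x r)) (λ ())
    (cong (strengthOf (spans , x , u7 , r) S) (spanVal-less b x r (strictly i _))) refl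
  shapes b (spans , x , u0 , r) (i , _) = even-shape b u0 _ i
  shapes b (spans , x , u1 , r) (i , _) = even-shape b u1 _ i
  shapes b (spans , x , u2 , r) (i , _) = even-shape b u2 _ i
  shapes b (spans , x , u3 , r) (i , _) = even-shape b u3 _ i
  shapes b (spans , x , u4 , r) (i , _) = even-shape b u4 _ i
  shapes b (spans , x , u5 , r) (i , _) = even-shape b u5 _ i
  shapes b (spans , x , u6 , r) (i , _) = even-shape b u6 _ i
  shapes b j@(spans , x , u7 , r) (i , _) =
    subst (λ v → Shape b j (ins j v)) (sym (spanVal-less b x r (strictly i _)))
      (gate-shape b j (q b (hi x r)) (λ ()) refl refl)
  shapes b (scan , x , u0 , r) _ = strong 2≤2
  shapes b (scan , x , u1 , r) _ = weak (λ ()) refl refl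
  shapes b (scan , x , u2 , r) _ = strong 2≤2
  shapes b (scan , x , u3 , r) _ = weak (λ ()) refl refl
  shapes b (scan , x , u4 , r) _ = strong 2≤2
  shapes b (scan , x , u5 , r) _ = weak (λ ()) refl refl
  shapes b (scan , x , u6 , r) _ = strong 2≤2
  shapes b (scan , x , u7 , r) _ = weak (λ ()) refl refl
  shapes b (load , x , u0 , r) _ = strong 2≤2
  shapes b (load , x , u1 , r) _ = strong 2≤2
  shapes b (load , x , u2 , r) _ = strong 2≤2
  shapes b (load , x , u3 , r) _ = strong 2≤2
  shapes b (load , x , u4 , r) _ = strong 2≤2
  shapes b (load , x , u5 , r) _ = strong 2≤2
  shapes b (load , x , u6 , r) _ = strong 2≤2
  shapes b (load , x , u7 , r) _ = strong 2≤2
  shapes b (column , x , u0 , zero) _ = strong 2≤2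
  shapes b (column , x , u0 , suc r) _ = strong 2≤2
  shapes b (column , x , u1 , r) _ = strong 2≤2
  shapes b (column , x , u2 , r) _ = strong 2≤2
  shapes b (column , x , u3 , r) _ = strong 2≤2
  shapes b j@(column , x , u4 , r) _ = gate-shape b j (span (q b) (lo 0 r) w) (λ ())
    (cong (strengthOf (spans , 0 , u0 , r) W) (spanVal-less b 0 r 0<w)) refl
  shapes b (column , x , u5 , r) _ = strong 2≤2
  shapes b (column , x , u6 , r) _ = strong 2≤2
  shapes b (spine , x , u0 , zero) (refl , _) = rooted refl
  shapes b (spine , x , u0 , suc r) _ = strong 2≤2
  shapes b (spine , x , u1 , r) _ = strong 2≤2
  shapes b (spine , x , u2 , r) _ = strong 2≤2
  shapes b (spine , x , u3 , r) _ = strong 2≤2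
  shapes b (spine , x , u4 , r) _ = strong 2≤2
  shapes b (spine , x , u5 , r) _ = strong 2≤2
  shapes b (spine , x , u6 , r) _ = strong 2≤2

  load-emits : ∀ b {x r} u d → x < w → r < w → odd u ≡ true → source d (inputs b (load , x , u , r)) ≡ nothing →
    Emits b (load , x , u , r) d (emitted b (load , x , u , r) d)
  load-emits b {x} {r} u N x< r< o _ = guarded (tooth , x , u , suc r) (ok-∈ (inside x< , r<)) refl
    (atN (load , x , u , r) (tooth , x , u , suc r) refl refl)
  load-emits b u E x< r< o _ rewrite o = silent
  load-emits b u S x< r< o _ rewrite o = reads refl
  load-emits b u W x< r< o e rewrite o with () ← e

  bump-emits : ∀ b {x r} u v d → x < w → r < w → odd u ≡ false → toℕ v ≡ suc (toℕ u) →
    Emits b (load , x , u , r) d (emitted b (load , x , u , r) d)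
  bump-emits b {x} {r} u v E x< r< o e = guarded (load , x , v , r) (ok-∈ (x< , r<)) refl
    (atE (load , x , u , r) (load , x , v , r) (cong (_+ suc x * 8) e) refl)
  bump-emits b u v N x< r< o e rewrite o = signal
  bump-emits b u v S x< r< o e rewrite o = signal
  bump-emits b u v W x< r< o e rewrite o = signal

  -- The layout takes care of the anonymous glues. An input tile has a tooth above it; an output
  -- tile has a tooth below it and a seed tile to the west. The glue `base` that holds an input tile
  -- faces only that tile.
  emission : ∀ b j d → Ok j → source d (inputs b j) ≡ nothing → Emits b j d (emitted b j d)
  emission b (tooth , x , u , r) d _ _ = signal
  emission b (store , x , u0 , r) d _ _ = signal
  emission b (store , x , u2 , r) d _ _ = signal
  emission b (store , x , u1 , r) N _ ()
  emission b (store , x , u1 , r) E _ _ = silent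
  emission b j@(store , x , u1 , r) S (i , p , _) _ =
    guarded (tooth , x , u1 , r) (ok-∈ (i , <⇒≤ p)) refl (atS j (tooth , x , u1 , r) refl refl)
  emission b j@(store , x , u1 , r) W (i , p , _) _ =
    guarded (store , x , u0 , r) (ok-∈ (within u0 i _ , p , _)) refl (atW j (store , x , u0 , r) refl refl)
  emission b (store , x , u3 , r) N _ ()
  emission b (store , x , u3 , r) E _ _ = silent
  emission b j@(store , x , u3 , r) S (i , p , _) _ =
    guarded (tooth , x , u3 , r) (ok-∈ (i , <⇒≤ p)) refl (atS j (tooth , x , u3 , r) refl refl)
  emission b j@(store , x , u3 , r) W (i , p , _) _ =
    guarded (store , x , u2 , r) (ok-∈ (within u2 i _ , p , _)) refl (atW j (store , x , u2 , r) refl refl)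
  emission b (sums , x , u , r) N _ _ = signal
  emission b (sums , x , u , r) E _ _ = signal
  emission b (sums , x , u , r) W _ _ = signal
  emission b (sums , x , u2 , r) S _ _ = signal
  emission b j@(sums , x , u1 , r) S (i , p , _) _ =
    writes (store , x , u1 , r) refl (ok-∈ (i , p , _)) (atS j (store , x , u1 , r) refl refl)
      refl refl
  emission b j@(sums , x , u3 , r) S (i , p , _) _ =
    writes (store , x , u3 , r) refl (ok-∈ (i , p , _)) (atS j (store , x , u3 , r) refl refl)
      refl refl
  emission b (carries , x , u , r) d _ _ = signal
  emission b (spans , x , u , r) d _ _ = signal
  emission b (scan , x , u , r) d _ _ = signal
  emission b (load , x , u0 , r) d (l , p) _ = bump-emits b u0 u1 d l p refl refl
  emission b (load , x , u2 , r) d (l , p) _ = bump-emits b u2 u3 d l p refl refl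
  emission b (load , x , u4 , r) d (l , p) _ = bump-emits b u4 u5 d l p refl refl
  emission b (load , x , u6 , r) d (l , p) _ = bump-emits b u6 u7 d l p refl refl
  emission b (load , x , u1 , r) d (l , p) e = load-emits b u1 d l p refl e
  emission b (load , x , u3 , r) d (l , p) e = load-emits b u3 d l p refl e
  emission b (load , x , u5 , r) d (l , p) e = load-emits b u5 d l p refl e
  emission b (load , x , u7 , r) d (l , p) e = load-emits b u7 d l p refl e
  emission b (column , x , u , r) d _ _ = signal
  emission b (spine , x , u , r) d _ _ = signal

  sends-sig : ∀ {i d v j e m s} → sends i d v ≡ sig j e m s → i ≡ j × d ≡ e
  sends-sig refl = refl , refl

  bitOut≢sig : ∀ c c′ d {j e m s} → bitOut c c′ d ≢ sig j e m s
  bitOut≢sig false c′ N ()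
  bitOut≢sig true c′ N ()
  bitOut≢sig c c′ E ()
  bitOut≢sig c c′ S ()
  bitOut≢sig c c′ W ()

  bitOut≢rd : ∀ c c′ {c″} → bitOut c c′ N ≢ rd c″
  bitOut≢rd false c′ ()
  bitOut≢rd true c′ ()

  out-sig : ∀ i d v {j e m s} → out i d v ≡ sig j e m s → i ≡ j × d ≡ e
  out-sig (tooth , _) d v e = sends-sig e
  out-sig (store , x , u , r) d v e with odd u
  ... | true = ⊥-elim (bitOut≢sig true (bitOf v) d e)
  ... | false = sends-sig e
  out-sig (sums , x , u , r) N v e = sends-sig e
  out-sig (sums , x , u , r) E v e = sends-sig e
  out-sig (sums , x , u , r) S v e with tap u
  out-sig (sums , x , u , r) S v () | just _
  ... | nothing = sends-sig e
  out-sig (sums , x , u , r) W v e = sends-sig e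
  out-sig (carries , _) d v e = sends-sig e
  out-sig (spans , _) d v e = sends-sig e
  out-sig (scan , _) d v e = sends-sig e
  out-sig (load , x , u , r) d v e with odd u
  out-sig (load , x , u , r) d v e | true = ⊥-elim (bitOut≢sig (real x u r) (bitOf v) d e)
  out-sig (load , x , u , r) N v e | false = sends-sig e
  out-sig (load , x , u , r) E v () | false
  out-sig (load , x , u , r) S v e | false = sends-sig e
  out-sig (load , x , u , r) W v e | false = sends-sig e
  out-sig (column , _) d v e = sends-sig e
  out-sig (spine , _) d v e = sends-sig e

  out-north : ∀ i v {c} → out i N v ≢ rd c
  out-north (tooth , _) v ()
  out-north (store , x , u , r) v e with odd u
  ... | true = bitOut≢rd true (bitOf v) e
  out-north (sums , _) v ()
  out-north (carries , _) v ()
  out-north (spans , _) v ()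
  out-north (scan , _) v ()
  out-north (load , x , u , r) v e with odd u
  ... | true = bitOut≢rd (real x u r) (bitOf v) e
  out-north (column , _) v ()
  out-north (spine , _) v ()

  ou-tile : ∀ b i {c} → Ok i → side b i N ≡ ou c → tileAt b i ≡ bitTileOf c
  ou-tile b (tooth , x , u , r) _ ()
  ou-tile b (store , x , u0 , r) _ ()
  ou-tile b (store , x , u1 , r) _ refl = refl
  ou-tile b (store , x , u2 , r) _ ()
  ou-tile b (store , x , u3 , r) _ refl = refl
  ou-tile b (sums , x , u1 , r) _ ()
  ou-tile b (sums , x , u2 , r) _ ()
  ou-tile b (sums , x , u3 , r) _ ()
  ou-tile b (carries , x , u0 , r) _ ()
  ou-tile b (carries , x , u1 , r) _ ()
  ou-tile b (carries , x , u2 , r) _ ()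
  ou-tile b (carries , x , u3 , r) _ ()
  ou-tile b (carries , x , u4 , r) _ ()
  ou-tile b (carries , x , u5 , r) _ ()
  ou-tile b (carries , x , u6 , r) _ ()
  ou-tile b (carries , x , u7 , r) _ ()
  ou-tile b (spans , x , u0 , r) _ ()
  ou-tile b (spans , x , u1 , r) _ ()
  ou-tile b (spans , x , u2 , r) _ ()
  ou-tile b (spans , x , u3 , r) _ ()
  ou-tile b (spans , x , u4 , r) _ ()
  ou-tile b (spans , x , u5 , r) _ ()
  ou-tile b (spans , x , u6 , r) _ ()
  ou-tile b (spans , x , u7 , r) (i , _) e = ⊥-elim (absurd (strictly i _) e)
    where
      absurd : ∀ {c} → x < w → side b (spans , x , u7 , r) N ≢ ou c
      absurd l e rewrite <⇒<ᵇ-true l with () ← e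
  ou-tile b (scan , x , u0 , r) _ ()
  ou-tile b (scan , x , u1 , r) _ ()
  ou-tile b (scan , x , u2 , r) _ ()
  ou-tile b (scan , x , u3 , r) _ ()
  ou-tile b (scan , x , u4 , r) _ ()
  ou-tile b (scan , x , u5 , r) _ ()
  ou-tile b (scan , x , u6 , r) _ ()
  ou-tile b (scan , x , u7 , r) _ ()
  ou-tile b (load , x , u0 , r) _ ()
  ou-tile b (load , x , u2 , r) _ ()
  ou-tile b (load , x , u4 , r) _ ()
  ou-tile b (load , x , u6 , r) _ ()
  ou-tile b (load , x , u1 , r) _ e with real x u1 r
  ou-tile b (load , x , u1 , r) _ refl | true = refl
  ou-tile b (load , x , u1 , r) _ () | false
  ou-tile b (load , x , u3 , r) _ e with real x u3 r
  ou-tile b (load , x , u3 , r) _ refl | true = refl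
  ou-tile b (load , x , u3 , r) _ () | false
  ou-tile b (load , x , u5 , r) _ e with real x u5 r
  ou-tile b (load , x , u5 , r) _ refl | true = refl
  ou-tile b (load , x , u5 , r) _ () | false
  ou-tile b (load , x , u7 , r) _ e with real x u7 r
  ou-tile b (load , x , u7 , r) _ refl | true = refl
  ou-tile b (load , x , u7 , r) _ () | false
  ou-tile b (column , x , u0 , zero) _ ()
  ou-tile b (column , x , u0 , suc r) _ ()
  ou-tile b (column , x , u1 , r) _ ()
  ou-tile b (column , x , u2 , r) _ ()
  ou-tile b (column , x , u3 , r) _ ()
  ou-tile b (column , x , u4 , r) _ e with span (q b) (lo 0 r) w
  ou-tile b (column , x , u4 , r) _ () | kill
  ou-tile b (column , x , u4 , r) _ () | gen
  ou-tile b (column , x , u4 , r) _ () | prop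
  ou-tile b (column , x , u5 , r) _ ()
  ou-tile b (column , x , u6 , r) _ ()
  ou-tile b (column , x , u7 , r) _ ()
  ou-tile b (spine , x , u0 , zero) _ ()
  ou-tile b (spine , x , u0 , suc r) _ ()
  ou-tile b (spine , x , u1 , r) _ ()
  ou-tile b (spine , x , u2 , r) _ ()
  ou-tile b (spine , x , u3 , r) _ ()
  ou-tile b (spine , x , u4 , r) _ ()
  ou-tile b (spine , x , u5 , r) _ ()
  ou-tile b (spine , x , u6 , r) _ ()
  ou-tile b (spine , x , u7 , r) _ ()

  carryOf : Val → Bool
  carryOf (car c _ _) = c
  carryOf (fin c _ _) = c
  carryOf _ = false

  spanOf : Val → Op
  spanOf (ops _ _ s) = s
  spanOf _ = prop

  private
    sig-msg : ∀ {j d v s j′ d′ v′ s′} → sig j d v s ≡ sig j′ d′ v′ s′ → v ≡ v′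
    sig-msg refl = refl

    ou-bit : ∀ {c c′} → ou c ≡ ou c′ → c ≡ c′
    ou-bit refl = refl

    rd-bit : ∀ {c c′} → rd c ≡ rd c′ → c ≡ c′
    rd-bit refl = refl

    bits-list : ∀ {l m} → bits l ≡ bits m → l ≡ m
    bits-list refl = refl

    ops-parts : ∀ {a b c a′ b′ c′} → ops a b c ≡ ops a′ b′ c′ → a ≡ a′ × b ≡ b′ × c ≡ c′
    ops-parts refl = refl , refl , refl

    after-cong : ∀ p {o o′} → (p ≡ prop → o ≡ o′) → p after o ≡ p after o′
    after-cong kill _ = refl
    after-cong gen _ = refl
    after-cong prop h = h refl

    apply-cong : ∀ p {c c′} → (p ≡ prop → c ≡ c′) → apply p c ≡ apply p c′
    apply-cong kill _ = refl
    apply-cong gen _ = refl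
    apply-cong prop h = h refl

    ifProp-∈ : ∀ {o y} → o ≡ prop → y ∈ ifProp o y
    ifProp-∈ refl = here refl

  localCarry-car : ∀ b x r → ∃ λ h → ∃ λ s → localCarry b x r ≡ car (carry (q b) (lo x r)) h s
  localCarry-car b zero zero = _ , _ , refl
  localCarry-car b zero (suc r) = _ , _ , refl
  localCarry-car b (suc x) r = _ , _ , refl

  blockCarry-carry : ∀ b r → carryOf (blockCarry b r) ≡ carry (q b) (lo 0 r)
  blockCarry-carry b r with _ , _ , e ← localCarry-car b zero r = cong carryOf e

  sumVal-carry : ∀ b x r → x < w → carryOf (sumVal b x r) ≡ carry (q b) (lo x r)
  sumVal-carry b x r l with _ , _ , e ← localCarry-car b x r
    rewrite e | spanVal-less b x r l = refl

  spanVal-span : ∀ b x r → x ≤ w → spanOf (spanVal b x r) ≡ span (q b) (lo x r) (w ∸ x)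
  spanVal-span b x r l with m≤n⇒m<n∨m≡n l
  ... | inj₁ p = cong spanOf (spanVal-less b x r p)
  ... | inj₂ refl = trans (cong spanOf (spanVal-edge b r)) (cong (span (q b) (lo w r)) (sym (n∸n≡0 w)))

  span-unfold : ∀ b x r → x < w → span (q b) (lo x r) (w ∸ x) ≡
    q b (hi x r) after (span (q b) (lo (suc x) r) (w ∸ suc x) after q b (lo x r))
  span-unfold b x r l rewrite ∸-step l = refl

  -- If the upper position kills or generates, the span is its operation whatever lies inside. So
  -- the inner span has to agree only where it is an input.
  spanVal-determined : ∀ b b′ x r → x < w → q b′ (lo x r) ≡ q b (lo x r) → q b′ (hi x r) ≡ q b (hi x r) →
    (q b′ (hi x r) ≡ prop → spanVal b′ (suc x) r ≡ spanVal b (suc x) r) →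
    spanVal b′ x r ≡ spanVal b x r
  spanVal-determined b b′ x r l lo≡ hi≡ inner = begin
    spanVal b′ x r
      ≡⟨ spanVal-less b′ x r l ⟩
    ops (q b′ (lo x r)) (q b′ (hi x r)) (span (q b′) (lo x r) (w ∸ x))
      ≡⟨ cong (ops _ _) span≡ ⟩
    ops (q b′ (lo x r)) (q b′ (hi x r)) (span (q b) (lo x r) (w ∸ x))
      ≡⟨ cong₂ (λ y z → ops y z (span (q b) (lo x r) (w ∸ x))) lo≡ hi≡ ⟩
    ops (q b (lo x r)) (q b (hi x r)) (span (q b) (lo x r) (w ∸ x))
      ≡⟨ spanVal-less b x r l ⟨
    spanVal b x r ∎
    where
      open ≡-Reasoning
      span≡ : span (q b′) (lo x r) (w ∸ x) ≡ span (q b) (lo x r) (w ∸ x)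
      span≡ = begin
        span (q b′) (lo x r) (w ∸ x)
          ≡⟨ span-unfold b′ x r l ⟩
        q b′ (hi x r) after (span (q b′) (lo (suc x) r) (w ∸ suc x) after q b′ (lo x r))
          ≡⟨ after-cong (q b′ (hi x r)) (λ p → cong₂ _after_
               (trans (sym (spanVal-span b′ (suc x) r l)) (trans (cong spanOf (inner p)) (spanVal-span b (suc x) r l))) lo≡) ⟩
        q b′ (hi x r) after (span (q b) (lo (suc x) r) (w ∸ suc x) after q b (lo x r))
          ≡⟨ cong (_after _) hi≡ ⟩
        q b (hi x r) after (span (q b) (lo (suc x) r) (w ∸ suc x) after q b (lo x r))
          ≡⟨ span-unfold b x r l ⟨
        span (q b) (lo x r) (w ∸ x) ∎

  localCarry-determined : ∀ b b′ x r → x < w → spanVal b′ x r ≡ spanVal b x r →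
    (q b′ (lo x r) ≡ prop → sumVal b′ x r ≡ sumVal b x r) →
    localCarry b′ (suc x) r ≡ localCarry b (suc x) r
  localCarry-determined b b′ x r l span≡ inner
    with lo≡ , hi≡ , _ ← ops-parts (trans (sym (spanVal-less b′ x r l)) (trans span≡ (spanVal-less b x r l))) =
    trans (cong (λ c → car c (q b′ (hi x r)) (q b′ (lo x r))) carry≡)
      (cong₂ (car _) hi≡ lo≡)
    where
      carry≡ : apply (q b′ (lo x r)) (carry (q b′) (lo x r)) ≡ apply (q b (lo x r)) (carry (q b) (lo x r))
      carry≡ = trans
        (apply-cong (q b′ (lo x r)) λ p →
          trans (sym (sumVal-carry b′ x r l)) (trans (cong carryOf (inner p)) (sumVal-carry b x r l)))
        (cong (λ o → apply o (carry (q b) (lo x r))) lo≡)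

  -- By `span-carry` the carry out of a block is its span applied to the carry into it; a span that
  -- does not propagate determines it alone.
  blockCarry-determined : ∀ b b′ r → spanVal b′ 0 r ≡ spanVal b 0 r →
    (span (q b′) (lo 0 r) w ≡ prop → blockCarry b′ r ≡ blockCarry b r) →
    blockCarry b′ (suc r) ≡ blockCarry b (suc r)
  blockCarry-determined b b′ r s≡ inner = trans
    (cong (λ c → car c prop (span (q b′) (lo 0 r) w)) carry≡)
    (cong (car _ prop) span≡)
    where
      span≡ : span (q b′) (lo 0 r) w ≡ span (q b) (lo 0 r) w
      span≡ = trans (sym (spanVal-span b′ 0 r z≤n)) (trans (cong spanOf s≡) (spanVal-span b 0 r z≤n))
      carry≡ : carry (q b′) (lo 0 (suc r)) ≡ carry (q b) (lo 0 (suc r))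
      carry≡ = begin
        carry (q b′) (lo 0 (suc r))
          ≡⟨ span-carry (q b′) w (lo 0 r) ⟨
        apply (span (q b′) (lo 0 r) w) (carry (q b′) (lo 0 r))
          ≡⟨ apply-cong (span (q b′) (lo 0 r) w) (λ p →
               trans (sym (blockCarry-carry b′ r)) (trans (cong carryOf (inner p)) (blockCarry-carry b r))) ⟩
        apply (span (q b′) (lo 0 r) w) (carry (q b) (lo 0 r))
          ≡⟨ cong (λ o → apply o (carry (q b) (lo 0 r))) span≡ ⟩
        apply (span (q b) (lo 0 r) w) (carry (q b) (lo 0 r))
          ≡⟨ span-carry (q b) w (lo 0 r) ⟩
        carry (q b) (lo 0 (suc r)) ∎
        where open ≡-Reasoning

  Agree : Input → Input → Site → Set
  Agree b b′ j = ∀ {d k} → (d , k) ∈ inputs b′ j → emitted b′ k (opp d) ≡ emitted b k (opp d)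

  determined : ∀ b b′ j → Ok j → isSeed j ≡ false → Agree b b′ j → msg b′ j ≡ msg b j
  determined b b′ (tooth , _) _ () _
  determined b b′ (store , x , u0 , r) _ () _
  determined b b′ (store , x , u1 , r) _ _ h = cong (λ c → bits (c ∷ [])) (ou-bit (h first))
  determined b b′ (store , x , u2 , r) _ () _
  determined b b′ (store , x , u3 , r) _ _ h = cong (λ c → bits (c ∷ [])) (ou-bit (h first))
  determined b b′ (sums , x , u1 , r) _ _ h = sig-msg (h first)
  determined b b′ (sums , x , u2 , r) _ _ h = sig-msg (h first)
  determined b b′ (sums , x , u3 , r) _ _ h = sig-msg (h first)
  determined b b′ (carries , zero , u0 , r) _ _ h = sig-msg (h first)
  determined b b′ (carries , suc x , u0 , r) _ _ h = sig-msg (h first)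
  determined b b′ (carries , x , u1 , r) _ _ h =
    cong₂ combine (sig-msg (h first)) (sig-msg (h second))
  determined b b′ (carries , x , u2 , r) _ _ h = sig-msg (h first)
  determined b b′ (carries , x , u3 , r) _ _ h = sig-msg (h first)
  determined b b′ (carries , x , u4 , r) _ _ h = sig-msg (h first)
  determined b b′ (carries , x , u5 , r) _ _ h = sig-msg (h first)
  determined b b′ (carries , x , u6 , r) _ _ h = sig-msg (h first)
  determined b b′ (carries , x , u7 , r) (i , _) _ h =
    localCarry-determined b b′ x r (strictly i _) (sig-msg (h first))
      λ p → sig-msg (h (there (ifProp-∈ p)))
  determined b b′ (spans , x , u0 , r) _ _ h = sig-msg (h first)
  determined b b′ (spans , x , u1 , r) _ _ h = sig-msg (h first)
  determined b b′ (spans , x , u2 , r) _ _ h = sig-msg (h first)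
  determined b b′ (spans , x , u3 , r) (edge _ , _) _ _ = trans (spanVal-edge b′ r) (sym (spanVal-edge b r))
  determined b b′ (spans , x , u3 , r) (inside l , _) _ h = sig-msg (h (here (cong (E ,_) (sym (if-inside l)))))
    where
      if-inside : x < w → eastOf spans u4 x u3 r ≡ (spans , x , u4 , r)
      if-inside l rewrite <⇒≢ᵇ l = refl
  determined b b′ (spans , x , u4 , r) _ _ h = sig-msg (h first)
  determined b b′ (spans , x , u5 , r) _ _ h = sig-msg (h first)
  determined b b′ (spans , x , u6 , r) _ _ h = sig-msg (h first)
  determined b b′ j@(spans , x , u7 , r) (i , _) _ h = gate (strictly i _)
    where
      input : ∀ {y} → x < w → y ∈ (N , scan , x , u7 , r) ∷ ifProp (q b′ (hi x r)) (E , spans , suc x , u0 , r) →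
        y ∈ inputs b′ j
      input l m = subst (λ v → _ ∈ ins j v) (sym (spanVal-less b′ x r l)) m
      gate : x < w → spanVal b′ x r ≡ spanVal b x r
      gate l
        with d , e ← ∷-injective (bits-list (sig-msg (h (input l first))))
        with c , e ← ∷-injective e with a₂ , e ← ∷-injective e with a₁ , _ ← ∷-injective e =
        spanVal-determined b b′ x r l (cong₂ opOf a₁ a₂) (cong₂ opOf c d)
          λ p → sig-msg (h (input l (there (ifProp-∈ p))))
  determined b b′ (scan , x , u0 , r) _ _ h = refl
  determined b b′ (scan , x , u1 , r) _ _ h =
    cong₂ (λ c l → bits (c ∷ l)) (rd-bit (h second)) (bits-list (sig-msg (h first)))
  determined b b′ (scan , x , u2 , r) _ _ h = sig-msg (h first)
  determined b b′ (scan , x , u3 , r) _ _ h =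
    cong₂ (λ c l → bits (c ∷ l)) (rd-bit (h second)) (bits-list (sig-msg (h first)))
  determined b b′ (scan , x , u4 , r) _ _ h = sig-msg (h first)
  determined b b′ (scan , x , u5 , r) _ _ h =
    cong₂ (λ c l → bits (c ∷ l)) (rd-bit (h second)) (bits-list (sig-msg (h first)))
  determined b b′ (scan , x , u6 , r) _ _ h = sig-msg (h first)
  determined b b′ (scan , x , u7 , r) _ _ h =
    cong₂ (λ c l → bits (c ∷ l)) (rd-bit (h second)) (bits-list (sig-msg (h first)))
  determined b b′ (load , _) _ () _
  determined b b′ (column , x , u0 , zero) _ () _
  determined b b′ (column , x , u0 , suc r) _ _ h = sig-msg (h first)
  determined b b′ (column , x , u1 , r) _ _ h = sig-msg (h first)
  determined b b′ (column , x , u2 , r) _ _ h = sig-msg (h first)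
  determined b b′ (column , x , u3 , r) _ _ h = sig-msg (h first)
  determined b b′ (column , x , u4 , r) _ _ h =
    blockCarry-determined b b′ r (sig-msg (h first)) λ p → sig-msg (h (there (ifProp-∈ p)))
  determined b b′ (column , x , u5 , r) _ _ h = sig-msg (h first)
  determined b b′ (column , x , u6 , r) _ _ h = sig-msg (h first)
  determined b b′ (spine , _) _ () _

  -- Worst-case bounds on the waiting, and levels

  inwards≤ : ∀ b r x m → inwards b r x m ≤ m
  inwards≤ b r x zero = z≤n
  inwards≤ b r x (suc m) with isProp (q b (hi x r))
  ... | true = s≤s (inwards≤ b r (suc x) m)
  ... | false = z≤n

  ρ≤w : ∀ b {x r} → ρ b x r ≤ w
  ρ≤w b {x} {r} = ≤-trans (inwards≤ b r x (w ∸ x)) (m∸n≤m w x)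

  μ≤x : ∀ b r x → μ b r x ≤ x
  μ≤x b r zero = z≤n
  μ≤x b r (suc x) with isProp (q b (lo x r))
  ... | true = s≤s (μ≤x b r x)
  ... | false = z≤n

  β≤r : ∀ b r → β b r ≤ r
  β≤r b zero = z≤n
  β≤r b (suc r) with isProp (span (q b) (lo 0 r) w)
  ... | true = s≤s (β≤r b r)
  ... | false = z≤n

  module Widest (b : Input) = Timing b w w (λ {x} {r} _ _ → ρ≤w b {x} {r}) (λ {r} r≤w → ≤-trans (β≤r b r) r≤w)

  base-level : ℕ
  base-level = suc (sum (map seedLev sites))

  -- Tiles outside the seed are ranked by their arrival in the worst-case schedule, above all seed
  -- tiles. Thus the schedule also proves that the inputs are not circular.
  level : Input → Site → ℕ
  level b j = if isSeed j then seedLev j else base-level + Widest.time b j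

  input-level : ∀ b {j d k} → j ∈ sites → (d , k) ∈ inputs b j → level b k < level b j
  input-level b {j} {d} {k} j∈ u = compare (isSeed j) refl (isSeed k) refl
    where
      open Widest b
      L = links j (∈-ok j∈) u
      k∈ = ok-∈ (Link.ok L)
      seed-level : ∀ {j} → isSeed j ≡ true → level b j ≡ seedLev j
      seed-level s rewrite s = refl
      late-level : ∀ {j} → isSeed j ≡ false → level b j ≡ base-level + time j
      late-level s rewrite s = refl
      compare : ∀ c → isSeed j ≡ c → ∀ e → isSeed k ≡ e → level b k < level b j
      compare true s _ _ with t , l ← Link.seedy L s rewrite seed-level {j} s | seed-level {k} t = l
      compare false s true t rewrite late-level {j} s | seed-level {k} t =
        ≤-trans (s≤s (∈-sum seedLev k∈)) (m≤m+n base-level (time j))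
      compare false s false t with Link.timely L s
      ... | inj₁ t′ with () ← trans (sym t) t′
      ... | inj₂ l rewrite late-level {j} s | late-level {k} t = +-monoʳ-< base-level l

  circuit : Circuit Input
  circuit = record
    { plan = plan
    ; lev = level
    ; root∈sites = ok-∈ (refl , inj₁ 0<w , _)
    ; root-seed = refl
    ; input-site = λ b {j} j∈ u → ok-∈ (Widest.Link.ok (Widest.links b j (∈-ok j∈) u))
    ; input-pos = λ b {j} j∈ u → Widest.Link.located (Widest.links b j (∈-ok j∈) u)
    ; input-seed = λ b {j} j∈ s u → proj₁ (Widest.Link.seedy (Widest.links b j (∈-ok j∈) u) s)
    ; input-lev = input-level
    ; shape = λ b {j} j∈ → shapes b j (∈-ok j∈)
    ; emits = λ b {j} d j∈ e → emission b j d (∈-ok j∈) e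
    ; out-sig = out-sig
    ; out-north = out-north
    ; ou-tile = λ b {i} i∈ e → ou-tile b i (∈-ok i∈) e
    ; determined = λ b b′ {j} j∈ s h → determined b b′ j (∈-ok j∈) s h
    }

-- The adder

∈-allBits : ∀ {k} (b : Vec Bool k) → b ∈ allBits k
∈-allBits [] = here refl
∈-allBits (false ∷ b) = ∈-++⁺ˡ (∈-map⁺ (false ∷_) (∈-allBits b))
∈-allBits {suc k} (true ∷ b) = ∈-++⁺ʳ (map (false ∷_) (allBits k)) (∈-map⁺ (true ∷_) (∈-allBits b))

∈-zipWith⁺ : ∀ {k} (f : X → Y → Z) (xs : Vec X k) (ys : Vec Y k) i →
  f (lookup xs i) (lookup ys i) ∈ toList (zipWith f xs ys)
∈-zipWith⁺ f (x ∷ xs) (y ∷ ys) Fin.zero = here refl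
∈-zipWith⁺ f (x ∷ xs) (y ∷ ys) (Fin.suc i) = there (∈-zipWith⁺ f xs ys i)

∈-zipWith⁻ : ∀ {k} (f : X → Y → Z) (xs : Vec X k) (ys : Vec Y k) {z} → z ∈ toList (zipWith f xs ys) →
  ∃ λ i → z ≡ f (lookup xs i) (lookup ys i)
∈-zipWith⁻ f [] [] ()
∈-zipWith⁻ f (x ∷ xs) (y ∷ ys) (here e) = Fin.zero , e
∈-zipWith⁻ f (x ∷ xs) (y ∷ ys) (there m) with i , e ← ∈-zipWith⁻ f xs ys m = Fin.suc i , e

zipWith-firsts : ∀ {k} (f : Y → Z) (xs : Vec X k) (ys : Vec Y k) →
  map proj₁ (toList (zipWith (λ x y → x , f y) xs ys)) ≡ toList xs
zipWith-firsts f [] [] = refl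
zipWith-firsts f (x ∷ xs) (y ∷ ys) = cong (x ∷_) (zipWith-firsts f xs ys)

∈-toList⁻ : ∀ {k} (xs : Vec X k) {x} → x ∈ toList xs → ∃ λ i → x ≡ lookup xs i
∈-toList⁻ (_ ∷ xs) (here e) = Fin.zero , e
∈-toList⁻ (_ ∷ xs) (there m) with i , e ← ∈-toList⁻ xs m = Fin.suc i , e

toList-unique : ∀ {k} (xs : Vec X k) → (∀ i j → lookup xs i ≡ lookup xs j → i ≡ j) → Unique (toList xs)
toList-unique [] inj = []
toList-unique (x ∷ xs) inj = All.tabulate new ∷ toList-unique xs (λ i j e → Fin.suc-injective (inj _ _ e))
  where
    new : ∀ {y} → y ∈ toList xs → x ≢ y
    new m e with i , e′ ← ∈-toList⁻ xs m with () ← inj Fin.zero (Fin.suc i) (trans e e′)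

double≡ : ∀ m → double m ≡ m + m
double≡ zero = refl
double≡ (suc m) = cong suc (trans (cong suc (double≡ m)) (sym (+-suc m m)))

-- The inequality is strict because position `n`, which has no input bits, needs a place for the
-- last carry as an output.
module Adder (n w : ℕ) (0<w : 0 < w) (n<area : n < w * double w) where
  open Layout n w
  open Links n w 0<w
  open Laws n w 0<w
  open Wiring plan

  private instance
    double-nonZero : NonZero (double w)
    double-nonZero = >-nonZero (≤-trans 0<w (≤-trans (m≤m+n w w) (≤-reflexive (sym (double≡ w)))))

  -- Places of the positions in the folded blocks

  place : ℕ → ℕ → Bool → ℕ
  place x r false = lo x r
  place x r true = hi x r

  offset : ℕ → Bool → ℕ
  offset x false = x
  offset x true = (w ∸ suc x) + w

  place-offset : ∀ {x r} h → x < w → place x r h ≡ offset x h + r * double w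
  place-offset false _ = refl
  place-offset {x} {r} true x<w = begin
    double d + (suc x + r * double w)   ≡⟨ +-assoc (double d) (suc x) _ ⟨
    double d + suc x + r * double w     ≡⟨ cong (λ z → z + suc x + r * double w) (double≡ d) ⟩
    d + d + suc x + r * double w        ≡⟨ cong (_+ r * double w) (+-assoc d d (suc x)) ⟩
    d + (d + suc x) + r * double w      ≡⟨ cong (λ z → d + z + r * double w) (m∸n+n≡m x<w) ⟩
    d + w + r * double w                ∎
    where
      open ≡-Reasoning
      d = w ∸ suc x

  offset< : ∀ {x} h → x < w → offset x h < double w
  offset< false x<w = ≤-trans x<w (≤-trans (m≤m+n w w) (≤-reflexive (sym (double≡ w))))
  offset< {x} true x<w = ≤-trans (+-monoˡ-< w (∸-monoʳ-< (s≤s z≤n) x<w)) (≤-reflexive (sym (double≡ w)))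

  offset-injective : ∀ {x y} h k → x < w → y < w → offset x h ≡ offset y k → x ≡ y × h ≡ k
  offset-injective false false _ _ e = e , refl
  offset-injective true true x< y< e =
    suc-injective (∸-cancelˡ-≡ x< y< (+-cancelʳ-≡ w _ _ e)) , refl
  offset-injective false true x< y< e = ⊥-elim (<⇒≱ x< (≤-trans (m≤n+m w _) (≤-reflexive (sym e))))
  offset-injective true false x< y< e = ⊥-elim (<⇒≱ y< (≤-trans (m≤n+m w _) (≤-reflexive e)))

  place-injective : ∀ {x r y s} h k → x < w → y < w → place x r h ≡ place y s k → x ≡ y × r ≡ s × h ≡ k
  place-injective {x} {r} {y} {s} h k x< y< e
    with p , q ← digits (double w) {x = r} {s} (offset< h x<) (offset< k y<)
           (trans (sym (place-offset h x<)) (trans e (place-offset k y<)))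
    with p , q′ ← offset-injective h k x< y< p = p , q , q′

  record Slot (k : ℕ) : Set where
    field
      x r : ℕ
      high : Bool
      x< : x < w
      r< : r < w
      place≡ : place x r high ≡ k

  abstract
    -- Division by the block length gives the block and the offset in it; an offset of at least `w`
    -- lies on the upper leg and is counted from the far end.
    slot : ∀ k → k < w * double w → Slot k
    slot k k< with k % double w <? w
    ... | yes m<w = record
      { x = k % double w ; r = k / double w ; high = false ; x< = m<w
      ; r< = m<n*o⇒m/o<n k< ; place≡ = sym (m≡m%n+[m/n]*n k (double w)) }
    ... | no m≮w = record
      { x = y ; r = k / double w ; high = true ; x< = y<
      ; r< = m<n*o⇒m/o<n k<
      ; place≡ = trans (place-offset {r = k / double w} true y<)
          (trans (cong (_+ k / double w * double w) (trans (cong (_+ w) back≡) (m∸n+n≡m (≮⇒≥ m≮w))))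
            (sym (m≡m%n+[m/n]*n k (double w)))) }
      where
        e : ℕ
        e = k % double w ∸ w
        e<w : e < w
        e<w = +-cancelʳ-< w e w (subst₂ _<_ (sym (m∸n+n≡m (≮⇒≥ m≮w))) (double≡ w) (m%n<n k (double w)))
        y : ℕ
        y = w ∸ suc e
        y< : y < w
        y< = ∸-monoʳ-< (s≤s z≤n) e<w
        back≡ : w ∸ suc y ≡ e
        back≡ = suc-injective (trans (sym (∸-step y<)) (m∸[m∸n]≡n e<w))

  -- arguments: second operand?, upper half of the block?
  portOf : Bool → Bool → Col
  portOf false false = u1
  portOf true false = u3
  portOf false true = u5
  portOf true true = u7

  pick : Input → Bool → Vec Bool n
  pick b false = Vec.take n b
  pick b true = Vec.drop n b

  port-index : ∀ o h x r → index x (portOf o h) r ≡ place x r h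
  port-index false false x r = refl
  port-index true false x r = refl
  port-index false true x r = refl
  port-index true true x r = refl

  port-operand : ∀ o h b → operand b (portOf o h) ≡ pick b o
  port-operand false false b = refl
  port-operand true false b = refl
  port-operand false true b = refl
  port-operand true true b = refl

  port-odd : ∀ o h → odd (portOf o h) ≡ true
  port-odd false false = refl
  port-odd true false = refl
  port-odd false true = refl
  port-odd true true = refl

  port-injective : ∀ o h o′ h′ → portOf o h ≡ portOf o′ h′ → o ≡ o′ × h ≡ h′
  port-injective o h o′ h′ e = cong proj₁ same , cong proj₂ same
    where
      role : Col → Bool × Bool
      role u3 = true , false
      role u5 = false , true
      role u7 = true , true
      role _ = false , false
      role-port : ∀ o h → role (portOf o h) ≡ (o , h)
      role-port false false = refl
      role-port true false = refl
      role-port false true = refl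
      role-port true true = refl
      same : (o , h) ≡ (o′ , h′)
      same = trans (sym (role-port o h)) (trans (cong role e) (role-port o′ h′))

  odd-port : ∀ u → odd u ≡ true → ∃ λ o → ∃ λ h → u ≡ portOf o h
  odd-port u1 _ = false , false , refl
  odd-port u3 _ = true , false , refl
  odd-port u5 _ = false , true , refl
  odd-port u7 _ = true , true , refl

  isPort : Site → Bool
  isPort (load , x , u , r) = odd u ∧ real x u r
  isPort _ = false

  slotFor : (i : Fin n) → Slot (toℕ i)
  slotFor i = slot (toℕ i) (<-trans (Fin.toℕ<n i) n<area)

  inputSite : Bool → Fin n → Site
  inputSite o i = load , Slot.x (slotFor i) , portOf o (Slot.high (slotFor i)) , Slot.r (slotFor i)

  split : Fin n ⊎ Fin n → Bool × Fin n
  split = [ false ,_ , true ,_ ]′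

  bitSite : Fin (n + n) → Site
  bitSite i = let o , k = split (splitAt n i) in inputSite o k

  split-injective : ∀ {i j} → split i ≡ split j → i ≡ j
  split-injective {inj₁ _} {inj₁ _} refl = refl
  split-injective {inj₂ _} {inj₂ _} refl = refl

  split-surjective : ∀ o k → ∃ λ i → split i ≡ (o , k)
  split-surjective false k = inj₁ k , refl
  split-surjective true k = inj₂ k , refl

  inputSite-ok : ∀ o i → Ok (inputSite o i)
  inputSite-ok o i = Slot.x< (slotFor i) , Slot.r< (slotFor i)

  inputSite-index : ∀ o i →
    index (Slot.x (slotFor i)) (portOf o (Slot.high (slotFor i))) (Slot.r (slotFor i)) ≡ toℕ i
  inputSite-index o i = trans (port-index o (Slot.high s) (Slot.x s) (Slot.r s)) (Slot.place≡ s)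
    where s = slotFor i

  inputSite-port : ∀ o i → isPort (inputSite o i) ≡ true
  inputSite-port o i = cong₂ _∧_ (port-odd o (Slot.high (slotFor i)))
    (<⇒<ᵇ-true (subst (_< n) (sym (inputSite-index o i)) (Fin.toℕ<n i)))

  inputSite-injective : ∀ {o o′ i i′} → inputSite o i ≡ inputSite o′ i′ → (o , i) ≡ (o′ , i′)
  inputSite-injective {o} {o′} {i} {i′} e = cong₂ _,_ (proj₁ ports)
    (Fin.toℕ-injective (trans (sym (Slot.place≡ s)) (trans same (Slot.place≡ s′))))
    where
      s = slotFor i
      s′ = slotFor i′
      ports = port-injective o (Slot.high s) o′ (Slot.high s′) (cong (λ j → proj₁ (proj₂ (proj₂ j))) e)
      same : place (Slot.x s) (Slot.r s) (Slot.high s) ≡ place (Slot.x s′) (Slot.r s′) (Slot.high s′)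
      same = trans (cong (place _ _) (proj₂ ports))
        (cong₂ (λ x r → place x r (Slot.high s′)) (cong (λ j → proj₁ (proj₂ j)) e) (cong (λ j → proj₂ (proj₂ (proj₂ j))) e))

  bitSite-injective : ∀ {i j} → bitSite i ≡ bitSite j → i ≡ j
  bitSite-injective {i} {j} e = trans (sym (Fin.join-splitAt n n i))
    (trans (cong (Fin.join n n) (split-injective {splitAt n i} {splitAt n j} (inputSite-injective e)))
      (Fin.join-splitAt n n j))

  inputSite-at : ∀ c h x r (index< : index x (portOf c h) r < n) → x < w →
    inputSite c (fromℕ< index<) ≡ (load , x , portOf c h , r)
  inputSite-at c h x r index< x<
    with s ← slotFor (fromℕ< index<)
    with p , q , t ← place-injective (Slot.high s) h (Slot.x< s) x<
           (trans (Slot.place≡ s) (trans (Fin.toℕ-fromℕ< index<) (port-index c h x r))) =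
    cong₂ (λ y z → load , y , z) p (cong₂ _,_ (cong (portOf c) t) q)

  bitSite-join : ∀ z → bitSite (Fin.join n n z) ≡ inputSite (proj₁ (split z)) (proj₂ (split z))
  bitSite-join z = cong (λ y → inputSite (proj₁ (split y)) (proj₂ (split y))) (Fin.splitAt-join n n z)

  port-bitSite : ∀ j → Ok j → isPort j ≡ true → ∃ λ i → bitSite i ≡ j
  port-bitSite (load , x , u , r) (x< , r<) p
    with odd u in o | real x u r in re | p
  ... | true | true | _ with c , h , refl ← odd-port u o
    with index< ← <ᵇ⇒< (index x (portOf c h) r) n (subst T (sym re) _)
    with z , e ← split-surjective c (fromℕ< index<) =
    Fin.join n n z , trans (bitSite-join z)
      (trans (cong (λ y → inputSite (proj₁ y) (proj₂ y)) e) (inputSite-at c h x r index< x<))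

  input-bit : ∀ b o i →
    inBit b (Slot.x (slotFor i)) (portOf o (Slot.high (slotFor i))) (Slot.r (slotFor i)) ≡ lookup (pick b o) i
  input-bit b o i = trans (cong₂ at (port-operand o (Slot.high (slotFor i)) b) (inputSite-index o i))
    (at-lookup (pick b o) i)

  pick-split : ∀ b i → let o , k = split (splitAt n i) in lookup (pick b o) k ≡ lookup b i
  pick-split b i = trans (choose (splitAt n i))
    (trans (sym (Vec.lookup-splitAt n (Vec.take n b) (Vec.drop n b) i))
      (cong (λ v → lookup v i) (Vec.take++drop≡id n b)))
    where
      choose : ∀ z → lookup (pick b (proj₁ (split z))) (proj₂ (split z)) ≡
        [ lookup (Vec.take n b) , lookup (Vec.drop n b) ]′ z
      choose (inj₁ _) = refl
      choose (inj₂ _) = refl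

  port-tile : ∀ b x u r → odd u ≡ true → real x u r ≡ true → tileAt b (load , x , u , r) ≡ bitTileOf (inBit b x u r)
  port-tile b x u1 r _ e rewrite e = refl
  port-tile b x u3 r _ e rewrite e = refl
  port-tile b x u5 r _ e rewrite e = refl
  port-tile b x u7 r _ e rewrite e = refl

  bitSite-tile : ∀ b i → tileAt b (bitSite i) ≡ bitTileOf (lookup b i)
  bitSite-tile b i = trans
    (port-tile b (Slot.x s) (portOf o (Slot.high s)) (Slot.r s) (port-odd o (Slot.high s)) is-real)
    (cong bitTileOf (trans (input-bit b o k) (pick-split b i)))
    where
      o = proj₁ (split (splitAt n i))
      k = proj₂ (split (splitAt n i))
      s = slotFor k
      is-real : real (Slot.x s) (portOf o (Slot.high s)) (Slot.r s) ≡ true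
      is-real = ∧-conicalʳ (odd (portOf o (Slot.high s))) _ (inputSite-port o k)

  -- The seed without the input bits

  fixed : Site → Bool
  fixed j = isSeed j ∧ not (isPort j)

  fixed-msg : ∀ b b′ j → fixed j ≡ true → msg b j ≡ msg b′ j
  fixed-msg b b′ (tooth , _) _ = refl
  fixed-msg b b′ (store , x , u0 , r) _ = refl
  fixed-msg b b′ (store , x , u2 , r) _ = refl
  fixed-msg b b′ (store , x , u4 , r) _ = refl
  fixed-msg b b′ (store , x , u6 , r) _ = refl
  fixed-msg b b′ (store , x , u7 , r) ()
  fixed-msg b b′ (load , x , u , r) e with odd u
  ... | false = refl
  ... | true with real x u r in re
  ...   | false = cong (λ c → bits (c ∷ [])) (trans (beyond (operand b u)) (sym (beyond (operand b′ u))))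
    where
      beyond : ∀ v → at v (index x u r) ≡ false
      beyond v = at-beyond v (index x u r) (≮⇒≥ λ l → true≢false (trans (sym (<⇒<ᵇ-true l)) re))
        where
          true≢false : true ≢ false
          true≢false ()
  fixed-msg b b′ (column , x , u0 , zero) _ = refl
  fixed-msg b b′ (spine , _) _ = refl

  seed-inputs-fixed : ∀ b j {d k} → Ok j → isSeed j ≡ true → (d , k) ∈ inputs b j → fixed k ≡ true
  seed-inputs-fixed b (tooth , x , u0 , r) _ _ first = refl
  seed-inputs-fixed b (tooth , x , u1 , r) _ _ first = refl
  seed-inputs-fixed b (tooth , x , u2 , r) _ _ first = refl
  seed-inputs-fixed b (tooth , x , u3 , r) _ _ first with x ≡ᵇ w
  ... | true = refl
  ... | false = refl
  seed-inputs-fixed b (tooth , x , u4 , r) _ _ first = refl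
  seed-inputs-fixed b (tooth , x , u5 , r) _ _ first = refl
  seed-inputs-fixed b (tooth , x , u6 , r) _ _ first = refl
  seed-inputs-fixed b (tooth , x , u7 , r) _ _ first = refl
  seed-inputs-fixed b (store , x , u0 , r) _ _ first = refl
  seed-inputs-fixed b (store , x , u2 , r) _ _ first = refl
  seed-inputs-fixed b (store , x , u4 , r) _ _ first = refl
  seed-inputs-fixed b (store , x , u6 , r) _ _ first = refl
  seed-inputs-fixed b (load , x , u0 , r) _ _ first = refl
  seed-inputs-fixed b (load , x , u1 , r) _ _ first = refl
  seed-inputs-fixed b (load , x , u2 , r) _ _ first = refl
  seed-inputs-fixed b (load , x , u3 , r) _ _ first = refl
  seed-inputs-fixed b (load , x , u4 , r) _ _ first = refl
  seed-inputs-fixed b (load , x , u5 , r) _ _ first = refl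
  seed-inputs-fixed b (load , x , u6 , r) _ _ first = refl
  seed-inputs-fixed b (load , x , u7 , r) _ _ first = refl
  seed-inputs-fixed b (column , x , u0 , zero) _ _ first = refl
  seed-inputs-fixed b (spine , x , u0 , suc r) _ _ first = refl
  seed-inputs-fixed b (spine , x , u1 , r) _ _ first = refl
  seed-inputs-fixed b (spine , x , u2 , r) _ _ first = refl
  seed-inputs-fixed b (spine , x , u3 , r) _ _ first = refl
  seed-inputs-fixed b (spine , x , u4 , r) _ _ first = refl
  seed-inputs-fixed b (spine , x , u5 , r) _ _ first = refl
  seed-inputs-fixed b (spine , x , u6 , r) _ _ first = refl
  seed-inputs-fixed b (spine , x , u7 , r) _ _ first = refl

  fixed-seed : ∀ j → fixed j ≡ true → isSeed j ≡ true
  fixed-seed j e with isSeed j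
  ... | true = refl

  tile-cong : ∀ b b′ j → msg b j ≡ msg b′ j → (∀ {d k} → (d , k) ∈ inputs b j → msg b k ≡ msg b′ k) →
    tileAt b j ≡ tileAt b′ j
  tile-cong b b′ j e h = tiles≡
    where
      feed≡ : ∀ d → (∀ {k} → source d (ins j (msg b j)) ≡ just k → msg b k ≡ msg b′ k) → side b j d ≡ side b′ j d
      feed≡ d h rewrite sym e with source d (ins j (msg b j))
      ... | just k = cong (out k (opp d)) (h refl)
      ... | nothing = cong (out j d) e
      side≡ : ∀ d → side b j d ≡ side b′ j d
      side≡ d = feed≡ d λ q → h (source-just d (inputs b j) q)
      tiles≡ : tileAt b j ≡ tileAt b′ j
      tiles≡ rewrite side≡ N | side≡ E | side≡ S | side≡ W | e = refl

  -- The template is chosen before the input is known. A fixed tile shows only its own emissions and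
  -- what another fixed tile sends it, and none of these messages depends on the input.
  fixed-tile : ∀ b b′ j → Ok j → fixed j ≡ true → tileAt b j ≡ tileAt b′ j
  fixed-tile b b′ j o e = tile-cong b b′ j (fixed-msg b b′ j e)
    λ {_} {k} u → fixed-msg b b′ k (seed-inputs-fixed b j o (fixed-seed j e) u)

  fixed-label : ∀ b j → fixed j ≡ true → label (tileAt b j) ≡ 2
  fixed-label b (tooth , _) _ = refl
  fixed-label b (store , x , u0 , r) _ = refl
  fixed-label b (store , x , u2 , r) _ = refl
  fixed-label b (store , x , u4 , r) _ = refl
  fixed-label b (store , x , u6 , r) _ = refl
  fixed-label b (store , x , u7 , r) ()
  fixed-label b (load , x , u , r) e with odd u ∧ real x u r
  ... | false = refl
  fixed-label b (column , x , u0 , zero) _ = refl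
  fixed-label b (spine , _) _ = refl

  labelled : ∀ b j → Ok j → label (tileAt b j) ≡ 2 ⊎ (∃ λ c → tileAt b j ≡ bitTileOf c)
  labelled b (tooth , _) _ = inj₁ refl
  labelled b (store , x , u0 , r) _ = inj₁ refl
  labelled b (store , x , u1 , r) _ = inj₂ (_ , refl)
  labelled b (store , x , u2 , r) _ = inj₁ refl
  labelled b (store , x , u3 , r) _ = inj₂ (_ , refl)
  labelled b (sums , _) _ = inj₁ refl
  labelled b (carries , _) _ = inj₁ refl
  labelled b (spans , _) _ = inj₁ refl
  labelled b (scan , _) _ = inj₁ refl
  labelled b j@(load , x , u , r) _ = by (isPort j) refl
    where
      by : ∀ c → isPort j ≡ c → label (tileAt b j) ≡ 2 ⊎ (∃ λ c → tileAt b j ≡ bitTileOf c)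
      by false e rewrite e = inj₁ refl
      by true e = inj₂ (_ , port-tile b x u r (∧-conicalˡ _ _ e) (∧-conicalʳ (odd u) _ e))
  labelled b (column , _) _ = inj₁ refl
  labelled b (spine , _) _ = inj₁ refl

  open CircuitAssembly circuit (allBits (n + n)) ∈-allBits using (tileSet; tileAt∈; member; isBit; isAt; dataflow)

  -- An arbitrary choice: by `fixed-tile` every input gives the same frame.
  blank : Input
  blank = Vec.replicate (n + n) false

  fixed? : ∀ j → Dec (fixed j ≡ true)
  fixed? j = fixed j Bool.≟ true

  frame : Assembly
  frame = map (λ j → pos j , tileAt blank j) (filter fixed? sites)

  ∈-frame⁻ : ∀ {x} → x ∈ frame → ∃ λ j → Ok j × fixed j ≡ true × x ≡ (pos j , tileAt blank j)
  ∈-frame⁻ m with j , j∈ , e ← ∈-map⁻ _ m with o , f ← ∈-filter⁻ fixed? {xs = sites} j∈ =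
    j , ∈-ok o , f , e

  frame-unique : ValidAssembly frame
  frame-unique = subst Unique (List.map-∘ (filter fixed? sites))
    (map-unique (λ i j → pos-injective
        (proj₁ (∈-filter⁻ fixed? {xs = sites} i)) (proj₁ (∈-filter⁻ fixed? {xs = sites} j)))
      (Unique.filter⁺ fixed? sites-unique))

  ports : Vec Pos (n + n)
  ports = tabulate λ i → pos (bitSite i)

  lookup-ports : ∀ i → lookup ports i ≡ pos (bitSite i)
  lookup-ports = Vec.lookup∘tabulate _

  bitSite-ok : ∀ i → Ok (bitSite i)
  bitSite-ok i = inputSite-ok (proj₁ (split (splitAt n i))) (proj₂ (split (splitAt n i)))

  bitSite-port : ∀ i → isPort (bitSite i) ≡ true
  bitSite-port i = inputSite-port (proj₁ (split (splitAt n i))) (proj₂ (split (splitAt n i)))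

  ports-distinct : ∀ i j → lookup ports i ≡ lookup ports j → i ≡ j
  ports-distinct i j e = bitSite-injective (pos-injective {bitSite i} {bitSite j}
    (ok-∈ {bitSite i} (bitSite-ok i)) (ok-∈ {bitSite j} (bitSite-ok j))
    (trans (sym (lookup-ports i)) (trans e (lookup-ports j))))

  fixed-not-port : ∀ {j} → fixed j ≡ true → isPort j ≡ true → ⊥
  fixed-not-port {j} e p with isSeed j | isPort j
  fixed-not-port () refl | true | true
  fixed-not-port () refl | false | true

  ports-free : ∀ i → ¬ (lookup ports i ∈ positions frame)
  ports-free i m = let x , x∈ , e = ∈-map⁻ proj₁ m ; j , o , f , at = ∈-frame⁻ x∈ in
    fixed-not-port {j} f (subst (λ z → isPort z ≡ true)
      (pos-injective {bitSite i} {j} (ok-∈ {bitSite i} (bitSite-ok i)) (ok-∈ {j} o)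
        (trans (sym (lookup-ports i)) (trans e (cong proj₁ at))))
      (bitSite-port i))

  -- Places and correctness of the output

  outputSlot : (i : Fin (suc n)) → Slot (toℕ i)
  outputSlot i = slot (toℕ i) (<-≤-trans (Fin.toℕ<n i) n<area)

  -- The upper sum bit is delivered one supercell further east, where `combine` has the carry behind
  -- the lower position and the span between the legs.
  resultSite : ℕ → ℕ → Bool → Site
  resultSite x r false = store , x , u1 , r
  resultSite x r true = store , suc x , u3 , r

  outputSite : Fin (suc n) → Site
  outputSite i = resultSite (Slot.x (outputSlot i)) (Slot.r (outputSlot i)) (Slot.high (outputSlot i))

  resultSite-ok : ∀ {x r} h → x < w → r < w → Ok (resultSite x r h)
  resultSite-ok false x< r< = inside x< , r< , _
  resultSite-ok true x< r< = next u3 x< _ , r< , _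

  outputSite-ok : ∀ i → Ok (outputSite i)
  outputSite-ok i = resultSite-ok (Slot.high (outputSlot i)) (Slot.x< (outputSlot i)) (Slot.r< (outputSlot i))

  lowSum-correct : ∀ b x r → x < w → lowSum (sumVal b x r) ≡ sumBit (q b) (lo x r)
  lowSum-correct b x r l with _ , _ , e ← localCarry-car b x r
    rewrite e | spanVal-less b x r l = refl

  -- By `span-carry` the stretch strictly between the two positions turns the carry behind the lower
  -- one into the carry into the upper one.
  highSum-correct : ∀ b x r → x < w → highSum (sumVal b (suc x) r) ≡ sumBit (q b) (hi x r)
  highSum-correct b x r l = trans by-span (cong (isProp (q b (hi x r)) xor_) (begin
    apply (spanOf (spanVal b (suc x) r)) (carry (q b) (lo (suc x) r))
      ≡⟨ cong (λ s → apply s (carry (q b) (lo (suc x) r))) (spanVal-span b (suc x) r l) ⟩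
    apply (span (q b) (lo (suc x) r) (w ∸ suc x)) (carry (q b) (lo (suc x) r))
      ≡⟨ span-carry (q b) (w ∸ suc x) (lo (suc x) r) ⟩
    carry (q b) (hi x r) ∎))
    where
      open ≡-Reasoning
      by-span : highSum (sumVal b (suc x) r) ≡
        isProp (q b (hi x r)) xor apply (spanOf (spanVal b (suc x) r)) (carry (q b) (lo (suc x) r))
      by-span with suc x <ᵇ w
      ... | true = refl
      ... | false = refl

  result-label : ∀ b x r h → x < w → label (tileAt b (resultSite x r h)) ≡ bitLabel (sumBit (q b) (place x r h))
  result-label b x r false l = cong bitLabel (lowSum-correct b x r l)
  result-label b x r true l = cong bitLabel (highSum-correct b x r l)

  adder : TAC (n + n) (suc n)
  adder = record
    { tiles = tileSet
    ; τ = 2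
    ; t₀ = bitTileOf false
    ; t₁ = bitTileOf true
    ; t₀∈T = here refl
    ; t₁∈T = there first
    ; label-t₀ = refl
    ; label-t₁ = refl
    ; only-t₀ = only false
    ; only-t₁ = only true
    ; R = frame
    ; R-valid = frame-unique
    ; R-tiles = λ x m → let j , o , f , e = ∈-frame⁻ m in
        subst (_∈ tileSet) (sym (cong proj₂ e)) (tileAt∈ blank (ok-∈ {j} o)) ,
        blank-not-bit false {j = j} o f e , blank-not-bit true {j = j} o f e
    ; B = ports
    ; B-distinct = ports-distinct
    ; B-free = ports-free
    ; C = tabulate λ i → pos (outputSite i)
    }
    where
      bit≢2 : ∀ c → bitLabel c ≢ 2
      bit≢2 false ()
      bit≢2 true ()
      only : ∀ c t → t ∈ tileSet → label t ≡ bitLabel c → t ≡ bitTileOf c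
      only c t t∈ e with member t∈
      only false t t∈ e | isBit false refl = refl
      only true t t∈ e | isBit true refl = refl
      ... | isAt b j j∈ refl with labelled b j (∈-ok j∈)
      ...   | inj₁ plain = ⊥-elim (bit≢2 c (trans (sym e) plain))
      only false t t∈ e | isAt b j j∈ refl | inj₂ (false , eq) = eq
      only true t t∈ e | isAt b j j∈ refl | inj₂ (true , eq) = eq
      only false t t∈ e | isAt b j j∈ refl | inj₂ (true , eq) with () ← trans (sym e) (cong label eq)
      only true t t∈ e | isAt b j j∈ refl | inj₂ (false , eq) with () ← trans (sym e) (cong label eq)
      blank-not-bit : ∀ c {x j} → Ok j → fixed j ≡ true → x ≡ (pos j , tileAt blank j) → proj₂ x ≢ bitTileOf c
      blank-not-bit c {j = j} o f refl e = bit≢2 c (trans (sym (cong label e)) (fixed-label blank j f))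

  -- Growth from a given input

  module Run (b : Input) where
    open Growth (dataflow b)

    loaded : List (Pos × Tile)
    loaded = toList (zipWith (λ p bit → p , bitTile adder bit) ports b)

    bitTile≡ : ∀ c → bitTile adder c ≡ bitTileOf c
    bitTile≡ false = refl
    bitTile≡ true = refl

    loaded-cell : ∀ i → (lookup ports i , bitTile adder (lookup b i)) ≡ cell (bitSite i)
    loaded-cell i = cong₂ _,_ (lookup-ports i) (trans (bitTile≡ (lookup b i)) (sym (bitSite-tile b i)))

    port-seed : ∀ j → isPort j ≡ true → isSeed j ≡ true
    port-seed (load , _) _ = refl

    start : Stage 0 (U adder b)
    start = record
      { valid = subst Unique (sym (trans (List.map-++ proj₁ frame loaded) (cong (positions frame ++_) loaded-firsts)))
          (Unique.++⁺ frame-unique (toList-unique ports ports-distinct)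
            λ { (i , j) → let k , e = ∈-toList⁻ ports j in ports-free k (subst (_∈ positions frame) e i) })
      ; only = λ {x} m → [ framed , (λ i → let k , e = ∈-zipWith⁻ _ ports b i in
            bitSite k , ok-∈ {bitSite k} (bitSite-ok k) , trans e (loaded-cell k) , port-seed (bitSite k) (bitSite-port k)) ]′
          (∈-++⁻ frame m)
      ; all = λ {j} j∈ s → seeded j (∈-ok j∈) s (isPort j) refl
      }
      where
        loaded-firsts : positions loaded ≡ toList ports
        loaded-firsts = zipWith-firsts (bitTile adder) ports b
        framed : ∀ {x} → x ∈ frame → ∃ λ j → j ∈ sites × x ≡ cell j × isSeed j ≡ true
        framed m with j , o , f , refl ← ∈-frame⁻ m =
          j , ok-∈ {j} o , cong (pos j ,_) (fixed-tile blank b j o f) , fixed-seed j f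
        seeded : ∀ j → Ok j → isSeed j ≡ true → ∀ c → isPort j ≡ c → cell j ∈ U adder b
        seeded j o s true p with i , refl ← port-bitSite j o p =
          ∈-++⁺ʳ frame (subst (_∈ loaded) (loaded-cell i) (∈-zipWith⁺ _ ports b i))
        seeded j o s false p = ∈-++⁺ˡ (subst (_∈ frame) (cong (pos j ,_) (fixed-tile blank b j o f))
          (∈-map⁺ _ (∈-filter⁺ fixed? (ok-∈ {j} o) f)))
          where
            f : fixed j ≡ true
            f rewrite s | p = refl

    represents : ∀ {A} → (∀ {j} → j ∈ sites → cell j ∈ A) → Represents adder A (adderFun n b)
    represents {A} full i = tileAt b (outputSite i) ,
      subst (λ p → (p , tileAt b (outputSite i)) ∈ A) (sym (Vec.lookup∘tabulate (λ k → pos (outputSite k)) i))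
        (full (ok-∈ {outputSite i} (outputSite-ok i))) ,
      trans (result-label b (Slot.x (outputSlot i)) (Slot.r (outputSlot i)) (Slot.high (outputSlot i))
          (Slot.x< (outputSlot i)))
        (cong bitLabel (trans (cong (sumBit (q b)) (Slot.place≡ (outputSlot i))) (sym (adder-sumBit n b i))))

    computes : Σ Assembly λ A → UniquelyAssembles tileSet 2 (U adder b) A × Represents adder A (adderFun n b)
    computes = let A , unique , full = unique-assembly (stage-good start) in A , unique , represents full

    time-bound : ∀ ℓ Λ → (ρ≤ : ∀ {x r} → x ≤ w → r < w → ρ b x r ≤ ℓ) → (β≤ : ∀ {r} → r ≤ w → β b r ≤ Λ) →
      (∀ {x r} → x ≤ w → r < w → μ b r x ≤ ℓ) →
      ∀ {j} → j ∈ sites → Timing.time b ℓ Λ ρ≤ β≤ j ≤ 7 + (ℓ * 8 + (7 + (Λ * 7 + (18 + ℓ * 8))))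
    time-bound ℓ Λ ρ≤ β≤ μ≤ {j} j∈ = bound j (∈-ok j∈)
      where
        open Timing b ℓ Λ ρ≤ β≤
        K = 7 + (ℓ * 8 + δ)
        tail : ∀ m → δ ≤ m + δ
        tail m = m≤n+m δ m
        α≤K : α ≤ K
        α≤K = ≤-trans (m≤n+m α (Λ * 7)) (≤-trans (m≤n+m _ 7) (≤-trans (tail (ℓ * 8)) (m≤n+m _ 7)))
        small : ∀ {m} → m ≤ 18 → m ≤ K
        small p = ≤-trans p (≤-trans (m≤m+n 18 (ℓ * 8)) α≤K)
        spanning : ∀ u {x r} → x ≤ w → r < w → back u + (9 + ρ b x r * 8) ≤ K
        spanning u x≤ r< = ≤-trans (+-mono-≤ (m∸n≤m 7 (toℕ u)) (+-monoʳ-≤ 9 (*-monoˡ-≤ 8 (ρ≤ x≤ r<))))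
          (≤-trans (m≤n+m _ 2) α≤K)
        columns : ∀ k {r} → k ≤ 7 → r ≤ w → k + (β b r * 7 + α) ≤ K
        columns k k≤ r≤ = ≤-trans (+-mono-≤ k≤ (+-monoˡ-≤ α (*-monoˡ-≤ 7 (β≤ r≤))))
          (≤-trans (tail (ℓ * 8)) (m≤n+m _ 7))
        rest : ∀ k {x r} → k ≤ 7 → x ≤ w → r < w → k + (μ b r x * 8 + δ) ≤ K
        rest k k≤ x≤ r< = +-mono-≤ k≤ (+-monoˡ-≤ δ (*-monoˡ-≤ 8 (μ≤ x≤ r<)))
        bound : ∀ j → Ok j → time j ≤ K
        bound (tooth , _) _ = z≤n
        bound (store , x , u0 , r) (i , p , _) = rest 3 (m≤m+n 3 4) (Inside-≤ i) p
        bound (store , x , u1 , r) (i , p , _) = rest 4 (m≤m+n 4 3) (Inside-≤ i) p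
        bound (store , x , u2 , r) (i , p , _) = rest 5 (m≤m+n 5 2) (Inside-≤ i) p
        bound (store , x , u3 , r) (i , p , _) = rest 6 (m≤m+n 6 1) (Inside-≤ i) p
        bound (sums , x , u1 , r) (i , p , _) = rest 3 (m≤m+n 3 4) (Inside-≤ i) p
        bound (sums , x , u2 , r) (i , p , _) = rest 4 (m≤m+n 4 3) (Inside-≤ i) p
        bound (sums , x , u3 , r) (i , p , _) = rest 5 (m≤m+n 5 2) (Inside-≤ i) p
        bound (carries , x , u0 , r) (i , p) = rest 1 (m≤m+n 1 6) (Inside-≤ i) p
        bound (carries , x , u1 , r) (i , p) = rest 2 (m≤m+n 2 5) (Inside-≤ i) p
        bound (carries , x , u2 , r) (i , p) = rest 3 (m≤m+n 3 4) (Inside-≤ i) p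
        bound (carries , x , u3 , r) (i , p) = rest 4 (m≤m+n 4 3) (Inside-≤ i) p
        bound (carries , x , u4 , r) (i , p) = rest 5 (m≤m+n 5 2) (Inside-≤ i) p
        bound (carries , x , u5 , r) (i , p) = rest 6 (m≤m+n 6 1) (Inside-≤ i) p
        bound (carries , x , u6 , r) (i , p) = rest 7 ≤-refl (Inside-≤ i) p
        bound (carries , x , u7 , r) (i , p) = rest 0 z≤n (strictly i _) p
        bound (spans , x , u , r) (i , p) = spanning u (Inside-≤ i) p
        bound (scan , x , u , r) _ = small (≤-trans (≤-pred (Fin.toℕ<n u)) (m≤m+n 7 11))
        bound (load , _) _ = z≤n
        bound (column , x , u0 , r) (_ , p , _) = columns 3 (m≤m+n 3 4) (<⇒≤ p)
        bound (column , x , u1 , r) (_ , p , _) = columns 4 (m≤m+n 4 3) (<⇒≤ p)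
        bound (column , x , u2 , r) (_ , p , _) = columns 5 (m≤m+n 5 2) (<⇒≤ p)
        bound (column , x , u3 , r) (_ , p , _) = columns 6 (m≤m+n 6 1) (<⇒≤ p)
        bound (column , x , u4 , r) (_ , p , _) = columns 0 z≤n p
        bound (column , x , u5 , r) (_ , p , _) = columns 1 (m≤m+n 1 6) p
        bound (column , x , u6 , r) (_ , p , _) = columns 2 (m≤m+n 2 5) p
        bound (column , x , u7 , r) _ = z≤n
        bound (spine , _) _ = z≤n

    run-time-bound : ∃ λ k → RunTimeOn adder b k ×
      (∀ ℓ Λ → (∀ {x r} → x ≤ w → r < w → ρ b x r ≤ ℓ) → (∀ {r} → r ≤ w → β b r ≤ Λ) →
        (∀ {x r} → x ≤ w → r < w → μ b r x ≤ ℓ) →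
        -- The last arrival is bounded with 7 in place of 9; the other 2 come from `run-time`.
        k ≤ 9 + (ℓ * 8 + (7 + (Λ * 7 + (18 + ℓ * 8)))))
    run-time-bound = let k , timed , within = run-time start in k , timed ,
      λ ℓ Λ ρ≤ β≤ μ≤ → within {Timing.time b ℓ Λ ρ≤ β≤}
        (λ {j} j∈ s u → Timing.Link.timely (Timing.links b ℓ Λ ρ≤ β≤ j (∈-ok j∈) u) s)
        (time-bound ℓ Λ ρ≤ β≤ μ≤)

-- Runs of propagating positions

sumTo : ℕ → (ℕ → ℕ) → ℕ
sumTo zero g = 0
sumTo (suc n) g = g 0 + sumTo n (λ i → g (suc i))

sumTo-term : ∀ {n} g {i} → i < n → g i ≤ sumTo n g
sumTo-term g {zero} (s≤s _) = m≤m+n _ _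
sumTo-term g {suc i} (s≤s l) = ≤-trans (sumTo-term (λ i → g (suc i)) l) (m≤n+m _ (g 0))

sumTo-ones : ∀ n g m → m ≤ n → (∀ j → j < m → 1 ≤ g j) → m ≤ sumTo n g
sumTo-ones n g zero _ _ = z≤n
sumTo-ones (suc n) g (suc m) (s≤s l) h =
  +-mono-≤ (h 0 (s≤s z≤n)) (sumTo-ones n (λ i → g (suc i)) m l (λ j l → h (suc j) (s≤s l)))

sumTo-* : ∀ n c g → sumTo n (λ i → c * g i) ≡ c * sumTo n g
sumTo-* zero c g = sym (*-zeroʳ c)
sumTo-* (suc n) c g = trans (cong (c * g 0 +_) (sumTo-* n c (λ i → g (suc i)))) (sym (*-distribˡ-+ c (g 0) _))

sumTo-≤ : ∀ n g M → (∀ i → g i ≤ M) → sumTo n g ≤ n * M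
sumTo-≤ zero g M h = z≤n
sumTo-≤ (suc n) g M h = +-mono-≤ (h 0) (sumTo-≤ n (λ i → g (suc i)) M (λ i → h (suc i)))

-- The series 1/2 + 1/4 + ⋯ stays below 1, with denominators cleared. To apply the induction
-- hypothesis the later terms are doubled.
geometric : ∀ n g M → (∀ j → g j * 2 ^ suc j ≤ M) → sumTo n g ≤ M
geometric zero g M h = z≤n
geometric (suc n) g M h = *-cancelˡ-≤ 2 (begin
  2 * (g 0 + sumTo n (λ j → g (suc j)))
    ≡⟨ *-distribˡ-+ 2 (g 0) _ ⟩
  2 * g 0 + 2 * sumTo n (λ j → g (suc j))
    ≡⟨ cong₂ _+_ (*-comm 2 (g 0)) (sym (sumTo-* n 2 (λ j → g (suc j)))) ⟩
  g 0 * 2 + sumTo n (λ j → 2 * g (suc j))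
    ≤⟨ +-mono-≤ (h 0) (geometric n (λ j → 2 * g (suc j)) M halve) ⟩
  M + M
    ≡⟨ cong (M +_) (+-identityʳ M) ⟨
  2 * M ∎)
  where
    open ≤-Reasoning
    halve : ∀ j → 2 * g (suc j) * 2 ^ suc j ≤ M
    halve j = ≤-trans
      (≤-reflexive (solve 2 (λ x y → con 2 :* x :* y := x :* (con 2 :* y)) refl (g (suc j)) (2 ^ suc j)))
      (h (suc j))
      where open +-*-Solver

-- Sums over all inputs

total : ∀ k → (Vec Bool k → ℕ) → ℕ
total k g = sum (map g (allBits k))

total-suc : ∀ k g → total (suc k) g ≡ total k (λ v → g (false ∷ v)) + total k (λ v → g (true ∷ v))
total-suc k g = begin
  sum (map g (map (false ∷_) L ++ map (true ∷_) L))
    ≡⟨ cong sum (List.map-++ g (map (false ∷_) L) (map (true ∷_) L)) ⟩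
  sum (map g (map (false ∷_) L) ++ map g (map (true ∷_) L))
    ≡⟨ sum-++ (map g (map (false ∷_) L)) (map g (map (true ∷_) L)) ⟩
  sum (map g (map (false ∷_) L)) + sum (map g (map (true ∷_) L))
    ≡⟨ cong₂ (λ y z → sum y + sum z) (List.map-∘ L) (List.map-∘ L) ⟨
  total k (λ v → g (false ∷ v)) + total k (λ v → g (true ∷ v)) ∎
  where
    open ≡-Reasoning
    L = allBits k

total-cong : ∀ k {g h : Vec Bool k → ℕ} → (∀ v → g v ≡ h v) → total k g ≡ total k h
total-cong k e = cong sum (List.map-cong e (allBits k))

total-mono : ∀ k {g h : Vec Bool k → ℕ} → (∀ v → g v ≤ h v) → total k g ≤ total k h
total-mono k e = sum-map-mono (allBits k) (λ {v} _ → e v)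

total-const : ∀ k c → total k (λ _ → c) ≡ c * 2 ^ k
total-const zero c = trans (+-identityʳ c) (sym (*-identityʳ c))
total-const (suc k) c = trans (total-suc k (λ _ → c)) (trans (cong₂ _+_ (total-const k c) (total-const k c))
  (solve 2 (λ c y → c :* y :+ c :* y := c :* (con 2 :* y)) refl c (2 ^ k)))
  where open +-*-Solver

total-+ : ∀ k g h → total k (λ v → g v + h v) ≡ total k g + total k h
total-+ k g h = go (allBits k)
  where
    go : ∀ L → sum (map (λ v → g v + h v) L) ≡ sum (map g L) + sum (map h L)
    go [] = refl
    go (v ∷ L) = trans (cong (g v + h v +_) (go L))
      (solve 4 (λ a b c d → a :+ b :+ (c :+ d) := a :+ c :+ (b :+ d)) refl (g v) (h v) (sum (map g L)) (sum (map h L)))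
      where open +-*-Solver

total-* : ∀ k c g → total k (λ v → c * g v) ≡ c * total k g
total-* k c g = go (allBits k)
  where
    go : ∀ L → sum (map (λ v → c * g v) L) ≡ c * sum (map g L)
    go [] = sym (*-zeroʳ c)
    go (v ∷ L) = trans (cong (c * g v +_) (go L)) (sym (*-distribˡ-+ c (g v) (sum (map g L))))

total-sumTo : ∀ k n (g : Vec Bool k → ℕ → ℕ) → total k (λ v → sumTo n (g v)) ≡ sumTo n (λ i → total k (λ v → g v i))
total-sumTo k zero g = total-const k 0
total-sumTo k (suc n) g = trans (total-+ k (λ v → g v 0) (λ v → sumTo n (λ i → g v (suc i))))
  (cong (total k (λ v → g v 0) +_) (total-sumTo k n (λ v i → g v (suc i))))

total-split : ∀ m k (g : Vec Bool m → Vec Bool k → ℕ) →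
  total (m + k) (λ v → g (Vec.take m v) (Vec.drop m v)) ≡ total m (λ a → total k (g a))
total-split zero k g = sym (+-identityʳ _)
total-split (suc m) k g = begin
  total (suc m + k) (λ v → g (Vec.take (suc m) v) (Vec.drop (suc m) v))
    ≡⟨ total-suc (m + k) _ ⟩
  total (m + k) (λ v → g (false ∷ Vec.take m v) (Vec.drop m v)) +
  total (m + k) (λ v → g (true ∷ Vec.take m v) (Vec.drop m v))
    ≡⟨ cong₂ _+_ (total-split m k (λ a → g (false ∷ a))) (total-split m k (λ a → g (true ∷ a))) ⟩
  total m (λ a → total k (g (false ∷ a))) + total m (λ a → total k (g (true ∷ a)))
    ≡⟨ total-suc m (λ a → total k (g a)) ⟨
  total (suc m) (λ a → total k (g a)) ∎
  where open ≡-Reasoning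

-- The frequency of propagating stretches

allProp : (ℕ → Op) → ℕ → ℕ → Bool
allProp q i zero = true
allProp q i (suc k) = isProp (q i) ∧ allProp q (suc i) k

allProp-suc : ∀ q i k → allProp q (suc i) k ≡ allProp (λ j → q (suc j)) i k
allProp-suc q i zero = refl
allProp-suc q i (suc k) = cong (isProp (q (suc i)) ∧_) (allProp-suc q (suc i) k)

opsOf : ∀ {n} → Vec Bool n → Vec Bool n → ℕ → Op
opsOf a b k = opOf (at a k) (at b k)

-- For a fixed first summand, propagation pins down one bit of the second per position.
propagating : ∀ n (a : Vec Bool n) i k → total n (λ b → bitLabel (allProp (opsOf a b) i k)) * 2 ^ k ≤ 2 ^ n
propagating n a i zero = ≤-reflexive (trans (*-identityʳ _) (trans (total-const n 1) (*-identityˡ _)))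
-- Past the last bit both summands read 0 and the operation is `kill`, so the stretch occurs for no
-- input.
propagating zero [] i (suc k) = z≤n
propagating (suc n) (x ∷ a) (suc i) (suc k) = begin
  total (suc n) (λ b → bitLabel (allProp (opsOf (x ∷ a) b) (suc i) (suc k))) * 2 ^ suc k
    ≡⟨ cong (_* 2 ^ suc k) (total-suc n _) ⟩
  (total n (λ b → bitLabel (allProp (opsOf (x ∷ a) (false ∷ b)) (suc i) (suc k))) +
   total n (λ b → bitLabel (allProp (opsOf (x ∷ a) (true ∷ b)) (suc i) (suc k)))) * 2 ^ suc k
    ≡⟨ cong₂ (λ y z → (y + z) * 2 ^ suc k)
         (total-cong n (λ b → cong bitLabel (allProp-suc (opsOf (x ∷ a) (false ∷ b)) i (suc k))))
         (total-cong n (λ b → cong bitLabel (allProp-suc (opsOf (x ∷ a) (true ∷ b)) i (suc k)))) ⟩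
  (s + s) * 2 ^ suc k
    ≡⟨ solve 2 (λ s p → (s :+ s) :* p := con 2 :* (s :* p)) refl s (2 ^ suc k) ⟩
  2 * (s * 2 ^ suc k)
    ≤⟨ *-monoʳ-≤ 2 (propagating n a i (suc k)) ⟩
  2 * 2 ^ n ∎
  where
    open ≤-Reasoning
    open +-*-Solver
    s = total n (λ b → bitLabel (allProp (opsOf a b) i (suc k)))
propagating (suc n) (x ∷ a) zero (suc k) = begin
  total (suc n) (λ b → bitLabel (allProp (opsOf (x ∷ a) b) 0 (suc k))) * 2 ^ suc k
    ≡⟨ cong (_* 2 ^ suc k) (total-suc n _) ⟩
  (total n (λ b → bitLabel (allProp (opsOf (x ∷ a) (false ∷ b)) 0 (suc k))) +
   total n (λ b → bitLabel (allProp (opsOf (x ∷ a) (true ∷ b)) 0 (suc k)))) * 2 ^ suc k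
    ≡⟨ cong (_* 2 ^ suc k) (once x refl) ⟩
  s * 2 ^ suc k
    ≡⟨ solve 2 (λ s p → s :* (con 2 :* p) := con 2 :* (s :* p)) refl s (2 ^ k) ⟩
  2 * (s * 2 ^ k)
    ≤⟨ *-monoʳ-≤ 2 (propagating n a 0 k) ⟩
  2 * 2 ^ n ∎
  where
    open ≤-Reasoning
    open +-*-Solver
    s = total n (λ b → bitLabel (allProp (opsOf a b) 0 k))
    blocked : ∀ y → isProp (opOf x y) ≡ false →
      total n (λ b → bitLabel (allProp (opsOf (x ∷ a) (y ∷ b)) 0 (suc k))) ≡ 0
    blocked y e = trans (total-cong n (λ b → cong (λ c → bitLabel (c ∧ allProp (opsOf (x ∷ a) (y ∷ b)) 1 k)) e)) (total-const n 0)
    through : ∀ y → isProp (opOf x y) ≡ true →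
      total n (λ b → bitLabel (allProp (opsOf (x ∷ a) (y ∷ b)) 0 (suc k))) ≡ s
    through y e = total-cong n (λ b → trans
      (cong (λ c → bitLabel (c ∧ allProp (opsOf (x ∷ a) (y ∷ b)) 1 k)) e)
      (cong bitLabel (allProp-suc (opsOf (x ∷ a) (y ∷ b)) 0 k)))
    once : ∀ z → x ≡ z → total n (λ b → bitLabel (allProp (opsOf (x ∷ a) (false ∷ b)) 0 (suc k))) +
      total n (λ b → bitLabel (allProp (opsOf (x ∷ a) (true ∷ b)) 0 (suc k))) ≡ s
    once true refl = trans (cong₂ _+_ (through false refl) (blocked true refl)) (+-identityʳ s)
    once false refl = cong₂ _+_ (blocked false refl) (through true refl)

-- The average of the longest run

module Average (n : ℕ) where
  K : ℕ
  K = suc ⌊log₂ n ⌋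

  n≤2^K : n ≤ 2 ^ K
  n≤2^K with n ≤? 2 ^ K
  ... | yes l = l
  ... | no n≰ = ⊥-elim (1+n≰n (≤-trans (≤-reflexive (sym (⌊log₂[2^n]⌋≡n K))) (⌊log₂⌋-mono-≤ (<⇒≤ (≰⇒> n≰)))))

  streaks : Vec Bool (n + n) → ℕ
  streaks b = sumTo n λ i → sumTo n λ j → bitLabel (allProp (opAt n b) i (K + suc j))

  -- Bounds every run of propagating positions, but is a sum of indicators and so easy to average.
  longest : Vec Bool (n + n) → ℕ
  longest b = K + streaks b

  streak-count : ∀ i k → total (n + n) (λ b → bitLabel (allProp (opAt n b) i k)) * 2 ^ k ≤ 2 ^ (n + n)
  streak-count i k = begin
    total (n + n) (λ b → bitLabel (allProp (opAt n b) i k)) * 2 ^ k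
      ≡⟨ cong (_* 2 ^ k) (total-split n n (λ a b → bitLabel (allProp (opsOf a b) i k))) ⟩
    total n (λ a → total n (λ b → bitLabel (allProp (opsOf a b) i k))) * 2 ^ k
      ≡⟨ *-comm _ (2 ^ k) ⟩
    2 ^ k * total n (λ a → total n (λ b → bitLabel (allProp (opsOf a b) i k)))
      ≡⟨ total-* n (2 ^ k) _ ⟨
    total n (λ a → 2 ^ k * total n (λ b → bitLabel (allProp (opsOf a b) i k)))
      ≤⟨ total-mono n (λ a → ≤-trans (≤-reflexive (*-comm (2 ^ k) _)) (propagating n a i k)) ⟩
    total n (λ _ → 2 ^ n)
      ≡⟨ total-const n (2 ^ n) ⟩
    2 ^ n * 2 ^ n
      ≡⟨ ^-distribˡ-+-* 2 n n ⟨
    2 ^ (n + n) ∎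
    where open ≤-Reasoning

  -- A stretch of length `K + suc j` from a given start has probability at most 2 to the minus that
  -- length. Over all `j` this sums to at most 2 to the minus `K`, and there are only `n ≤ 2 ^ K`
  -- starts; so on average there is at most one streak.
  streaks-total : total (n + n) streaks ≤ 2 ^ (n + n)
  streaks-total = *-cancelˡ-≤ (2 ^ K) {{m^n≢0 2 K}} (begin
    2 ^ K * total (n + n) streaks
      ≡⟨ cong (2 ^ K *_) (trans (total-sumTo (n + n) n _) refl) ⟩
    2 ^ K * sumTo n (λ i → total (n + n) (λ b → sumTo n λ j → bitLabel (allProp (opAt n b) i (K + suc j))))
      ≡⟨ sumTo-* n (2 ^ K) _ ⟨
    sumTo n (λ i → 2 ^ K * total (n + n) (λ b → sumTo n λ j → bitLabel (allProp (opAt n b) i (K + suc j))))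
      ≤⟨ sumTo-≤ n _ M per-start ⟩
    n * M
      ≤⟨ *-monoˡ-≤ M n≤2^K ⟩
    2 ^ K * M ∎)
    where
      open ≤-Reasoning
      M = 2 ^ (n + n)
      count : ℕ → ℕ → ℕ
      count i j = total (n + n) (λ b → bitLabel (allProp (opAt n b) i (K + suc j)))
      per-start : ∀ i → 2 ^ K * total (n + n) (λ b → sumTo n λ j → bitLabel (allProp (opAt n b) i (K + suc j))) ≤ M
      per-start i = begin
        2 ^ K * total (n + n) (λ b → sumTo n λ j → bitLabel (allProp (opAt n b) i (K + suc j)))
          ≡⟨ cong (2 ^ K *_) (total-sumTo (n + n) n _) ⟩
        2 ^ K * sumTo n (count i)
          ≡⟨ sumTo-* n (2 ^ K) (count i) ⟨
        sumTo n (λ j → 2 ^ K * count i j)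
          ≤⟨ geometric n _ M (λ j → ≤-trans (≤-reflexive (trans
               (solve 3 (λ p c r → p :* c :* r := c :* (p :* r)) refl (2 ^ K) (count i j) (2 ^ suc j))
               (cong (count i j *_) (sym (^-distribˡ-+-* 2 K (suc j)))))) (streak-count i (K + suc j))) ⟩
        M ∎
        where open +-*-Solver

  longest-total : total (n + n) longest ≤ suc K * 2 ^ (n + n)
  longest-total = begin
    total (n + n) longest                             ≡⟨ total-+ (n + n) (λ _ → K) streaks ⟩
    total (n + n) (λ _ → K) + total (n + n) streaks   ≤⟨ +-mono-≤ (≤-reflexive (total-const (n + n) K)) streaks-total ⟩
    K * 2 ^ (n + n) + 2 ^ (n + n)                     ≡⟨ +-comm (K * 2 ^ (n + n)) _ ⟩
    suc K * 2 ^ (n + n)                               ∎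
    where open ≤-Reasoning

  module _ (b : Vec Bool (n + n)) where
    q : ℕ → Op
    q = opAt n b

    Between : ℕ → ℕ → Set
    Between i e = ∀ k → i ≤ k → k < e → q k ≡ prop

    -- Past the last bit the operation is `kill`, so no run leaves the `n` bits, and `streaks` may
    -- stop its sums at `n`.
    beyond : ∀ k → q k ≡ prop → k < n
    beyond k e with n ≤? k
    ... | no n≰k = ≰⇒> n≰k
    ... | yes n≤k with () ← trans (sym e) (cong₂ opOf (at-beyond (Vec.take n b) k n≤k) (at-beyond (Vec.drop n b) k n≤k))

    between-allProp : ∀ i ℓ → Between i (i + ℓ) → allProp q i ℓ ≡ true
    between-allProp i zero h = refl
    between-allProp i (suc ℓ) h
      rewrite h i ≤-refl (m<m+n i (s≤s z≤n)) =
      between-allProp (suc i) ℓ λ k l l′ → h k (<⇒≤ l) (≤-trans l′ (≤-reflexive (sym (+-suc i ℓ))))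

    -- A run of length `K + m` contains the stretches of lengths `K + 1` to `K + m` from its first
    -- position, and `streaks` counts each of them.
    between-longest : ∀ i ℓ e → i + ℓ ≡ e → Between i e → ℓ ≤ longest b
    between-longest i ℓ _ refl h with ℓ ≤? K
    ... | yes l = ≤-trans l (m≤m+n K (streaks b))
    ... | no ℓ≰K with m≤n⇒∃[o]m+o≡n (<⇒≤ (≰⇒> ℓ≰K))
    ...   | m , refl = +-monoʳ-≤ K (≤-trans
            (sumTo-ones n (λ j → bitLabel (allProp q i (K + suc j))) m m≤n ones)
            (sumTo-term (λ i → sumTo n λ j → bitLabel (allProp q i (K + suc j))) i<n))
      where
        i<n : i < n
        i<n = beyond i (h i ≤-refl (m<m+n i (s≤s z≤n)))
        within : ∀ ℓ′ → suc ℓ′ ≤ K + m → suc (i + ℓ′) ≤ n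
        within ℓ′ l = beyond (i + ℓ′) (h (i + ℓ′) (m≤m+n i ℓ′) (≤-trans (≤-reflexive (sym (+-suc i ℓ′))) (+-monoʳ-≤ i l)))
        m≤n : m ≤ n
        m≤n = ≤-trans (≤-trans (m≤n+m m ⌊log₂ n ⌋) (m≤n+m _ (suc i))) (within (⌊log₂ n ⌋ + m) ≤-refl)
        ones : ∀ j → j < m → 1 ≤ bitLabel (allProp q i (K + suc j))
        ones j l rewrite between-allProp i (K + suc j) (λ k p p′ → h k p (≤-trans p′ (+-monoʳ-≤ i (+-monoʳ-≤ K l)))) = ≤-refl

    between-trans : ∀ i e f → Between i e → Between e f → Between i f
    between-trans i e f h h′ k l l′ with e ≤? k
    ... | yes p = h′ k p l′
    ... | no p = h k l (≰⇒> p)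

    between-one : ∀ e → q e ≡ prop → Between e (suc e)
    between-one e h k l (s≤s l′) with refl ← ≤-antisym l l′ = h

    between-empty : ∀ e → Between e e
    between-empty e k l l′ = ⊥-elim (<⇒≱ l′ l)

  -- Waiting times against the longest run

  module _ (w : ℕ) (0<w : 0 < w) (b : Vec Bool (n + n)) where
    open Layout n w using (lo; hi)
    open Links n w 0<w using (inwards; ρ; μ; β)

    private
      isProp-prop : ∀ {o} → isProp o ≡ true → o ≡ prop
      isProp-prop {prop} _ = refl

      Run : ℕ → ℕ → Set
      Run ℓ e = ∃ λ i → i + ℓ ≡ e × Between b i e

      run-suc : ∀ {ℓ e} → Run ℓ e → q b e ≡ prop → Run (suc ℓ) (suc e)
      run-suc {ℓ} {e} (i , eq , h) p =
        i , trans (+-suc i ℓ) (cong suc eq) , between-trans b i e (suc e) h (between-one b e p)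

      run-zero : ∀ e → Run 0 e
      run-zero e = e , +-identityʳ e , between-empty b e

      -- Going inwards on the upper leg lowers the position, so the run counted by `inwards` is one
      -- of consecutive positions whose last is the upper position of supercell `x`.
      inwards-run : ∀ r m x → w ∸ x ≡ m → Run (inwards b r x m) (double m + lo x r)
      inwards-run r zero x _ = run-zero _
      inwards-run r (suc m) x e with isProp (q b (hi x r)) in p
      ... | false = run-zero _
      ... | true = subst (Run _) (cong suc (trans at-hi (+-suc (double m) (lo x r))))
          (run-suc (subst (Run _) (sym at-hi) (inwards-run r m (suc x) m≡)) (isProp-prop p))
        where
          x<w : x < w
          x<w = m∸n≢0⇒n<m λ z → 1+n≢0 (trans (sym e) z)
          m≡ : w ∸ suc x ≡ m
          m≡ = suc-injective (trans (sym (∸-step x<w)) e)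
          at-hi : hi x r ≡ double m + suc (lo x r)
          at-hi = cong (λ z → double z + suc (lo x r)) m≡

      μ-run : ∀ r x → Run (μ b r x) (lo x r)
      μ-run r zero = run-zero _
      μ-run r (suc x) with isProp (q b (lo x r)) in p
      ... | false = run-zero _
      ... | true = run-suc (μ-run r x) (isProp-prop p)

      -- A propagating block consists of propagating positions only, by `span-prop`; so a chain of
      -- such blocks is a run `double w` times as long.
      β-run : ∀ r → Run (β b r * double w) (lo 0 r)
      β-run zero = run-zero 0
      β-run (suc r) with isProp (span (q b) (lo 0 r) w) in p
      ... | false = run-zero _
      ... | true with i , eq , h ← β-run r =
        i , trans (trans (cong (i +_) (+-comm (double w) _)) (trans (sym (+-assoc i _ (double w))) (cong (_+ double w) eq)))
              (+-comm (lo 0 r) (double w)) ,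
        between-trans b i (lo 0 r) (lo 0 (suc r)) h λ k l l′ →
          subst (λ z → q b z ≡ prop) (m∸n+n≡m l) (span-prop (q b) w (lo 0 r) (isProp-prop p) (k ∸ lo 0 r)
            (+-cancelʳ-< (lo 0 r) _ _ (≤-trans (≤-reflexive (cong suc (m∸n+n≡m l))) l′)))

    ρ≤longest : ∀ x r → ρ b x r ≤ longest b
    ρ≤longest x r with i , eq , h ← inwards-run r (w ∸ x) x refl = between-longest b i _ _ eq h

    μ≤longest : ∀ x r → μ b r x ≤ longest b
    μ≤longest x r with i , eq , h ← μ-run r x = between-longest b i _ _ eq h

    β≤longest : ∀ r → β b r ≤ longest b
    β≤longest r with i , eq , h ← β-run r = ≤-trans
      (m≤m*n (β b r) (double w) {{double-nonZero 0<w}}) (between-longest b i _ _ eq h)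
      where
        double-nonZero : ∀ {w} → 0 < w → NonZero (double w)
        double-nonZero {suc _} _ = _

-- Running time

integer-sqrt : ∀ n → 1 ≤ n → ∃ λ s → 1 ≤ s × s * s ≤ n × n < suc s * suc s
integer-sqrt (suc zero) _ = 1 , ≤-refl , ≤-refl , s≤s (s≤s z≤n)
integer-sqrt (suc n@(suc _)) _ with integer-sqrt n (s≤s z≤n)
... | s , 1≤s , lower , upper with suc s * suc s ≤? suc n
...   | no above = s , 1≤s , ≤-trans lower (n≤1+n n) , ≰⇒> above
...   | yes fits = suc s , s≤s z≤n , fits ,
  ≤-trans (s≤s upper) (*-mono-< {suc s} {suc (suc s)} {suc s} {suc (suc s)} ≤-refl ≤-refl)

budget : ℕ → ℕ → ℕ
budget ℓ Λ = 9 + (ℓ * 8 + (7 + (Λ * 7 + (18 + ℓ * 8))))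

budget-linear : ∀ ℓ → budget ℓ ℓ ≡ 34 + 23 * ℓ
budget-linear = solve 1 (λ ℓ → con 9 :+ (ℓ :* con 8 :+ (con 7 :+ (ℓ :* con 7 :+ (con 18 :+ ℓ :* con 8)))) :=
  con 34 :+ con 23 :* ℓ) refl
  where open +-*-Solver

module Fast (n s : ℕ) (1≤s : 1 ≤ s) (lower : s * s ≤ n) (upper : n < suc s * suc s) where
  w : ℕ
  w = suc s

  n<area : n < w * double w
  n<area = ≤-trans upper (*-monoʳ-≤ w (≤-trans (m≤m+n w w) (≤-reflexive (sym (double≡ w)))))

  open Adder n w (s≤s z≤n) n<area
  open Links n w (s≤s z≤n)
  open Laws n w (s≤s z≤n)
  open Average n

  runs : ∀ b → ∃ λ k → RunTimeOn adder b k × k ≤ 34 + 23 * w × k ≤ 34 + 23 * longest b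
  runs b = let k , timed , bound = Run.run-time-bound b in k , timed ,
    ≤-trans (bound w w (λ {x} {r} _ _ → ρ≤w b {x} {r}) (λ {r} r≤ → ≤-trans (β≤r b r) r≤)
        (λ {x} {r} x≤ _ → ≤-trans (μ≤x b r x) x≤))
      (≤-reflexive (budget-linear w)) ,
    ≤-trans (bound (longest b) (longest b) (λ {x} {r} _ _ → ρ≤longest w (s≤s z≤n) b x r)
        (λ {r} _ → β≤longest w (s≤s z≤n) b r) (λ {x} {r} _ _ → μ≤longest w (s≤s z≤n) b x r))
      (≤-reflexive (budget-linear (longest b)))

  rt : Vec Bool (n + n) → ℕ
  rt b = proj₁ (runs b)

  -- The bound by the root of `n` is stated in squares, which avoids roots.
  worst : ∀ b → rt b * rt b ≤ 103 * 103 * n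
  worst b = begin
    rt b * rt b            ≤⟨ *-mono-≤ linear linear ⟩
    103 * s * (103 * s)    ≡⟨ solve 1 (λ s → con 103 :* s :* (con 103 :* s) := con 103 :* con 103 :* (s :* s)) refl s ⟩
    103 * 103 * (s * s)    ≤⟨ *-monoʳ-≤ (103 * 103) lower ⟩
    103 * 103 * n          ∎
    where
      open ≤-Reasoning
      open +-*-Solver
      linear : rt b ≤ 103 * s
      linear = begin
        rt b               ≤⟨ proj₁ (proj₂ (proj₂ (runs b))) ⟩
        34 + 23 * suc s    ≡⟨ solve 1 (λ s → con 34 :+ con 23 :* (con 1 :+ s) := con 57 :* con 1 :+ con 23 :* s) refl s ⟩
        -- 57 is raised to 80 so that the constant becomes the one of `average`.
        57 * 1 + 23 * s    ≤⟨ +-monoˡ-≤ (23 * s) (*-mono-≤ (m≤m+n 57 23) 1≤s) ⟩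
        80 * s + 23 * s    ≡⟨ *-distribʳ-+ s 80 23 ⟨
        103 * s            ∎

  average : 2 ≤ n → sum (map rt (allBits (n + n))) ≤ 103 * ⌊log₂ n ⌋ * 2 ^ (n + n)
  average 2≤n = begin
    total (n + n) rt
      ≤⟨ total-mono (n + n) (λ b → proj₂ (proj₂ (proj₂ (runs b)))) ⟩
    total (n + n) (λ b → 34 + 23 * longest b)
      ≡⟨ total-+ (n + n) (λ _ → 34) (λ b → 23 * longest b) ⟩
    total (n + n) (λ _ → 34) + total (n + n) (λ b → 23 * longest b)
      ≡⟨ cong₂ _+_ (total-const (n + n) 34) (total-* (n + n) 23 longest) ⟩
    34 * M + 23 * total (n + n) longest
      ≤⟨ +-monoʳ-≤ (34 * M) (*-monoʳ-≤ 23 longest-total) ⟩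
    34 * M + 23 * (suc (suc L) * M)
      ≡⟨ solve 2 (λ L M → con 34 :* M :+ con 23 :* ((con 2 :+ L) :* M) := (con 80 :* con 1 :+ con 23 :* L) :* M) refl L M ⟩
    (80 * 1 + 23 * L) * M
      -- Here 80 is 34 + 2 * 23. It is absorbed since `L` is at least 1, which needs `n` to be at
      -- least 2; this gives 80 + 23 = 103.
      ≤⟨ *-monoˡ-≤ M (+-monoˡ-≤ (23 * L) (*-monoʳ-≤ 80 (⌊log₂⌋-mono-≤ 2≤n))) ⟩
    (80 * L + 23 * L) * M
      ≡⟨ cong (_* M) (*-distribʳ-+ L 80 23) ⟨
    103 * L * M ∎
    where
      open ≤-Reasoning
      open +-*-Solver
      L = ⌊log₂ n ⌋
      M = 2 ^ (n + n)

  solution : Σ (TAC (n + n) (suc n)) λ M → Computes M (adderFun n) ×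
    Σ (Vec Bool (n + n) → ℕ) λ rt → (∀ b → RunTimeOn M b (rt b)) ×
    (2 ≤ n → sum (map rt (allBits (n + n))) ≤ 103 * ⌊log₂ n ⌋ * 2 ^ (n + n) ×
      (∀ b → rt b * rt b ≤ 103 * 103 * n))
  solution = adder , Run.computes , rt , (λ b → proj₁ (proj₂ (runs b))) , λ 2≤n → average 2≤n , worst

theorem5 : ∃[ c ] ∃[ n₀ ] ∀ (n : ℕ) → 1 ≤ n →
    Σ (TAC (n + n) (suc n)) λ M → Computes M (adderFun n) ×
    Σ (Vec Bool (n + n) → ℕ) λ rt →
    (∀ b → RunTimeOn M b (rt b)) ×
    (n₀ ≤ n →
    sum (map rt (allBits (n + n))) ≤ c * ⌊log₂ n ⌋ * 2 ^ (n + n)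
    × (∀ b → rt b * rt b ≤ c * c * n))
theorem5 = 103 , 2 , λ n 1≤n →
  let s , 1≤s , lower , upper = integer-sqrt n 1≤n in Fast.solution n s 1≤s lower upper
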